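{- Let $\mu_X$ and $\mu_X'$ be the probability measures on $\mathbb{T}$ defined by $$\mu_X=\frac{1}{\#\Omega(X)}\sum_{(T_{p,q},\alpha)\in\Omega(X)}\delta_\alpha,\qquad \mu_X'=\frac{1}{\#\Omega_1(X)}\sum_{(T_{p,q},\alpha)\in\Omega_1(X)}\delta_\alpha,$$ where $\delta_\alpha$ denotes the Dirac mass at $\alpha\in\mathbb{T}$. Then both $\mu_X$ and $\mu_X'$ converge weakly to $\mu_{\mathbb{T}}$ as $X\to\infty$.
   Context: $\mathbb{T}=\{z\in\mathbb{C}:|z|=1\}$ and $\mu_{\mathbb{T}}$ is the normalized Haar measure on $\mathbb{T}$. For positive integers $p,q$ let $T_{p,q}$ be the $(p,q)$-torus link, $d=\gcd(p,q)$, $L=\operatorname{lcm}(p,q)$, with single-variable Alexander polynomial $$\Delta_{p,q}(t)=\frac{(t^{L}-1)^{d}(t-1)}{(t^{p}-1)(t^{q}-1)}$$ (for $d=1$ this is the Alexander polynomial $\frac{(t^{pq}-1)(t-1)}{(t^p-1)(t^q-1)}$ of the torus knot). All its roots are roots of unity. Links are indexed by ordered pairs $(p,q)$. For $X>0$, $\Omega(X)$ is the multiset of pairs $(T_{p,q},\alpha)$ with $1\le p,q\le X$ and $\alpha$ a root of $\Delta_{p,q}(t)$, counted with multiplicity; $\Omega_1(X)$ is the set of pairs $(T_{p,q},\alpha)$ with $1\le p,q\le X$, $\gcd(p,q)=1$ and $\alpha$ a root of $\Delta_{p,q}(t)$. The measures are considered for $X$ large enough that $\Omega(X)$ and $\Omega_1(X)$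 are nonempty. -}

module Defs where

open import Algebra.Bundles using (CommutativeMonoid; CommutativeRing; RawRing)
import Algebra.Definitions.RawSemiring as RawSemiringDefinitions
import Algebra.Properties.CommutativeSemigroup as CommutativeSemigroupProperties
open import Algebra.Structures using (IsCommutativeRing)
open import Data.Bool.Base using (if_then_else_)
open import Data.Fin.Base using (toℕ)
import Data.Integer.Base as ℤ
open import Data.Integer.Solver renaming (module +-*-Solver to ℤSolver)
open import Data.List.Base
  using (List; foldr; map; length; applyUpTo; cartesianProduct; concatMap; filter)
open import Data.List.Relation.Unary.Any using (Any)
import Data.List.Relation.Unary.Unique.Setoid as UniqueSetoid
open import Data.Nat.Base as ℕ using (ℕ; zero; suc)
import Data.Nat.Divisibility as ℕ
open import Data.Nat.GCD using (gcd)
open import Data.Nat.LCM using (lcm)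
import Data.Nat.Properties as ℕ
open import Data.Product.Base using (Σ; ∃; _×_; _,_; proj₂)
open import Data.Rational.Base as ℚ using (ℚ; 0ℚ; 1ℚ; ½; Positive)
import Data.Rational.Properties as ℚ
import Data.Rational.Unnormalised.Base as ℚᵘ
import Data.Rational.Unnormalised.Properties as ℚᵘ
open import Data.Rational.Solver using (module +-*-Solver)
open import Data.Sum.Base using (inj₁; inj₂)
open import Function.Base using (_∘_)
open import Function.Bundles using (_⇔_)
open import Level using (0ℓ)
open import Relation.Binary.Bundles using (Setoid)
open import Relation.Binary.PropositionalEquality
  using (_≡_; refl; sym; trans; cong; cong₂; subst; subst₂)
import Relation.Binary.Reasoning.Setoid as SetoidReasoning
open import Relation.Nullary.Decidable using (does)
open import Relation.Nullary.Negation using (¬_)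

module _ where
  ½⁺ : ∀ ε .{{_ : Positive ε}} → Positive (½ ℚ.* ε)
  ½⁺ ε = ℚ.pos*pos⇒pos ½ ε

  ½+½ : ∀ ε → ½ ℚ.* ε ℚ.+ ½ ℚ.* ε ≡ ε
  ½+½ ε = trans (sym (ℚ.*-distribʳ-+ ε ½ ½)) (ℚ.*-identityˡ ε)

  ≤-respˡ : ∀ {a b c} → a ≡ b → a ℚ.≤ c → b ℚ.≤ c
  ≤-respˡ refl p = p

  dist : ℚ → ℚ → ℚ
  dist a b = ℚ.∣ a ℚ.- b ∣

  dist-refl : ∀ a → dist a a ≡ 0ℚ
  dist-refl a = cong ℚ.∣_∣ (ℚ.+-inverseʳ a)

  dist-sym : ∀ a b → dist a b ≡ dist b a
  dist-sym a b = trans (cong ℚ.∣_∣ (eq a b)) (ℚ.∣-p∣≡∣p∣ (b ℚ.- a))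
    where
    open +-*-Solver
    eq : ∀ a b → a ℚ.- b ≡ ℚ.- (b ℚ.- a)
    eq = solve 2 (λ a b → a :- b := :- (b :- a)) refl

  dist-trans : ∀ a b c → dist a c ℚ.≤ dist a b ℚ.+ dist b c
  dist-trans a b c = ≤-respˡ (cong ℚ.∣_∣ (eq a b c))
    (ℚ.∣p+q∣≤∣p∣+∣q∣ (a ℚ.- b) (b ℚ.- c))
    where
    open +-*-Solver
    eq : ∀ a b c → (a ℚ.- b) ℚ.+ (b ℚ.- c) ≡ a ℚ.- c
    eq = solve 3 (λ a b c → (a :- b) :+ (b :- c) := a :- c) refl

  dist-+ : ∀ a b c d → dist (a ℚ.+ b) (c ℚ.+ d) ℚ.≤ dist a c ℚ.+ dist b d
  dist-+ a b c d = ≤-respˡ (cong ℚ.∣_∣ (eq a b c d))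
    (ℚ.∣p+q∣≤∣p∣+∣q∣ (a ℚ.- c) (b ℚ.- d))
    where
    open +-*-Solver
    eq : ∀ a b c d → (a ℚ.- c) ℚ.+ (b ℚ.- d) ≡ (a ℚ.+ b) ℚ.- (c ℚ.+ d)
    eq = solve 4 (λ a b c d → (a :- c) :+ (b :- d) := (a :+ b) :- (c :+ d)) refl

  dist-neg : ∀ a b → dist (ℚ.- a) (ℚ.- b) ≡ dist a b
  dist-neg a b = trans (cong ℚ.∣_∣ (eq a b)) (ℚ.∣-p∣≡∣p∣ (a ℚ.- b))
    where
    open +-*-Solver
    eq : ∀ a b → ℚ.- a ℚ.- ℚ.- b ≡ ℚ.- (a ℚ.- b)
    eq = solve 2 (λ a b → :- a :- :- b := :- (a :- b)) refl

  dist-* : ∀ a b c d → dist (a ℚ.* b) (c ℚ.* d) ℚ.≤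
           ℚ.∣ a ∣ ℚ.* dist b d ℚ.+ ℚ.∣ d ∣ ℚ.* dist a c
  dist-* a b c d = subst₂ ℚ._≤_ (cong ℚ.∣_∣ (eq a b c d))
    (cong₂ ℚ._+_ (ℚ.∣p*q∣≡∣p∣*∣q∣ a _) (ℚ.∣p*q∣≡∣p∣*∣q∣ d _))
    (ℚ.∣p+q∣≤∣p∣+∣q∣ (a ℚ.* (b ℚ.- d)) (d ℚ.* (a ℚ.- c)))
    where
    open +-*-Solver
    eq : ∀ a b c d → a ℚ.* (b ℚ.- d) ℚ.+ d ℚ.* (a ℚ.- c) ≡ (a ℚ.* b) ℚ.- (c ℚ.* d)
    eq = solve 4 (λ a b c d →
           a :* (b :- d) :+ d :* (a :- c) := (a :* b) :- (c :* d)) refl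

  ∣a∣≤∣b∣+dist : ∀ a b → ℚ.∣ a ∣ ℚ.≤ ℚ.∣ b ∣ ℚ.+ dist a b
  ∣a∣≤∣b∣+dist a b = ≤-respˡ (cong ℚ.∣_∣ (eq a b))
    (ℚ.∣p+q∣≤∣p∣+∣q∣ b (a ℚ.- b))
    where
    open +-*-Solver
    eq : ∀ a b → b ℚ.+ (a ℚ.- b) ≡ a
    eq = solve 2 (λ a b → b :+ (a :- b) := a) refl

  a≤c+b⇒a-c≤b : ∀ {a b} c → a ℚ.≤ c ℚ.+ b → a ℚ.- c ℚ.≤ b
  a≤c+b⇒a-c≤b {a} {b} c p =
    subst (a ℚ.- c ℚ.≤_) (eq c b) (ℚ.+-monoˡ-≤ (ℚ.- c) p)
    where
    open +-*-Solver
    eq : ∀ c b → (c ℚ.+ b) ℚ.- c ≡ b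
    eq = solve 2 (λ c b → (c :+ b) :- c := b) refl

  dist-∣∣ : ∀ a b → dist (ℚ.∣ a ∣) (ℚ.∣ b ∣) ℚ.≤ dist a b
  dist-∣∣ a b with ℚ.∣p∣≡p∨∣p∣≡-p (ℚ.∣ a ∣ ℚ.- ℚ.∣ b ∣)
  ... | inj₁ e = ≤-respˡ (sym e)
        (a≤c+b⇒a-c≤b ℚ.∣ b ∣ (∣a∣≤∣b∣+dist a b))
  ... | inj₂ e = subst₂ ℚ._≤_ (sym (trans e (eq ℚ.∣ a ∣ ℚ.∣ b ∣))) (dist-sym b a)
        (a≤c+b⇒a-c≤b ℚ.∣ a ∣ (∣a∣≤∣b∣+dist b a))
    where
    open +-*-Solver
    eq : ∀ a b → ℚ.- (a ℚ.- b) ≡ b ℚ.- a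
    eq = solve 2 (λ a b → :- (a :- b) := b :- a) refl

  *-bound : ∀ {a b c d} .{{_ : ℚ.NonNegative a}} .{{_ : ℚ.NonNegative d}} →
            a ℚ.≤ b → c ℚ.≤ d → a ℚ.* c ℚ.≤ b ℚ.* d
  *-bound {a} {d = d} a≤b c≤d =
    ℚ.≤-trans (ℚ.*-monoˡ-≤-nonNeg a c≤d) (ℚ.*-monoʳ-≤-nonNeg d a≤b)

-- Real numbers: Cauchy sequences of rationals with a modulus.  All
-- operations are pointwise; real equality is _≈_, not _≡_.

Eventually : (ℕ → Set) → Set
Eventually P = ∃ λ N → ∀ n → N ℕ.≤ n → P n

record ℝ : Set where
  no-eta-equality
  constructor mkℝ
  field
    seq    : ℕ → ℚ
    cauchy : ∀ ε .{{_ : Positive ε}} →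
             ∃ λ N → ∀ m n → N ℕ.≤ m → N ℕ.≤ n → ℚ.∣ seq m ℚ.- seq n ∣ ℚ.≤ ε

open ℝ public

infix 4 _≈_ _≤_

record _≈_ (x y : ℝ) : Set where
  constructor mk≈
  field
    close : ∀ ε .{{_ : Positive ε}} → Eventually λ n → ℚ.∣ seq x n ℚ.- seq y n ∣ ℚ.≤ ε

record _≤_ (x y : ℝ) : Set where
  constructor mk≤
  field
    below : ∀ ε .{{_ : Positive ε}} → Eventually λ n → seq x n ℚ.≤ seq y n ℚ.+ ε

open _≈_ public
open _≤_ public

module _ where
  both : ∀ {P Q R : ℕ → Set} → (∀ n → P n → Q n → R n) →
         Eventually P → Eventually Q → Eventually R
  both f (M , p) (N , q) = M ℕ.⊔ N , λ n le →
    f n (p n (ℕ.≤-trans (ℕ.m≤m⊔n M N) le)) (q n (ℕ.≤-trans (ℕ.m≤n⊔m M N) le))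

  halves : ∀ {a b c} ε → a ℚ.≤ b ℚ.+ c → b ℚ.≤ ½ ℚ.* ε → c ℚ.≤ ½ ℚ.* ε → a ℚ.≤ ε
  halves ε p q r = ℚ.≤-trans p (subst (_ ℚ.≤_) (½+½ ε) (ℚ.+-mono-≤ q r))

  bounded : ∀ x → ∃ λ B → Positive B × Eventually λ n → ℚ.∣ seq x n ∣ ℚ.≤ B
  bounded x with cauchy x 1ℚ
  ... | N , c = ℚ.∣ seq x N ∣ ℚ.+ 1ℚ
              , ℚ.nonNeg+pos⇒pos ℚ.∣ seq x N ∣ {{ℚ.∣-∣-nonNeg (seq x N)}} 1ℚ
              , N , λ n le → ℚ.≤-trans (∣a∣≤∣b∣+dist (seq x n) (seq x N))
                  (ℚ.+-monoʳ-≤ ℚ.∣ seq x N ∣ (c n N le ℕ.≤-refl))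

  share : ∀ ε B .{{_ : Positive B}} .{{_ : Positive ε}} →
          ∃ λ η → Positive η × B ℚ.* η ≡ ½ ℚ.* ε
  share ε B = ℚ.1/ B ℚ.* (½ ℚ.* ε) , pos
            , trans (sym (ℚ.*-assoc B (ℚ.1/ B) _))
                (trans (cong (ℚ._* (½ ℚ.* ε)) (ℚ.*-inverseʳ B)) (ℚ.*-identityˡ _))
    where
    instance
      B≢0 : ℚ.NonZero B
      B≢0 = ℚ.pos⇒nonZero B
    pos : Positive (ℚ.1/ B ℚ.* (½ ℚ.* ε))
    pos = ℚ.pos*pos⇒pos (ℚ.1/ B) {{ℚ.1/pos⇒pos B}} (½ ℚ.* ε) {{½⁺ ε}}

  *-close : ∀ a b c d ε A D η θ .{{_ : Positive η}} .{{_ : Positive θ}} →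
            ℚ.∣ a ∣ ℚ.≤ A → ℚ.∣ d ∣ ℚ.≤ D →
            A ℚ.* η ≡ ½ ℚ.* ε → D ℚ.* θ ≡ ½ ℚ.* ε →
            dist b d ℚ.≤ η → dist a c ℚ.≤ θ → dist (a ℚ.* b) (c ℚ.* d) ℚ.≤ ε
  *-close a b c d ε A D η θ a≤ d≤ Aη Dθ bd ac = halves ε (dist-* a b c d)
    (subst (_ ℚ.≤_) Aη (*-bound {{ℚ.∣-∣-nonNeg a}} {{ℚ.pos⇒nonNeg η}} a≤ bd))
    (subst (_ ℚ.≤_) Dθ (*-bound {{ℚ.∣-∣-nonNeg d}} {{ℚ.pos⇒nonNeg θ}} d≤ ac))

fromℚ : ℚ → ℝ
seq    (fromℚ q) _ = q
cauchy (fromℚ q) ε = 0 , λ _ _ _ _ →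
  ≤-respˡ (sym (dist-refl q)) (ℚ.nonNegative⁻¹ ε {{ℚ.pos⇒nonNeg ε}})

fromℕ : ℕ → ℝ
fromℕ n = fromℚ (ℤ.+ n ℚ./ 1)

fromℤ : ℤ.ℤ → ℝ
fromℤ i = fromℚ (i ℚ./ 1)

infixl 6 _+_ _-_
infixl 7 _*_
infix  8 -_

_+_ : ℝ → ℝ → ℝ
seq    (x + y) n = seq x n ℚ.+ seq y n
cauchy (x + y) ε =
  let (M , p) = cauchy x (½ ℚ.* ε) {{½⁺ ε}} ; (N , q) = cauchy y (½ ℚ.* ε) {{½⁺ ε}} in
  M ℕ.⊔ N , λ m n le le′ → halves ε (dist-+ (seq x m) (seq y m) (seq x n) (seq y n))
    (p m n (ℕ.≤-trans (ℕ.m≤m⊔n M N) le) (ℕ.≤-trans (ℕ.m≤m⊔n M N) le′))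
    (q m n (ℕ.≤-trans (ℕ.m≤n⊔m M N) le) (ℕ.≤-trans (ℕ.m≤n⊔m M N) le′))

-_ : ℝ → ℝ
seq    (- x) n = ℚ.- seq x n
cauchy (- x) ε =
  let (N , p) = cauchy x ε in
  N , λ m n le le′ →
    ≤-respˡ (sym (dist-neg (seq x m) (seq x n))) (p m n le le′)

_-_ : ℝ → ℝ → ℝ
x - y = x + (- y)

∣_∣ : ℝ → ℝ
seq    ∣ x ∣ n = ℚ.∣ seq x n ∣
cauchy ∣ x ∣ ε =
  let (N , p) = cauchy x ε in
  N , λ m n le le′ → ℚ.≤-trans (dist-∣∣ (seq x m) (seq x n)) (p m n le le′)

_*_ : ℝ → ℝ → ℝ
seq    (x * y) n = seq x n ℚ.* seq y n
cauchy (x * y) ε =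
  let (A , A⁺ , K , a) = bounded x
      (D , D⁺ , L , d) = bounded y
      (η , η⁺ , Aη)    = share ε A {{A⁺}}
      (θ , θ⁺ , Dθ)    = share ε D {{D⁺}}
      (M , p)          = cauchy x θ {{θ⁺}}
      (N , q)          = cauchy y η {{η⁺}}
      KL = K ℕ.⊔ L ; MN = M ℕ.⊔ N
      KL≤ = ℕ.m≤m⊔n KL MN ; MN≤ = ℕ.m≤n⊔m KL MN
      K≤ = ℕ.≤-trans (ℕ.m≤m⊔n K L) KL≤ ; L≤ = ℕ.≤-trans (ℕ.m≤n⊔m K L) KL≤
      M≤ = ℕ.≤-trans (ℕ.m≤m⊔n M N) MN≤ ; N≤ = ℕ.≤-trans (ℕ.m≤n⊔m M N) MN≤
  in KL ℕ.⊔ MN , λ m n le le′ →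
    *-close (seq x m) (seq y m) (seq x n) (seq y n) ε A D η θ {{η⁺}} {{θ⁺}}
      (a m (ℕ.≤-trans K≤ le)) (d n (ℕ.≤-trans L≤ le′)) Aη Dθ
      (q m n (ℕ.≤-trans N≤ le) (ℕ.≤-trans N≤ le′))
      (p m n (ℕ.≤-trans M≤ le) (ℕ.≤-trans M≤ le′))

0ℝ 1ℝ : ℝ
0ℝ = fromℚ 0ℚ
1ℝ = fromℚ 1ℚ

pointwise : ∀ {x y} → (∀ n → seq x n ≡ seq y n) → x ≈ y
pointwise {x} {y} eq = mk≈ λ ε → 0 , λ n _ →
  ≤-respˡ (sym (trans (cong (λ a → dist a (seq y n)) (eq n)) (dist-refl (seq y n))))
    (ℚ.nonNegative⁻¹ ε {{ℚ.pos⇒nonNeg ε}})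

≈-refl : ∀ {x} → x ≈ x
≈-refl = pointwise λ _ → refl

≈-sym : ∀ {x y} → x ≈ y → y ≈ x
≈-sym {x} {y} p = mk≈ λ ε → let (N , q) = close p ε in
  N , λ n le → ≤-respˡ (dist-sym (seq x n) (seq y n)) (q n le)

≈-trans : ∀ {x y z} → x ≈ y → y ≈ z → x ≈ z
≈-trans {x} {y} {z} p q = mk≈ λ ε →
  both (λ n → halves ε (dist-trans (seq x n) (seq y n) (seq z n)))
    (close p (½ ℚ.* ε) {{½⁺ ε}}) (close q (½ ℚ.* ε) {{½⁺ ε}})

+-cong : ∀ {x x′ y y′} → x ≈ x′ → y ≈ y′ → x + y ≈ x′ + y′
+-cong {x} {x′} {y} {y′} p q = mk≈ λ ε →
  both (λ n → halves ε (dist-+ (seq x n) (seq y n) (seq x′ n) (seq y′ n)))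
    (close p (½ ℚ.* ε) {{½⁺ ε}}) (close q (½ ℚ.* ε) {{½⁺ ε}})

-‿cong : ∀ {x y} → x ≈ y → - x ≈ - y
-‿cong {x} {y} p = mk≈ λ ε → let (N , q) = close p ε in
  N , λ n le → ≤-respˡ (sym (dist-neg (seq x n) (seq y n))) (q n le)

*-cong : ∀ {x x′ y y′} → x ≈ x′ → y ≈ y′ → x * y ≈ x′ * y′
*-cong {x} {x′} {y} {y′} p q = mk≈ λ ε →
  let (A , A⁺ , a)  = bounded x
      (D , D⁺ , d)  = bounded y′
      (η , η⁺ , Aη) = share ε A {{A⁺}}
      (θ , θ⁺ , Dθ) = share ε D {{D⁺}}
  in both (λ n (a≤ , d≤) (bd , ac) →
       *-close (seq x n) (seq y n) (seq x′ n) (seq y′ n) ε A D η θ {{η⁺}} {{θ⁺}}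
         a≤ d≤ Aη Dθ bd ac)
     (both (λ _ → _,_) a d) (both (λ _ → _,_) (close q η {{η⁺}}) (close p θ {{θ⁺}}))

ℝ-isCommutativeRing : IsCommutativeRing _≈_ _+_ _*_ -_ 0ℝ 1ℝ
ℝ-isCommutativeRing = record
  { isRing = record
    { +-isAbelianGroup = record
      { isGroup = record
        { isMonoid = record
          { isSemigroup = record
            { isMagma = record
              { isEquivalence = record { refl = ≈-refl ; sym = ≈-sym ; trans = ≈-trans }
              ; ∙-cong = +-cong
              }
            ; assoc = λ x y z → pointwise λ n → ℚ.+-assoc (seq x n) (seq y n) (seq z n)
            }
          ; identity = (λ x → pointwise λ n → ℚ.+-identityˡ (seq x n))
                     , (λ x → pointwise λ n → ℚ.+-identityʳ (seq x n))
          }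
        ; inverse = (λ x → pointwise λ n → ℚ.+-inverseˡ (seq x n))
                  , (λ x → pointwise λ n → ℚ.+-inverseʳ (seq x n))
        ; ⁻¹-cong = -‿cong
        }
      ; comm = λ x y → pointwise λ n → ℚ.+-comm (seq x n) (seq y n)
      }
    ; *-cong = *-cong
    ; *-assoc = λ x y z → pointwise λ n → ℚ.*-assoc (seq x n) (seq y n) (seq z n)
    ; *-identity = (λ x → pointwise λ n → ℚ.*-identityˡ (seq x n))
                 , (λ x → pointwise λ n → ℚ.*-identityʳ (seq x n))
    ; distrib =
        (λ x y z → pointwise λ n → ℚ.*-distribˡ-+ (seq x n) (seq y n) (seq z n))
      , (λ x y z → pointwise λ n → ℚ.*-distribʳ-+ (seq x n) (seq y n) (seq z n))
    }
  ; *-comm = λ x y → pointwise λ n → ℚ.*-comm (seq x n) (seq y n)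
  }

ℝ-commutativeRing : CommutativeRing 0ℓ 0ℓ
ℝ-commutativeRing = record { isCommutativeRing = ℝ-isCommutativeRing }

module ℝ-Ring = CommutativeRing ℝ-commutativeRing

0≤+ : ∀ {x y} → 0ℝ ≤ x → 0ℝ ≤ y → 0ℝ ≤ x + y
0≤+ {x} {y} p q = mk≤ λ ε → both
  (λ n a b → subst (0ℚ ℚ.≤_) (eq ε n) (ℚ.+-mono-≤ a b))
  (below p (½ ℚ.* ε) {{½⁺ ε}}) (below q (½ ℚ.* ε) {{½⁺ ε}})
  where
  open +-*-Solver
  shuffle : ∀ a b c d → (a ℚ.+ c) ℚ.+ (b ℚ.+ d) ≡ (a ℚ.+ b) ℚ.+ (c ℚ.+ d)
  shuffle = solve 4 (λ a b c d → (a :+ c) :+ (b :+ d) := (a :+ b) :+ (c :+ d)) refl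
  eq : ∀ ε n → (seq x n ℚ.+ ½ ℚ.* ε) ℚ.+ (seq y n ℚ.+ ½ ℚ.* ε) ≡ (seq x n ℚ.+ seq y n) ℚ.+ ε
  eq ε n = trans (shuffle (seq x n) (seq y n) _ _)
    (cong (seq x n ℚ.+ seq y n ℚ.+_) (½+½ ε))

0≤scale : ∀ c .{{_ : Positive c}} {x} → 0ℝ ≤ x → 0ℝ ≤ fromℚ c * x
0≤scale c {x} p = mk≤ λ ε →
  let (η , η⁺ , cη) = share ε c
      (N , q)       = below p η {{η⁺}}
  in N , λ n le → ℚ.≤-trans
       (subst₂ ℚ._≤_ (ℚ.*-zeroʳ c)
         (trans (ℚ.*-distribˡ-+ c (seq x n) η) (cong (c ℚ.* seq x n ℚ.+_) cη))
         (ℚ.*-monoˡ-≤-nonNeg c {{ℚ.pos⇒nonNeg c}} (q n le)))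
       (ℚ.+-monoʳ-≤ (c ℚ.* seq x n) (half≤ ε))
  where
  half≤ : ∀ ε .{{_ : Positive ε}} → ½ ℚ.* ε ℚ.≤ ε
  half≤ ε = subst₂ ℚ._≤_ (ℚ.+-identityʳ _) (½+½ ε)
    (ℚ.+-monoʳ-≤ (½ ℚ.* ε) (ℚ.nonNegative⁻¹ (½ ℚ.* ε) {{ℚ.pos⇒nonNeg (½ ℚ.* ε) {{½⁺ ε}}}}))

record ℂ : Set where
  constructor _+i_
  field
    re im : ℝ

open ℂ public

ℂ-rawRing : RawRing 0ℓ 0ℓ
ℂ-rawRing = record
  { Carrier = ℂ
  ; _≈_ = λ z w → re z ≈ re w × im z ≈ im w
  ; _+_ = λ z w → (re z + re w) +i (im z + im w)
  ; _*_ = λ z w → (re z * re w - im z * im w) +i (re z * im w + im z * re w)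
  ; -_  = λ z → (- re z) +i (- im z)
  ; 0#  = 0ℝ +i 0ℝ
  ; 1#  = 1ℝ +i 0ℝ
  }

module ℂ-Ring = RawRing ℂ-rawRing

∣_∣² : ℂ → ℝ
∣ z ∣² = re z * re z + im z * im z

record 𝕋 : Set where
  constructor mk𝕋
  field
    point : ℂ
    ∣point∣≈1 : ∣ point ∣² ≈ 1ℝ

open 𝕋 public

𝕋-setoid : Setoid 0ℓ 0ℓ
𝕋-setoid = record
  { Carrier = 𝕋
  ; _≈_ = λ z w → point z ℂ-Ring.≈ point w
  ; isEquivalence = record
    { refl  = R.refl , R.refl
    ; sym   = λ (p , q) → R.sym p , R.sym q
    ; trans = λ (p , q) (p′ , q′) → R.trans p p′ , R.trans q q′
    }
  }
  where module R = ℝ-Ring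

∣zw∣² : ∀ z w → ∣ z ℂ-Ring.* w ∣² ≈ ∣ z ∣² * ∣ w ∣²
∣zw∣² (a +i b) (c +i d) =
  pointwise {∣ (a +i b) ℂ-Ring.* (c +i d) ∣²} {∣ a +i b ∣² * ∣ c +i d ∣²}
  λ n → eq (seq a n) (seq b n) (seq c n) (seq d n)
  where
  open +-*-Solver
  eq : ∀ a b c d →
       (a ℚ.* c ℚ.+ ℚ.- (b ℚ.* d)) ℚ.* (a ℚ.* c ℚ.+ ℚ.- (b ℚ.* d))
         ℚ.+ (a ℚ.* d ℚ.+ b ℚ.* c) ℚ.* (a ℚ.* d ℚ.+ b ℚ.* c)
       ≡ (a ℚ.* a ℚ.+ b ℚ.* b) ℚ.* (c ℚ.* c ℚ.+ d ℚ.* d)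
  eq = solve 4 (λ a b c d →
         (a :* c :+ :- (b :* d)) :* (a :* c :+ :- (b :* d))
           :+ (a :* d :+ b :* c) :* (a :* d :+ b :* c)
         := (a :* a :+ b :* b) :* (c :* c :+ d :* d)) refl

infixl 7 _·_

_·_ : 𝕋 → 𝕋 → 𝕋
point (z · w) = point z ℂ-Ring.* point w
∣point∣≈1 (z · w) = R.trans (∣zw∣² (point z) (point w))
  (R.trans (R.*-cong (∣point∣≈1 z) (∣point∣≈1 w)) (R.*-identityˡ 1ℝ))
  where module R = ℝ-Ring

-- Continuous real functions on 𝕋.  As 𝕋 is compact, continuity is uniform
-- continuity (constructively, this is the definition of continuity on a
-- compact space).  It implies that the function respects _≈_.

record C⟨𝕋⟩ : Set where
  field
    _⟨_⟩ : 𝕋 → ℝ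
    continuous : ∀ ε .{{_ : Positive ε}} → ∃ λ δ → Positive δ ×
      (∀ z w → ∣ point z ℂ-Ring.+ (ℂ-Ring.- point w) ∣² ≤ fromℚ (δ ℚ.* δ) →
               ∣ _⟨_⟩ z - _⟨_⟩ w ∣ ≤ fromℚ ε)

open C⟨𝕋⟩ public

-- Finite positive (Radon) measures on the compact space 𝕋, as positive
-- linear functionals on C⟨𝕋⟩.

record Measure : Set where
  field
    ∫ : C⟨𝕋⟩ → ℝ
    additive    : ∀ f g h → (∀ z → h ⟨ z ⟩ ≈ f ⟨ z ⟩ + g ⟨ z ⟩) → ∫ h ≈ ∫ f + ∫ g
    homogeneous : ∀ c f h → (∀ z → h ⟨ z ⟩ ≈ c * f ⟨ z ⟩) → ∫ h ≈ c * ∫ f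
    positive    : ∀ f → (∀ z → 0ℝ ≤ f ⟨ z ⟩) → 0ℝ ≤ ∫ f

open Measure public

IsProbability : Measure → Set
IsProbability μ = ∀ f → (∀ z → f ⟨ z ⟩ ≈ 1ℝ) → ∫ μ f ≈ 1ℝ

-- Normalized Haar measure on 𝕋 is the unique rotation-invariant probability
-- measure.
record IsNormalizedHaar (μ : Measure) : Set where
  field
    isProbability : IsProbability μ
    invariant : ∀ a f g → (∀ z → g ⟨ z ⟩ ≈ f ⟨ a · z ⟩) → ∫ μ g ≈ ∫ μ f

private
  open module +-Properties = CommutativeSemigroupProperties
    (CommutativeMonoid.commutativeSemigroup ℝ-Ring.+-commutativeMonoid)
    using (interchange)
  open module *-Properties = CommutativeSemigroupProperties
    (CommutativeMonoid.commutativeSemigroup ℝ-Ring.*-commutativeMonoid)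
    using (x∙yz≈y∙xz)

δ : 𝕋 → Measure
δ α = record
  { ∫ = _⟨ α ⟩
  ; additive    = λ _ _ _ p → p α
  ; homogeneous = λ _ _ _ p → p α
  ; positive    = λ _ p → p α
  }

0ᴹ : Measure
0ᴹ = record
  { ∫ = λ _ → 0ℝ
  ; additive    = λ _ _ _ _ → ≈-sym (ℝ-Ring.+-identityˡ 0ℝ)
  ; homogeneous = λ c _ _ _ → ≈-sym (ℝ-Ring.zeroʳ c)
  ; positive    = λ _ _ → mk≤ λ ε → 0 , λ _ _ →
      subst (0ℚ ℚ.≤_) (sym (ℚ.+-identityˡ ε)) (ℚ.nonNegative⁻¹ ε {{ℚ.pos⇒nonNeg ε}})
  }

infixr 6 _+ᴹ_
infixr 7 _·ᴹ_

_+ᴹ_ : Measure → Measure → Measure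
μ +ᴹ ν = record
  { ∫ = λ f → ∫ μ f + ∫ ν f
  ; additive    = λ f g h p → ≈-trans
      (+-cong (additive μ f g h p) (additive ν f g h p))
      (interchange (∫ μ f) (∫ μ g) (∫ ν f) (∫ ν g))
  ; homogeneous = λ c f h p → ≈-trans
      (+-cong (homogeneous μ c f h p) (homogeneous ν c f h p))
      (≈-sym (ℝ-Ring.distribˡ c (∫ μ f) (∫ ν f)))
  ; positive    = λ f p → 0≤+ (positive μ f p) (positive ν f p)
  }

_·ᴹ_ : (c : ℚ) .{{_ : Positive c}} → Measure → Measure
c ·ᴹ μ = record
  { ∫ = λ f → fromℚ c * ∫ μ f
  ; additive    = λ f g h p → ≈-trans
      (*-cong ≈-refl (additive μ f g h p))
      (ℝ-Ring.distribˡ (fromℚ c) (∫ μ f) (∫ μ g))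
  ; homogeneous = λ a f h p → ≈-trans
      (*-cong ≈-refl (homogeneous μ a f h p))
      (x∙yz≈y∙xz (fromℚ c) a (∫ μ f))
  ; positive    = λ f p → 0≤scale c (positive μ f p)
  }

-- (1 / #ω) Σ_{x ∈ ω} δ_{α x}, the elements of ω counted with multiplicity.
empirical : {A : Set} (α : A → 𝕋) (ω : List A) → .{{_ : ℕ.NonZero (length ω)}} → Measure
empirical α ω = _·ᴹ_ (ℤ.+ 1 ℚ./ length ω) {{ℚ.normalize-pos 1 (length ω)}}
  (foldr _+ᴹ_ 0ᴹ (map (δ ∘ α) ω))

module _ where
  /1-suc : ∀ n → ℤ.+ suc n ℚ./ 1 ≡ 1ℚ ℚ.+ ℤ.+ n ℚ./ 1
  /1-suc n = ℚ.toℚᵘ-injective (begin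
    ℚ.toℚᵘ (ℤ.+ suc n ℚ./ 1)                ≈⟨ ℚ.toℚᵘ-fromℚᵘ (ℚᵘ.mkℚᵘ (ℤ.+ suc n) 0) ⟩
    ℚᵘ.mkℚᵘ (ℤ.+ suc n) 0                   ≈⟨ ℚᵘ.*≡* (eq (ℤ.+ n)) ⟩
    ℚᵘ.1ℚᵘ ℚᵘ.+ ℚᵘ.mkℚᵘ (ℤ.+ n) 0           ≈⟨ ℚᵘ.+-cong (ℚᵘ.≃-refl {ℚᵘ.1ℚᵘ}) (ℚ.toℚᵘ-fromℚᵘ (ℚᵘ.mkℚᵘ (ℤ.+ n) 0)) ⟨
    ℚ.toℚᵘ 1ℚ ℚᵘ.+ ℚ.toℚᵘ (ℤ.+ n ℚ./ 1)     ≈⟨ ℚ.toℚᵘ-homo-+ 1ℚ (ℤ.+ n ℚ./ 1) ⟨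
    ℚ.toℚᵘ (1ℚ ℚ.+ ℤ.+ n ℚ./ 1)             ∎)
    where
    open SetoidReasoning ℚᵘ.≃-setoid
    open ℤSolver
    eq : ∀ i → (ℤ.1ℤ ℤ.+ i) ℤ.* ℤ.1ℤ ≡ (ℤ.1ℤ ℤ.* ℤ.1ℤ ℤ.+ i ℤ.* ℤ.1ℤ) ℤ.* ℤ.1ℤ
    eq = solve 1 (λ i → (con ℤ.1ℤ :+ i) :* con ℤ.1ℤ :=
           (con ℤ.1ℤ :* con ℤ.1ℤ :+ i :* con ℤ.1ℤ) :* con ℤ.1ℤ) refl

  1/n*n : ∀ n .{{_ : ℕ.NonZero n}} → (ℤ.+ 1 ℚ./ n) ℚ.* (ℤ.+ n ℚ./ 1) ≡ 1ℚ
  1/n*n (suc n) = ℚ.toℚᵘ-injective (begin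
    ℚ.toℚᵘ ((ℤ.+ 1 ℚ./ suc n) ℚ.* (ℤ.+ suc n ℚ./ 1))
      ≈⟨ ℚ.toℚᵘ-homo-* (ℤ.+ 1 ℚ./ suc n) (ℤ.+ suc n ℚ./ 1) ⟩
    ℚ.toℚᵘ (ℤ.+ 1 ℚ./ suc n) ℚᵘ.* ℚ.toℚᵘ (ℤ.+ suc n ℚ./ 1)
      ≈⟨ ℚᵘ.*-cong (ℚ.toℚᵘ-fromℚᵘ (ℚᵘ.mkℚᵘ (ℤ.+ 1) n)) (ℚ.toℚᵘ-fromℚᵘ (ℚᵘ.mkℚᵘ (ℤ.+ suc n) 0)) ⟩
    ℚᵘ.mkℚᵘ (ℤ.+ 1) n ℚᵘ.* ℚᵘ.mkℚᵘ (ℤ.+ suc n) 0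
      ≈⟨ ℚᵘ.*-inverseˡ (ℚᵘ.mkℚᵘ (ℤ.+ suc n) 0) ⟩
    ℚᵘ.1ℚᵘ ∎)
    where open SetoidReasoning ℚᵘ.≃-setoid

  total-mass : ∀ {A : Set} (α : A → 𝕋) (ω : List A) f → (∀ z → f ⟨ z ⟩ ≈ 1ℝ) →
               ∫ (foldr _+ᴹ_ 0ᴹ (map (δ ∘ α) ω)) f ≈ fromℕ (length ω)
  total-mass α List.[] f p = pointwise λ _ → refl
  total-mass α (x List.∷ ω) f p = ≈-trans (+-cong (p (α x)) (total-mass α ω f p))
    (pointwise λ _ → sym (/1-suc (length ω)))

empirical-isProbability :
  ∀ {A : Set} (α : A → 𝕋) (ω : List A) .{{_ : ℕ.NonZero (length ω)}} →
  IsProbability (empirical α ω)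
empirical-isProbability α ω f p = ≈-trans
  (*-cong ≈-refl (total-mass α ω f p))
  (pointwise λ _ → 1/n*n (length ω))

-- Formal power series, as coefficient sequences; polynomials are regarded
-- as series.

series : ∀ {c ℓ} → RawRing c ℓ → RawRing c ℓ
series R = record
  { Carrier = ℕ → R.Carrier
  ; _≈_ = λ f g → ∀ k → f k R.≈ g k
  ; _+_ = λ f g k → f k R.+ g k
  ; _*_ = λ f g k → sum {suc k} λ i → f (toℕ i) R.* g (k ℕ.∸ toℕ i)
  ; -_  = λ f k → R.- f k
  ; 0#  = λ _ → R.0#
  ; 1#  = λ { zero → R.1# ; (suc _) → R.0# }
  }
  where
  module R = RawRing R
  open RawSemiringDefinitions R.rawSemiring using (sum)

module Series {c ℓ} (R : RawRing c ℓ) where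
  private module R = RawRing R
  open RawRing (series R) public using (Carrier)
    renaming (_≈_ to _≈ˢ_; _+_ to _+ˢ_; _*_ to _*ˢ_; -_ to -ˢ_; 1# to 1ˢ)
  open RawSemiringDefinitions (RawRing.rawSemiring (series R)) public using ()
    renaming (_^_ to _^ˢ_)

  infixl 6 _-ˢ_

  _-ˢ_ : Carrier → Carrier → Carrier
  f -ˢ g = f +ˢ (-ˢ g)

  constant : R.Carrier → Carrier
  constant a zero    = a
  constant a (suc _) = R.0#

  t : Carrier
  t k = if k ℕ.≡ᵇ 1 then R.1# else R.0#

  -- The value at z of a polynomial of degree at most d.
  eval : ℕ → Carrier → R.Carrier → R.Carrier
  eval d f z = sum {suc d} λ i → f (toℕ i) R.* (z ^ᴿ toℕ i)
    where open RawSemiringDefinitions R.rawSemiring using (sum) renaming (_^_ to _^ᴿ_)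

module ℤ⟦t⟧ = Series ℤ.+-*-rawRing
module ℂ⟦t⟧ = Series ℂ-rawRing

t^[_]-1 : ℕ → ℤ⟦t⟧.Carrier
t^[ n ]-1 = (t ^ˢ n) -ˢ 1ˢ
  where open ℤ⟦t⟧

-- 1 / (t^n - 1) = - Σ_{j ≥ 0} t^{jn}, for n > 0.
1/[t^_-1] : ℕ → ℤ⟦t⟧.Carrier
1/[t^ n -1] k = if does (n ℕ.∣? k) then ℤ.-1ℤ else ℤ.0ℤ

-- (t^L - 1)^d (t - 1) / ((t^p - 1)(t^q - 1)), the Alexander polynomial of the
-- torus link T_{p,q}, L = lcm p q, d = gcd p q.  The quotient is formed in
-- ℤ⟦t⟧, where t^p - 1 and t^q - 1 are invertible.
Δ : ℕ → ℕ → ℤ⟦t⟧.Carrier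
Δ p q = (t^[ lcm p q ]-1 ^ˢ gcd p q) *ˢ t^[ 1 ]-1 *ˢ (1/[t^ p -1] *ˢ 1/[t^ q -1])
  where open ℤ⟦t⟧

-- The degree of Δ p q is lcm p q * gcd p q + 1 - p - q = (p - 1)(q - 1).
degΔ : ℕ → ℕ → ℕ
degΔ p q = (p ℕ.∸ 1) ℕ.* (q ℕ.∸ 1)

Δℂ : ℕ → ℕ → ℂ⟦t⟧.Carrier
Δℂ p q k = fromℤ (Δ p q k) +i 0ℝ

-- Δ p q is monic, so α₁, …, αₙ are its roots with multiplicity exactly when
-- it factors as (t - α₁) ⋯ (t - αₙ).
IsRootMultiset : ℕ → ℕ → List 𝕋 → Set
IsRootMultiset p q αs =
  Δℂ p q ≈ˢ foldr (λ α f → (t -ˢ constant (point α)) *ˢ f) 1ˢ αs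
  where open ℂ⟦t⟧

record IsRootSet (p q : ℕ) (αs : List 𝕋) : Set where
  field
    distinct : UniqueSetoid.Unique 𝕋-setoid αs
    roots    : ∀ z → ℂ⟦t⟧.eval (degΔ p q) (Δℂ p q) z ℂ-Ring.≈ ℂ-Ring.0#
                     ⇔ Any (λ α → z ℂ-Ring.≈ point α) αs

-- A real X together with its integer part, which cannot be computed from a
-- Cauchy sequence.  A natural number p satisfies p ≤ X iff p ≤ ⌊X⌋.
record Cutoff : Set where
  field
    value   : ℝ
    ⌊_⌋     : ℕ
    floor≤  : fromℕ ⌊_⌋ ≤ value
    <floor+1 : ¬ (fromℕ (suc ⌊_⌋) ≤ value)

open Cutoff public

pairs : Cutoff → List (ℕ × ℕ)
pairs X = cartesianProduct (applyUpTo suc ⌊ X ⌋) (applyUpTo suc ⌊ X ⌋)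

withRoots : (ℕ → ℕ → List 𝕋) → List (ℕ × ℕ) → List ((ℕ × ℕ) × 𝕋)
withRoots roots = concatMap λ (p , q) → map ((p , q) ,_) (roots p q)

Ω : (roots : ℕ → ℕ → List 𝕋) → Cutoff → List ((ℕ × ℕ) × 𝕋)
Ω roots X = withRoots roots (pairs X)

Ω₁ : (rootSet : ℕ → ℕ → List 𝕋) → Cutoff → List ((ℕ × ℕ) × 𝕋)
Ω₁ rootSet X = withRoots rootSet (filter (λ (p , q) → gcd p q ℕ.≟ 1) (pairs X))

μ : (roots : ℕ → ℕ → List 𝕋) (X : Cutoff) → .(ℕ.NonZero (length (Ω roots X))) → Measure
μ roots X nonempty = empirical proj₂ (Ω roots X) {{nonempty}}

μ′ : (rootSet : ℕ → ℕ → List 𝕋) (X : Cutoff) → .(ℕ.NonZero (length (Ω₁ rootSet X))) → Measure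
μ′ rootSet X nonempty = empirical proj₂ (Ω₁ rootSet X) {{nonempty}}

-- Weak convergence as X → ∞ of measures μ_X defined for those X satisfying
-- D; the limit requires D X to hold for all large X.

ConvergesWeakly : {D : Cutoff → Set} → (∀ X → .(D X) → Measure) → Measure → Set
ConvergesWeakly {D} μ ν =
  ∀ (f : C⟨𝕋⟩) (ε : ℚ) .{{_ : Positive ε}} →
  ∃ λ (X₀ : ℝ) → ∀ (X : Cutoff) → X₀ ≤ value X →
  Σ (D X) λ d → ∣ ∫ (μ X d) f - ∫ ν f ∣ ≤ fromℚ ε

{-# OPTIONS --safe #-}
-- Taking logarithmic derivatives of Δ = ∏ (t - α), with α⁻¹ = conj α, shows that the
-- k-th power sum of the roots of Δ p q is p q [L ∣ k] + 1 - p [p ∣ k] - q [q ∣ k], which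
-- is at most (k + 1)² in absolute value for every (p , q).  Taking k = p q bounds the
-- number of roots below by (p - 1)(q - 1).  So with Y = ⌊X⌋ the k-th power sum over all
-- roots is at most Y² (k + 1)², while the number of roots grows at least like Y³,
-- already because of the coprime pairs (i + 1 , i).
--
-- If A and B are finite families on the circle whose power sums are small relative to
-- their sizes, averaging over A and over B gives nearly the same value on a continuous
-- f: compare both with the double average of f weighted by the Fejér kernel of
-- α / β.  Taking for B the rotations by z of a fixed such family and integrating over z
-- replaces the average over B by the Haar integral of f.
--
-- For coprime p, q the set of roots is matched with the multiset of roots: Δ p q divides
-- t^L - 1, which has no double roots.
module Submission where

open import Algebra.Bundles using (CommutativeRing; RawRing)
import Algebra.Definitions.RawSemiring as RawSemiringDefinitions
import Algebra.Properties.CommutativeMonoid.Mult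
import Algebra.Properties.Monoid.Mult
import Algebra.Properties.Ring
import Algebra.Properties.Semiring.Mult
import Algebra.Solver.Ring
open import Algebra.Solver.Ring.AlmostCommutativeRing
  using (fromCommutativeRing; _-Raw-AlmostCommutative⟶_)
import Algebra.Solver.Ring.NaturalCoefficients.Default
open import Algebra.Structures using (IsCommutativeRing)
open import Data.Bool.Base using (true; false; if_then_else_)
open import Data.Fin.Base as Fin using (Fin; toℕ)
open import Data.Integer.Base as ℤ using (ℤ)
import Data.Integer.Properties as ℤ
open import Data.Integer.Solver renaming (module +-*-Solver to ℤSolver)
open import Data.List.Base
  using (List; []; _∷_; _++_; foldr; length; map; applyUpTo; cartesianProduct; filter)
open import Data.List.Properties
  using (length-map; length-++; map-++; map-∘; length-filter; length-applyUpTo)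
open import Data.List.Relation.Unary.All as All using (All; []; _∷_)
open import Data.List.Relation.Unary.All.Properties
  using (¬Any⇒All¬; applyUpTo⁺₂; cartesianProduct⁺; all-filter; filter⁺)
open import Data.List.Relation.Unary.AllPairs using ([]; _∷_)
open import Data.List.Relation.Unary.Any as Any using (Any; here; there; _─_)
import Data.List.Relation.Unary.Unique.Setoid as UniqueSetoid
open import Data.Maybe.Base using (Maybe; just; nothing)
open import Data.Nat.Base as ℕ using (ℕ; zero; suc; z≤n; s≤s; _<_; NonZero)
open import Data.Nat.Coprimality using (coprime-+; 1-coprimeTo; coprime⇒gcd≡1)
open import Data.Nat.Divisibility as ℕ using (_∣_; _∣?_)
open import Data.Nat.GCD using (gcd)
open import Data.Nat.LCM as LCM using (lcm; gcd*lcm)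
import Data.Nat.ListAction.Properties as ℕ
import Data.Nat.Properties as ℕ
open import Data.Nat.Solver renaming (module +-*-Solver to ℕSolver)
open import Data.Product.Base using (∃; _×_; _,_; proj₁; proj₂)
open import Data.Rational.Base as ℚ using (ℚ; 0ℚ; 1ℚ; ½; Positive; mkℚ)
import Data.Rational.Properties as ℚ
open import Data.Rational.Solver renaming (module +-*-Solver to ℚSolver)
import Data.Rational.Unnormalised.Base as ℚᵘ
import Data.Rational.Unnormalised.Properties as ℚᵘ
open import Data.Sum.Base using (_⊎_; inj₁; inj₂)
open import Defs using (module Series)
open import Function.Base using (_∘_)
open import Function.Bundles using (Equivalence)
open import Level using (0ℓ)
open import Relation.Binary.Bundles using (Poset; Setoid)
open import Relation.Binary.Definitions using (tri<; tri≈; tri>)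
open import Relation.Binary.PropositionalEquality as ≡ using (_≡_)
import Relation.Binary.Reasoning.PartialOrder
import Relation.Binary.Reasoning.Setoid as SetoidReasoning
open import Relation.Nullary.Decidable using (yes; no; does; dec-true; dec-false)
open import Relation.Nullary.Negation using (¬_; contradiction)

-- Points of the circle are handled without trigonometric functions, and the Haar integral only
-- through linearity, positivity, normalization and invariance. Weyl's criterion would require its
-- value on each z^k and the density of trigonometric polynomials; comparing two finite families
-- avoids both. The reference family is the multiset of roots itself, at one fixed cutoff. Such
-- families also replace compactness: being finite nets of the circle, they turn uniform continuity
-- into a bound for f. The Fejér kernel has two properties that matter: it is nonnegative, so
-- weighted errors are estimated termwise, and N times it is at most 4 / |z - w|^2 for every N,
-- although that multiple averages about N. Hence the modulus of continuity is put in the form ε + C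
-- |z - w|^2. Real numbers have undecidable order and equality. Case distinctions are therefore made
-- between overlapping alternatives, many estimates are proved up to an arbitrary positive rational,
-- and smallness is expressed by natural numbers in inequalities cleared of denominators.

module SeriesRing {c ℓ} (R : CommutativeRing c ℓ) where
  open CommutativeRing R renaming (refl to ≈ᴿ-refl; sym to ≈ᴿ-sym; trans to ≈ᴿ-trans)
  open Series rawRing renaming (Carrier to 𝕊)
  open Algebra.Solver.Ring.NaturalCoefficients.Default commutativeSemiring
  open SetoidReasoning setoid

  -- The product unfolds by computation to `f 0 * g (suc k) + (tail f *ˢ g) k` at index `suc k`. The
  -- ring laws of the product are therefore proved by induction on the index, with `f` replaced by
  -- `tail f`.
  tail : 𝕊 → 𝕊
  tail f k = f (suc k)

  infixr 7 _⋆_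
  _⋆_ : Carrier → 𝕊 → 𝕊
  (a ⋆ f) k = a * f k

  0ˢ : 𝕊
  0ˢ _ = 0#

  *ˢ-cong : ∀ {f f′ g g′} → f ≈ˢ f′ → g ≈ˢ g′ → f *ˢ g ≈ˢ f′ *ˢ g′
  *ˢ-cong p q zero    = +-cong (*-cong (p 0) (q 0)) ≈ᴿ-refl
  *ˢ-cong p q (suc k) =
    +-cong (*-cong (p 0) (q (suc k))) (*ˢ-cong (λ i → p (suc i)) q k)

  zeroˡ-*ˢ : ∀ {f} g → f ≈ˢ 0ˢ → f *ˢ g ≈ˢ 0ˢ
  zeroˡ-*ˢ g p zero    = begin
    _ * g 0 + 0#  ≈⟨ +-identityʳ _ ⟩
    _ * g 0       ≈⟨ *-congʳ (p 0) ⟩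
    0# * g 0      ≈⟨ zeroˡ _ ⟩
    0#            ∎
  zeroˡ-*ˢ {f} g p (suc k) = begin
    f 0 * g (suc k) + (tail f *ˢ g) k  ≈⟨ +-cong (*-congʳ (p 0)) (zeroˡ-*ˢ g (λ i → p (suc i)) k) ⟩
    0# * g (suc k) + 0#                ≈⟨ +-identityʳ _ ⟩
    0# * g (suc k)                     ≈⟨ zeroˡ _ ⟩
    0#                                 ∎

  1ˢ-*ˢ : ∀ f → 1ˢ *ˢ f ≈ˢ f
  1ˢ-*ˢ f zero    = ≈ᴿ-trans (+-identityʳ _) (*-identityˡ _)
  1ˢ-*ˢ f (suc k) = begin
    1# * f (suc k) + (tail 1ˢ *ˢ f) k  ≈⟨ +-cong (*-identityˡ _) (zeroˡ-*ˢ f (λ _ → ≈ᴿ-refl) k) ⟩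
    f (suc k) + 0#                     ≈⟨ +-identityʳ _ ⟩
    f (suc k)                          ∎

  *ˢ-distribʳ : ∀ h f g → (f +ˢ g) *ˢ h ≈ˢ f *ˢ h +ˢ g *ˢ h
  *ˢ-distribʳ h f g zero    =
    solve 3 (λ a b c → (a :+ b) :* c :+ con 0 := (a :* c :+ con 0) :+ (b :* c :+ con 0))
      ≈ᴿ-refl (f 0) (g 0) (h 0)
  *ˢ-distribʳ h f g (suc k) = begin
    (f 0 + g 0) * h (suc k) + ((tail f +ˢ tail g) *ˢ h) k
      ≈⟨ +-congˡ (*ˢ-distribʳ h (tail f) (tail g) k) ⟩
    (f 0 + g 0) * h (suc k) + ((tail f *ˢ h) k + (tail g *ˢ h) k)
      ≈⟨ solve 5 (λ a b c x y → (a :+ b) :* c :+ (x :+ y) := (a :* c :+ x) :+ (b :* c :+ y))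
           ≈ᴿ-refl (f 0) (g 0) (h (suc k)) _ _ ⟩
    (f 0 * h (suc k) + (tail f *ˢ h) k) + (g 0 * h (suc k) + (tail g *ˢ h) k) ∎

  ⋆-*ˢ : ∀ a f g → (a ⋆ f) *ˢ g ≈ˢ a ⋆ (f *ˢ g)
  ⋆-*ˢ a f g zero    =
    solve 3 (λ a x y → (a :* x) :* y :+ con 0 := a :* (x :* y :+ con 0))
      ≈ᴿ-refl a (f 0) (g 0)
  ⋆-*ˢ a f g (suc k) = begin
    (a * f 0) * g (suc k) + ((a ⋆ tail f) *ˢ g) k
      ≈⟨ +-congˡ (⋆-*ˢ a (tail f) g k) ⟩
    (a * f 0) * g (suc k) + a * (tail f *ˢ g) k
      ≈⟨ solve 4 (λ a x y z → (a :* x) :* y :+ a :* z := a :* (x :* y :+ z))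
           ≈ᴿ-refl a (f 0) (g (suc k)) _ ⟩
    a * (f 0 * g (suc k) + (tail f *ˢ g) k) ∎

  -- Unfolding peels coefficients off the left factor only. To interchange the factors, both must be
  -- peeled once, so the induction descends by two and has two base cases.
  *ˢ-comm : ∀ f g → f *ˢ g ≈ˢ g *ˢ f
  *ˢ-comm f g zero          = +-congʳ (*-comm _ _)
  *ˢ-comm f g (suc zero)    =
    solve 4 (λ a b c d → a :* b :+ (c :* d :+ con 0) := d :* c :+ (b :* a :+ con 0))
      ≈ᴿ-refl (f 0) (g 1) (f 1) (g 0)
  *ˢ-comm f g (suc (suc k)) = begin
    f 0 * g (2 ℕ.+ k) + (tail f *ˢ g) (suc k)
      ≈⟨ +-congˡ (*ˢ-comm (tail f) g (suc k)) ⟩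
    f 0 * g (2 ℕ.+ k) + (g 0 * f (2 ℕ.+ k) + (tail g *ˢ tail f) k)
      ≈⟨ +-congˡ (+-congˡ (*ˢ-comm (tail g) (tail f) k)) ⟩
    f 0 * g (2 ℕ.+ k) + (g 0 * f (2 ℕ.+ k) + (tail f *ˢ tail g) k)
      ≈⟨ solve 3 (λ x y z → x :+ (y :+ z) := y :+ (x :+ z)) ≈ᴿ-refl _ _ _ ⟩
    g 0 * f (2 ℕ.+ k) + (f 0 * g (2 ℕ.+ k) + (tail f *ˢ tail g) k)
      ≈⟨ +-congˡ (*ˢ-comm (tail g) f (suc k)) ⟨
    g 0 * f (2 ℕ.+ k) + (tail g *ˢ f) (suc k) ∎

  -- By computation `tail (f *ˢ g)` is `f 0 ⋆ tail g +ˢ tail f *ˢ g`; distributivity and `⋆-*ˢ`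
  -- split it so that the induction hypothesis applies to `tail f`.
  *ˢ-assoc : ∀ f g h → (f *ˢ g) *ˢ h ≈ˢ f *ˢ (g *ˢ h)
  *ˢ-assoc f g h zero    =
    solve 3 (λ a b c → (a :* b :+ con 0) :* c :+ con 0 := a :* (b :* c :+ con 0) :+ con 0)
      ≈ᴿ-refl (f 0) (g 0) (h 0)
  *ˢ-assoc f g h (suc k) = begin
    (f 0 * g 0 + 0#) * h (suc k) + ((f 0 ⋆ tail g +ˢ tail f *ˢ g) *ˢ h) k
      ≈⟨ +-congˡ (*ˢ-distribʳ h (f 0 ⋆ tail g) (tail f *ˢ g) k) ⟩
    (f 0 * g 0 + 0#) * h (suc k) + (((f 0 ⋆ tail g) *ˢ h) k + ((tail f *ˢ g) *ˢ h) k)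
      ≈⟨ +-congˡ (+-cong (⋆-*ˢ (f 0) (tail g) h k) (*ˢ-assoc (tail f) g h k)) ⟩
    (f 0 * g 0 + 0#) * h (suc k) + (f 0 * (tail g *ˢ h) k + (tail f *ˢ (g *ˢ h)) k)
      ≈⟨ solve 5 (λ a b c x y → (a :* b :+ con 0) :* c :+ (a :* x :+ y) := a :* (b :* c :+ x) :+ y)
           ≈ᴿ-refl (f 0) (g 0) (h (suc k)) _ _ ⟩
    f 0 * (g 0 * h (suc k) + (tail g *ˢ h) k) + (tail f *ˢ (g *ˢ h)) k ∎

  isCommutativeRingˢ : IsCommutativeRing _≈ˢ_ _+ˢ_ _*ˢ_ -ˢ_ 0ˢ 1ˢ
  isCommutativeRingˢ = record
    { isRing = record
      { +-isAbelianGroup = record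
        { isGroup = record
          { isMonoid = record
            { isSemigroup = record
              { isMagma = record
                { isEquivalence = record
                  { refl = λ _ → ≈ᴿ-refl ; sym = λ p k → ≈ᴿ-sym (p k)
                  ; trans = λ p q k → ≈ᴿ-trans (p k) (q k) }
                ; ∙-cong = λ p q k → +-cong (p k) (q k)
                }
              ; assoc = λ f g h k → +-assoc (f k) (g k) (h k)
              }
            ; identity = (λ f k → +-identityˡ (f k)) , (λ f k → +-identityʳ (f k))
            }
          ; inverse = (λ f k → -‿inverseˡ (f k)) , (λ f k → -‿inverseʳ (f k))
          ; ⁻¹-cong = λ p k → -‿cong (p k)
          }
        ; comm = λ f g k → +-comm (f k) (g k)
        }
      ; *-cong = *ˢ-cong
      ; *-assoc = *ˢ-assoc
      ; *-identity = 1ˢ-*ˢ , λ f k → ≈ᴿ-trans (*ˢ-comm f 1ˢ k) (1ˢ-*ˢ f k)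
      ; distrib = (λ f g h k → begin
            (f *ˢ (g +ˢ h)) k             ≈⟨ *ˢ-comm f (g +ˢ h) k ⟩
            ((g +ˢ h) *ˢ f) k             ≈⟨ *ˢ-distribʳ f g h k ⟩
            (g *ˢ f) k + (h *ˢ f) k       ≈⟨ +-cong (*ˢ-comm g f k) (*ˢ-comm h f k) ⟩
            (f *ˢ g) k + (f *ˢ h) k       ∎)
        , *ˢ-distribʳ
      }
    ; *-comm = *ˢ-comm
    }

  seriesRing : CommutativeRing c ℓ
  seriesRing = record { isCommutativeRing = isCommutativeRingˢ }

-- Logarithmic derivatives of formal power series

module LogarithmicDerivative {c ℓ} (R : CommutativeRing c ℓ) where
  open CommutativeRing R
  open Series rawRing renaming (Carrier to 𝕊)
  open SeriesRing R
  module 𝕊 = CommutativeRing seriesRing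
  private
    module ×R = Algebra.Properties.Monoid.Mult +-monoid
    module ×S = Algebra.Properties.Monoid.Mult 𝕊.+-monoid
    module R-solver = Algebra.Solver.Ring.NaturalCoefficients.Default commutativeSemiring
    module S-solver = Algebra.Solver.Ring.NaturalCoefficients.Default 𝕊.commutativeSemiring
  open ×R using () renaming (_×_ to _×ᴿ_)
  open ×S using () renaming (_×_ to _×ˢ_)
  open Algebra.Properties.CommutativeMonoid.Mult +-commutativeMonoid using (×-distrib-+)
  open Algebra.Properties.Semiring.Mult semiring using (×-comm-*)
  open Algebra.Properties.Semiring.Mult 𝕊.semiring using () renaming (×-comm-* to ×ˢ-comm-*)
  open SetoidReasoning setoid
  module S = SetoidReasoning 𝕊.setoid

  ×-zero : ∀ k → k ×ᴿ 0# ≈ 0#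
  ×-zero zero    = refl
  ×-zero (suc k) = trans (+-identityˡ _) (×-zero k)

  congˡ : ∀ f {g h} → g ≈ˢ h → f *ˢ g ≈ˢ f *ˢ h
  congˡ f p = *ˢ-cong {f} {f} 𝕊.refl p

  congʳ : ∀ f {g h} → g ≈ˢ h → g *ˢ f ≈ˢ h *ˢ f
  congʳ f p = *ˢ-cong p (𝕊.refl {f})

  -- With t d/dt in place of d/dt each coefficient is scaled where it stands, so that, up to sign,
  -- the k-th coefficient of a logarithmic derivative is the k-th power sum, without a shift of
  -- index.
  D : 𝕊 → 𝕊
  D f k = k ×ᴿ f k

  D-cong : ∀ {f g} → f ≈ˢ g → D f ≈ˢ D g
  D-cong p k = ×R.×-congʳ k (p k)

  D-+ : ∀ f g → D (f +ˢ g) ≈ˢ D f +ˢ D g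
  D-+ f g k = ×-distrib-+ (f k) (g k) k

  -- Induction on the index, using that `tail (D f)` is `tail f +ˢ D (tail f)`: lowering the index
  -- by one loses one copy of each coefficient.
  D-* : ∀ f g → D (f *ˢ g) ≈ˢ D f *ˢ g +ˢ f *ˢ D g
  D-* f g zero    = solve 2 (λ a b → con 0 := (con 0 :* b :+ con 0) :+ (a :* con 0 :+ con 0))
      refl (f 0) (g 0)
    where open R-solver
  D-* f g (suc k) = begin
    (f 0 * g (suc k) + (tail f *ˢ g) k) + k ×ᴿ (f 0 * g (suc k) + (tail f *ˢ g) k)
      ≈⟨ +-congˡ (×-distrib-+ _ _ k) ⟩
    (f 0 * g (suc k) + (tail f *ˢ g) k) + (k ×ᴿ (f 0 * g (suc k)) + k ×ᴿ (tail f *ˢ g) k)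
      ≈⟨ +-congˡ (+-cong (sym (×-comm-* k (f 0) (g (suc k)))) (D-* (tail f) g k)) ⟩
    (f 0 * g (suc k) + (tail f *ˢ g) k)
      + (f 0 * (k ×ᴿ g (suc k)) + ((D (tail f) *ˢ g) k + (tail f *ˢ D g) k))
      ≈⟨ solve 6 (λ a b c d x y → (a :* b :+ c) :+ (a :* d :+ (x :+ y)) :=
           (con 0 :* b :+ (c :+ x)) :+ (a :* (b :+ d) :+ y))
           refl (f 0) (g (suc k)) _ _ _ _ ⟩
    (0# * g (suc k) + ((tail f *ˢ g) k + (D (tail f) *ˢ g) k))
      + (f 0 * (g (suc k) + k ×ᴿ g (suc k)) + (tail f *ˢ D g) k)
      ≈⟨ +-congʳ (+-congˡ (*ˢ-distribʳ g (tail f) (D (tail f)) k)) ⟨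
    (0# * g (suc k) + ((tail f +ˢ D (tail f)) *ˢ g) k)
      + (f 0 * (g (suc k) + k ×ᴿ g (suc k)) + (tail f *ˢ D g) k) ∎
    where open R-solver

  D-1 : D 1ˢ ≈ˢ 0ˢ
  D-1 zero    = refl
  D-1 (suc k) = ×-zero (suc k)

  t-* : ∀ f k → (t *ˢ f) (suc k) ≈ f k
  t-* f k = begin
    0# * f (suc k) + (tail t *ˢ f) k  ≈⟨ +-cong (zeroˡ _) (congʳ f tail-t k) ⟩
    0# + (1ˢ *ˢ f) k                  ≈⟨ +-identityˡ _ ⟩
    (1ˢ *ˢ f) k                       ≈⟨ 1ˢ-*ˢ f k ⟩
    f k                               ∎
    where
    tail-t : tail t ≈ˢ 1ˢ
    tail-t zero    = refl
    tail-t (suc _) = refl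

  t-*-0 : ∀ f → (t *ˢ f) 0 ≈ 0#
  t-*-0 f = trans (+-identityʳ _) (zeroˡ _)

  t^-* : ∀ n f k → (t ^ˢ n *ˢ f) (n ℕ.+ k) ≈ f k
  t^-* zero    f k = 1ˢ-*ˢ f k
  t^-* (suc n) f k = begin
    ((t *ˢ t ^ˢ n) *ˢ f) (suc n ℕ.+ k)  ≈⟨ *ˢ-assoc t (t ^ˢ n) f (suc n ℕ.+ k) ⟩
    (t *ˢ (t ^ˢ n *ˢ f)) (suc n ℕ.+ k)  ≈⟨ t-* (t ^ˢ n *ˢ f) (n ℕ.+ k) ⟩
    (t ^ˢ n *ˢ f) (n ℕ.+ k)             ≈⟨ t^-* n f k ⟩
    f k                                 ∎

  t^-*-< : ∀ n f {k} → k ℕ.< n → (t ^ˢ n *ˢ f) k ≈ 0#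
  t^-*-< (suc n) f {zero}  _ = trans (*ˢ-assoc t (t ^ˢ n) f 0) (t-*-0 (t ^ˢ n *ˢ f))
  t^-*-< (suc n) f {suc k} (s≤s k<n) = begin
    ((t *ˢ t ^ˢ n) *ˢ f) (suc k)  ≈⟨ *ˢ-assoc t (t ^ˢ n) f (suc k) ⟩
    (t *ˢ (t ^ˢ n *ˢ f)) (suc k)  ≈⟨ t-* (t ^ˢ n *ˢ f) k ⟩
    (t ^ˢ n *ˢ f) k               ≈⟨ t^-*-< n f k<n ⟩
    0#                            ∎

  D-t^ : ∀ n → D (t ^ˢ n) ≈ˢ n ×ˢ (t ^ˢ n)
  D-t^ zero    = D-1
  D-t^ (suc n) = S.begin
    D (t *ˢ t ^ˢ n)                   S.≈⟨ D-* t (t ^ˢ n) ⟩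
    D t *ˢ t ^ˢ n +ˢ t *ˢ D (t ^ˢ n)  S.≈⟨ 𝕊.+-cong (congʳ (t ^ˢ n) D-t) (congˡ t (D-t^ n)) ⟩
    t ^ˢ suc n +ˢ t *ˢ (n ×ˢ t ^ˢ n)  S.≈⟨ 𝕊.+-congˡ (×ˢ-comm-* n t (t ^ˢ n)) ⟩
    t ^ˢ suc n +ˢ n ×ˢ (t ^ˢ suc n)   S.∎
    where
    D-t : D t ≈ˢ t
    D-t zero          = refl
    D-t (suc zero)    = +-identityʳ _
    D-t (suc (suc k)) = ×-zero (2 ℕ.+ k)

  -- g is the logarithmic derivative of f, for the derivation D = t d/dt.
  LogD : 𝕊 → 𝕊 → Set ℓ
  LogD f g = D f ≈ˢ g *ˢ f

  LogD-cong : ∀ {f f′ g g′} → f ≈ˢ f′ → g ≈ˢ g′ → LogD f g → LogD f′ g′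
  LogD-cong p q h = 𝕊.trans (D-cong (𝕊.sym p)) (𝕊.trans h (*ˢ-cong q p))

  LogD-1 : LogD 1ˢ 0ˢ
  LogD-1 = 𝕊.trans D-1 (𝕊.sym (𝕊.zeroˡ 1ˢ))

  LogD-* : ∀ {f f′ g g′} → LogD f g → LogD f′ g′ → LogD (f *ˢ f′) (g +ˢ g′)
  LogD-* {f} {f′} {g} {g′} p q = S.begin
    D (f *ˢ f′)                       S.≈⟨ D-* f f′ ⟩
    D f *ˢ f′ +ˢ f *ˢ D f′            S.≈⟨ 𝕊.+-cong (congʳ f′ p) (congˡ f q) ⟩
    g *ˢ f *ˢ f′ +ˢ f *ˢ (g′ *ˢ f′)   S.≈⟨ solve 4 (λ f f′ g g′ →
      g :* f :* f′ :+ f :* (g′ :* f′) := (g :+ g′) :* (f :* f′)) 𝕊.refl f f′ g g′ ⟩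
    (g +ˢ g′) *ˢ (f *ˢ f′)            S.∎
    where open S-solver

  LogD-^ : ∀ n {f g} → LogD f g → LogD (f ^ˢ n) (n ×ˢ g)
  LogD-^ zero    p = LogD-1
  LogD-^ (suc n) {f} {g} p = LogD-* {f} {f ^ˢ n} {g} {n ×ˢ g} p (LogD-^ n p)

  -- The inverse `v` cancels `u` from both relations. This is what equates the logarithmic
  -- derivative computed from the quotient formula with the one computed from the roots.
  LogD-unique : ∀ {u v g g′} → u *ˢ v ≈ˢ 1ˢ → LogD u g → LogD u g′ → g ≈ˢ g′
  LogD-unique {u} {v} {g} {g′} uv p q = S.begin
    g                S.≈⟨ expand g ⟩
    g *ˢ u *ˢ v      S.≈⟨ congʳ v (𝕊.trans (𝕊.sym p) q) ⟩
    g′ *ˢ u *ˢ v     S.≈⟨ expand g′ ⟨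
    g′               S.∎
    where
    expand : ∀ h → h ≈ˢ h *ˢ u *ˢ v
    expand h = 𝕊.trans (𝕊.sym (𝕊.*-identityʳ h))
      (𝕊.trans (congˡ h (𝕊.sym uv)) (𝕊.sym (*ˢ-assoc h u v)))

  -- Differentiating u v = 1 gives g + u D v = 0, since D u = g u; multiplying by v turns u D v back
  -- into D v.
  LogD-inverse : ∀ {u v g} → u *ˢ v ≈ˢ 1ˢ → LogD u g → LogD v (-ˢ g)
  LogD-inverse {u} {v} {g} uv p = S.begin
    D v                              S.≈⟨ 𝕊.*-identityʳ (D v) ⟨
    D v *ˢ 1ˢ                        S.≈⟨ congˡ (D v) uv ⟨
    D v *ˢ (u *ˢ v)                  S.≈⟨ solve 3 (λ d u v → d :* (u :* v) := (u :* d) :* v) 𝕊.refl (D v) u v ⟩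
    u *ˢ D v *ˢ v                    S.≈⟨ congʳ v uDv ⟩
    (-ˢ g) *ˢ v                      S.∎
    where
    open S-solver
    open Algebra.Properties.Ring 𝕊.ring using () renaming (+-inverseʳ-unique to +ˢ-inverse-unique)
    sum≈0 : g +ˢ u *ˢ D v ≈ˢ 0ˢ
    sum≈0 = S.begin
      g +ˢ u *ˢ D v                  S.≈⟨ 𝕊.+-congʳ (𝕊.trans (𝕊.sym (𝕊.*-identityʳ g)) (congˡ g (𝕊.sym uv))) ⟩
      g *ˢ (u *ˢ v) +ˢ u *ˢ D v      S.≈⟨ 𝕊.+-congʳ (𝕊.trans (𝕊.sym (*ˢ-assoc g u v)) (congʳ v (𝕊.sym p))) ⟩
      D u *ˢ v +ˢ u *ˢ D v           S.≈⟨ D-* u v ⟨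
      D (u *ˢ v)                     S.≈⟨ D-cong uv ⟩
      D 1ˢ                           S.≈⟨ D-1 ⟩
      0ˢ                             S.∎
    uDv : u *ˢ D v ≈ˢ -ˢ g
    uDv = +ˢ-inverse-unique g (u *ˢ D v) sum≈0

-- Polynomials as series with a bound on the degree

module Polynomials {c ℓ} (R : CommutativeRing c ℓ) where
  open CommutativeRing R
  open Series rawRing renaming (Carrier to 𝕊)
  open SeriesRing R
  open LogarithmicDerivative R
  open Algebra.Properties.Ring ring using (-0#≈0#)
  open RawSemiringDefinitions (RawRing.rawSemiring rawRing) using (sum; _^_)
  open Algebra.Solver.Ring.NaturalCoefficients.Default commutativeSemiring
  open SetoidReasoning setoid
  open Algebra.Properties.Monoid.Mult +-monoid using () renaming (_×_ to _×ᴿ_)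
  open Algebra.Properties.Monoid.Mult 𝕊.+-monoid using () renaming (_×_ to _×ˢ_; ×-congʳ to ×ˢ-congʳ)
  open Algebra.Properties.Semiring.Mult 𝕊.semiring using () renaming (×-comm-* to ×ˢ-comm-*)
  open Algebra.Properties.CommutativeMonoid.Mult 𝕊.+-commutativeMonoid using () renaming (×-distrib-+ to ×ˢ-distrib-+)
  private module Rˢ = Algebra.Properties.Ring 𝕊.ring
  private module Sˢ = Algebra.Solver.Ring.NaturalCoefficients.Default 𝕊.commutativeSemiring

  -- Equality of complex coefficients is undecidable, so the exact degree of a polynomial cannot be
  -- computed; a bound is carried instead.
  Degree≤ : ℕ → 𝕊 → Set ℓ
  Degree≤ n f = ∀ k → n < k → f k ≈ 0#

  degree≤-cong : ∀ {n f g} → f ≈ˢ g → Degree≤ n f → Degree≤ n g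
  degree≤-cong p h k n<k = trans (sym (p k)) (h k n<k)

  degree≤-mono : ∀ {m n f} → m ℕ.≤ n → Degree≤ m f → Degree≤ n f
  degree≤-mono m≤n h k n<k = h k (ℕ.≤-<-trans m≤n n<k)

  degree≤-+ : ∀ {n f g} → Degree≤ n f → Degree≤ n g → Degree≤ n (f +ˢ g)
  degree≤-+ p q k n<k = trans (+-cong (p k n<k) (q k n<k)) (+-identityˡ 0#)

  degree≤-neg : ∀ {n f} → Degree≤ n f → Degree≤ n (-ˢ f)
  degree≤-neg p k n<k = trans (-‿cong (p k n<k)) -0#≈0#

  degree≤-D : ∀ {n f} → Degree≤ n f → Degree≤ n (D f)
  degree≤-D p k n<k =
    trans (Algebra.Properties.Monoid.Mult.×-congʳ +-monoid k (p k n<k)) (×-zero k)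

  private
    constant-* : ∀ {f} → Degree≤ 0 f → ∀ g → f *ˢ g ≈ˢ f 0 ⋆ g
    constant-* h g zero    = +-identityʳ _
    constant-* h g (suc k) = trans
      (+-congˡ (zeroˡ-*ˢ g (λ i → h (suc i) (s≤s z≤n)) k)) (+-identityʳ _)

  degree≤-* : ∀ {n m f g} → Degree≤ n f → Degree≤ m g → Degree≤ (n ℕ.+ m) (f *ˢ g)
  degree≤-* {zero}  {f = f} {g} p q k m<k =
    trans (constant-* p g k) (trans (*-congˡ (q k m<k)) (zeroʳ _))
  degree≤-* {suc n} {m} {f} {g} p q (suc k) (s≤s n+m<k) = begin
    f 0 * g (suc k) + (tail f *ˢ g) k
      ≈⟨ +-cong (*-congˡ (q (suc k) (ℕ.m≤n⇒m≤1+n (ℕ.≤-<-trans (ℕ.m≤n+m m n) n+m<k))))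
           (degree≤-* {n} (λ i n<i → p (suc i) (s≤s n<i)) q k n+m<k) ⟩
    f 0 * 0# + 0#  ≈⟨ solve 1 (λ a → a :* con 0 :+ con 0 := con 0) refl (f 0) ⟩
    0#             ∎

  leading-* : ∀ {n m f g} → Degree≤ n f → Degree≤ m g → (f *ˢ g) (n ℕ.+ m) ≈ f n * g m
  leading-* {zero}  {m} {g = g} p q = constant-* p g m
  leading-* {suc n} {m} {f} {g} p q = begin
    f 0 * g (suc (n ℕ.+ m)) + (tail f *ˢ g) (n ℕ.+ m)
      ≈⟨ +-cong (*-congˡ (q _ (s≤s (ℕ.m≤n+m m n)))) (leading-* {n} (λ i n<i → p (suc i) (s≤s n<i)) q) ⟩
    f 0 * 0# + f (suc n) * g m  ≈⟨ +-congʳ (zeroʳ _) ⟩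
    0# + f (suc n) * g m        ≈⟨ +-identityˡ _ ⟩
    f (suc n) * g m             ∎

  record Monic (n : ℕ) (f : 𝕊) : Set ℓ where
    constructor monic
    field
      leading : f n ≈ 1#
      degree≤ : Degree≤ n f
  open Monic public

  monic-cong : ∀ {n f g} → f ≈ˢ g → Monic n f → Monic n g
  monic-cong {n} p (monic l d) = monic (trans (sym (p n)) l) (degree≤-cong p d)

  monic-1 : Monic 0 1ˢ
  monic-1 = monic refl λ { (suc _) _ → refl }

  monic-* : ∀ {n m f g} → Monic n f → Monic m g → Monic (n ℕ.+ m) (f *ˢ g)
  monic-* (monic l d) (monic l′ d′) = monic
    (trans (leading-* d d′) (trans (*-cong l l′) (*-identityˡ 1#)))
    (degree≤-* d d′)

  monic-unique : ¬ (1# ≈ 0#) → ∀ {n m f} → Monic n f → Monic m f → n ≡ m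
  monic-unique 1≉0 {n} {m} (monic l d) (monic l′ d′) with ℕ.<-cmp n m
  ... | tri< n<m _ _ = contradiction (trans (sym l′) (d m n<m)) 1≉0
  ... | tri≈ _ n≡m _ = n≡m
  ... | tri> _ _ m<n = contradiction (trans (sym l) (d′ n m<n)) 1≉0

  private
    t^-> : ∀ n k → n < k → (t ^ˢ n) k ≈ 0#
    t^-> zero    (suc k) _         = refl
    t^-> (suc n) (suc k) (s≤s n<k) = trans (t-* (t ^ˢ n) k) (t^-> n k n<k)

    t^-leading : ∀ n → (t ^ˢ n) n ≈ 1#
    t^-leading zero    = refl
    t^-leading (suc n) = trans (t-* (t ^ˢ n) n) (t^-leading n)

  monic-t^ : ∀ n → Monic n (t ^ˢ n)
  monic-t^ n = monic (t^-leading n) (t^-> n)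

  monic-+ : ∀ {n m f g} → m < n → Monic n f → Degree≤ m g → Monic n (f +ˢ g)
  monic-+ m<n (monic l d) h = monic
    (trans (+-cong l (h _ m<n)) (+-identityʳ 1#))
    (degree≤-+ d (degree≤-mono (ℕ.<⇒≤ m<n) h))

  degree≤-constant : ∀ a → Degree≤ 0 (constant a)
  degree≤-constant a (suc _) _ = refl

  degree≤-t : Degree≤ 1 t
  degree≤-t (suc (suc _)) _       = refl
  degree≤-t (suc zero)    (s≤s ())

  linear : Carrier → 𝕊
  linear a = t -ˢ constant a

  monic-linear : ∀ a → Monic 1 (linear a)
  monic-linear a = monic-+ (s≤s z≤n) (monic refl degree≤-t) (degree≤-neg (degree≤-constant a))

  linear-*-0 : ∀ a f → (linear a *ˢ f) 0 ≈ - a * f 0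
  linear-*-0 a f = trans (+-identityʳ _) (*-congʳ (+-identityˡ _))

  linear-*-suc : ∀ a f k → (linear a *ˢ f) (suc k) ≈ f k + - a * f (suc k)
  linear-*-suc a f k = begin
    (linear a *ˢ f) (suc k)                          ≈⟨ *ˢ-distribʳ f t (-ˢ constant a) (suc k) ⟩
    (t *ˢ f) (suc k) + ((-ˢ constant a) *ˢ f) (suc k)
      ≈⟨ +-cong (t-* f k) (constant-* (degree≤-neg (degree≤-constant a)) f (suc k)) ⟩
    f k + - a * f (suc k)                            ∎

  -- A nonzero constant is not a multiple of t - a among polynomials.
  linear∣constant : ∀ {a c} n {f} → Degree≤ n f → linear a *ˢ f ≈ˢ constant c → c ≈ 0#
  linear∣constant {a} {c} n {f} h p = begin
    c                  ≈⟨ p 0 ⟨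
    (linear a *ˢ f) 0  ≈⟨ linear-*-0 a f ⟩
    - a * f 0          ≈⟨ *-congˡ (f≈0 n h 0) ⟩
    - a * 0#           ≈⟨ zeroʳ _ ⟩
    0#                 ∎
    where
    -- The coefficient of t^(k + 1) reads f k - a f (k + 1) = 0, so vanishing spreads downwards from
    -- beyond the degree bound.
    step : ∀ k → f (suc k) ≈ 0# → f k ≈ 0#
    step k q = begin
      f k                       ≈⟨ solve 2 (λ x y → x := x :+ y :* con 0) refl (f k) (- a) ⟩
      f k + - a * 0#            ≈⟨ +-congˡ (*-congˡ q) ⟨
      f k + - a * f (suc k)     ≈⟨ linear-*-suc a f k ⟨
      (linear a *ˢ f) (suc k)   ≈⟨ p (suc k) ⟩
      0#                        ∎
    f≈0 : ∀ n → Degree≤ n f → ∀ k → f k ≈ 0#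
    f≈0 zero    h zero    = step 0 (h 1 (s≤s z≤n))
    f≈0 zero    h (suc k) = h (suc k) (s≤s z≤n)
    f≈0 (suc n) h = f≈0 n λ k n<k → step k (h (suc k) (s≤s n<k))

  private
    sum-cong : ∀ n {u v : Fin n → Carrier} → (∀ i → u i ≈ v i) → sum u ≈ sum v
    sum-cong zero    p = refl
    sum-cong (suc n) p = +-cong (p Fin.zero) (sum-cong n λ i → p (Fin.suc i))

    *-sum : ∀ n z (u : Fin n → Carrier) → sum (λ i → z * u i) ≈ z * sum u
    *-sum zero    z u = sym (zeroʳ z)
    *-sum (suc n) z u = trans (+-congˡ (*-sum n z (λ i → u (Fin.suc i)))) (sym (distribˡ z _ _))

  eval-cong : ∀ n {f g} z → f ≈ˢ g → eval n f z ≈ eval n g z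
  eval-cong n z p = sum-cong (suc n) λ i → *-congʳ {z ^ toℕ i} (p (toℕ i))

  horner : ∀ n f z → eval (suc n) f z ≈ f 0 + z * eval n (tail f) z
  horner n f z = +-cong (*-identityʳ (f 0)) (trans
    (sum-cong (suc n) λ i → solve 3 (λ a b c → a :* (b :* c) := b :* (a :* c)) refl (f (suc (toℕ i))) z (z ^ toℕ i))
    (*-sum (suc n) z (λ i → f (suc (toℕ i)) * z ^ toℕ i)))

  eval-trim : ∀ n f z → f (suc n) ≈ 0# → eval (suc n) f z ≈ eval n f z
  eval-trim zero    f z p = begin
    eval 1 f z                         ≈⟨ horner 0 f z ⟩
    f 0 + z * (f 1 * 1# + 0#)          ≈⟨ +-congˡ (*-congˡ (+-congʳ (*-congʳ p))) ⟩
    f 0 + z * (0# * 1# + 0#)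
      ≈⟨ solve 2 (λ a z → a :+ z :* (con 0 :* con 1 :+ con 0) := a :* con 1 :+ con 0) refl (f 0) z ⟩
    f 0 * 1# + 0#                      ∎
  eval-trim (suc n) f z p = begin
    eval (2 ℕ.+ n) f z                 ≈⟨ horner (suc n) f z ⟩
    f 0 + z * eval (suc n) (tail f) z  ≈⟨ +-congˡ (*-congˡ (eval-trim n (tail f) z p)) ⟩
    f 0 + z * eval n (tail f) z        ≈⟨ horner n f z ⟨
    eval (suc n) f z                   ∎

  eval-axpy : ∀ n f b g z → eval n (f +ˢ b ⋆ g) z ≈ eval n f z + b * eval n g z
  eval-axpy zero    f b g z = solve 3 (λ x b y →
    (x :+ b :* y) :* con 1 :+ con 0 := (x :* con 1 :+ con 0) :+ b :* (y :* con 1 :+ con 0))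
    refl (f 0) b (g 0)
  eval-axpy (suc n) f b g z = begin
    eval (suc n) (f +ˢ b ⋆ g) z
      ≈⟨ horner n (f +ˢ b ⋆ g) z ⟩
    (f 0 + b * g 0) + z * eval n (tail f +ˢ b ⋆ tail g) z
      ≈⟨ +-congˡ (*-congˡ (eval-axpy n (tail f) b (tail g) z)) ⟩
    (f 0 + b * g 0) + z * (eval n (tail f) z + b * eval n (tail g) z)
      ≈⟨ solve 6 (λ x b y z u v → (x :+ b :* y) :+ z :* (u :+ b :* v) :=
           (x :+ z :* u) :+ b :* (y :+ z :* v)) refl (f 0) b (g 0) z _ _ ⟩
    (f 0 + z * eval n (tail f) z) + b * (g 0 + z * eval n (tail g) z)
      ≈⟨ +-cong (horner n f z) (*-congˡ (horner n g z)) ⟨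
    eval (suc n) f z + b * eval (suc n) g z ∎

  -- The tail of the product is f - a `tail f`. Horner's rule collects the part with -a into -a
  -- times the value of f with bound `suc n`, and the degree bound trims that to `n`.
  eval-linear-* : ∀ n a f z → Degree≤ n f → eval (suc n) (linear a *ˢ f) z ≈ (z - a) * eval n f z
  eval-linear-* n a f z h = begin
    eval (suc n) (linear a *ˢ f) z
      ≈⟨ horner n (linear a *ˢ f) z ⟩
    (linear a *ˢ f) 0 + z * eval n (tail (linear a *ˢ f)) z
      ≈⟨ +-cong (linear-*-0 a f) (*-congˡ (trans
           (eval-cong n z (linear-*-suc a f)) (eval-axpy n f (- a) (tail f) z))) ⟩
    - a * f 0 + z * (eval n f z + - a * eval n (tail f) z)
      ≈⟨ solve 5 (λ x y z u v → x :* y :+ z :* (u :+ x :* v) := z :* u :+ x :* (y :+ z :* v))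
           refl (- a) (f 0) z _ _ ⟩
    z * eval n f z + - a * (f 0 + z * eval n (tail f) z)
      ≈⟨ +-congˡ (*-congˡ (trans (sym (horner n f z)) (eval-trim n f z (h (suc n) ℕ.≤-refl)))) ⟩
    z * eval n f z + - a * eval n f z
      ≈⟨ distribʳ _ z (- a) ⟨
    (z - a) * eval n f z ∎

  fromRoots : List Carrier → 𝕊
  fromRoots = foldr (λ a f → linear a *ˢ f) 1ˢ

  monic-fromRoots : ∀ as → Monic (length as) (fromRoots as)
  monic-fromRoots []       = monic-1
  monic-fromRoots (a ∷ as) = monic-* (monic-linear a) (monic-fromRoots as)

  eval-fromRoots : ∀ as z →
    eval (length as) (fromRoots as) z ≈ foldr (λ a x → (z - a) * x) 1# as
  eval-fromRoots []       z = trans (+-identityʳ _) (*-identityʳ 1#)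
  eval-fromRoots (a ∷ as) z = trans
    (eval-linear-* (length as) a (fromRoots as) z (degree≤ (monic-fromRoots as)))
    (*-congˡ (eval-fromRoots as z))

  monic-^ : ∀ n {m f} → Monic m f → Monic (n ℕ.* m) (f ^ˢ n)
  monic-^ zero    h = monic-1
  monic-^ (suc n) h = monic-* h (monic-^ n h)

  degree≤-1 : Degree≤ 0 1ˢ
  degree≤-1 = degree≤ monic-1

  monic-t^-1 : ∀ n .{{_ : ℕ.NonZero n}} → Monic n (t ^ˢ n -ˢ 1ˢ)
  monic-t^-1 n = monic-+ (ℕ.>-nonZero⁻¹ n) (monic-t^ n) (degree≤-neg degree≤-1)

  degree≤-×ˢ : ∀ m {n f} → Degree≤ n f → Degree≤ n (m ×ˢ f)
  degree≤-×ˢ zero    h = λ _ _ → refl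
  degree≤-×ˢ (suc m) h = degree≤-+ h (degree≤-×ˢ m h)

  -- H = t^N - 1 satisfies D H = N H + N, so a double root would divide N.
  t^-1-squarefree : ∀ N {a n B} → Degree≤ n B → t ^ˢ N -ˢ 1ˢ ≈ˢ linear a *ˢ (linear a *ˢ B) → N ×ᴿ 1# ≈ 0#
  t^-1-squarefree N {a} {n} {B} h p = linear∣constant (suc n) {S} degree-S (𝕊.trans eq constant-N)
    where
    l = linear a
    C = l *ˢ B
    S = (D l *ˢ B +ˢ D C) -ˢ (N ×ˢ C)
    H = t ^ˢ N -ˢ 1ˢ
    degree-C : Degree≤ (suc n) C
    degree-C = degree≤-* (degree≤ (monic-linear a)) h
    degree-S : Degree≤ (suc n) S
    degree-S = degree≤-+ (degree≤-+ (degree≤-* (degree≤-D (degree≤ (monic-linear a))) h) (degree≤-D degree-C))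
      (degree≤-neg (degree≤-×ˢ N degree-C))
    D-neg-1 : D (-ˢ 1ˢ) ≈ˢ 0ˢ
    D-neg-1 zero    = refl
    D-neg-1 (suc k) = trans (Algebra.Properties.Monoid.Mult.×-congʳ +-monoid (suc k) -0#≈0#) (×-zero (suc k))
    D-H : D H ≈ˢ N ×ˢ t ^ˢ N
    D-H = 𝕊.trans (D-+ (t ^ˢ N) (-ˢ 1ˢ)) (𝕊.trans (𝕊.+-cong (D-t^ N) D-neg-1) (𝕊.+-identityʳ _))
    D-product : D H ≈ˢ l *ˢ (D l *ˢ B +ˢ D C)
    D-product = 𝕊.trans (D-cong p) (𝕊.trans (D-* l C)
      (Sˢ.solve 4 (λ d l b e → d Sˢ.:* (l Sˢ.:* b) Sˢ.:+ l Sˢ.:* e Sˢ.:= l Sˢ.:* (d Sˢ.:* b Sˢ.:+ e)) 𝕊.refl (D l) l B (D C)))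
    constant-N : N ×ˢ 1ˢ ≈ˢ constant (N ×ᴿ 1#)
    constant-N k = trans (×ˢ-at N k) (at k)
      where
      ×ˢ-at : ∀ n k → (n ×ˢ 1ˢ) k ≈ n ×ᴿ 1ˢ k
      ×ˢ-at zero    k = refl
      ×ˢ-at (suc n) k = +-congˡ (×ˢ-at n k)
      at : ∀ k → N ×ᴿ 1ˢ k ≈ constant (N ×ᴿ 1#) k
      at zero    = refl
      at (suc k) = ×-zero N
    eq : l *ˢ S ≈ˢ N ×ˢ 1ˢ
    eq = S.begin
      l *ˢ ((D l *ˢ B +ˢ D C) -ˢ (N ×ˢ C))            S.≈⟨ Rˢ.x[y-z]≈xy-xz l (D l *ˢ B +ˢ D C) (N ×ˢ C) ⟩
      l *ˢ (D l *ˢ B +ˢ D C) -ˢ l *ˢ (N ×ˢ C)         S.≈⟨ 𝕊.+-cong (𝕊.sym D-product) (𝕊.-‿cong (𝕊.trans (×ˢ-comm-* N l C) (×ˢ-congʳ N (𝕊.sym p)))) ⟩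
      D H -ˢ (N ×ˢ H)                                 S.≈⟨ 𝕊.+-congʳ (𝕊.trans D-H (×ˢ-congʳ N t^N)) ⟩
      N ×ˢ (H +ˢ 1ˢ) -ˢ (N ×ˢ H)                      S.≈⟨ 𝕊.+-congʳ (𝕊.trans (×ˢ-distrib-+ H 1ˢ N) (𝕊.+-comm (N ×ˢ H) (N ×ˢ 1ˢ))) ⟩
      (N ×ˢ 1ˢ +ˢ N ×ˢ H) -ˢ (N ×ˢ H)                 S.≈⟨ 𝕊.+-assoc (N ×ˢ 1ˢ) (N ×ˢ H) (-ˢ (N ×ˢ H)) ⟩
      N ×ˢ 1ˢ +ˢ (N ×ˢ H -ˢ (N ×ˢ H))                 S.≈⟨ 𝕊.+-congˡ {N ×ˢ 1ˢ} (𝕊.-‿inverseʳ (N ×ˢ H)) ⟩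
      N ×ˢ 1ˢ +ˢ 0ˢ                                   S.≈⟨ 𝕊.+-identityʳ (N ×ˢ 1ˢ) ⟩
      N ×ˢ 1ˢ                                         S.∎
      where
      t^N : t ^ˢ N ≈ˢ H +ˢ 1ˢ
      t^N = 𝕊.sym (𝕊.trans (𝕊.+-assoc (t ^ˢ N) (-ˢ 1ˢ) 1ˢ)
        (𝕊.trans (𝕊.+-congˡ {t ^ˢ N} (𝕊.-‿inverseˡ 1ˢ)) (𝕊.+-identityʳ (t ^ˢ N))))

open ≡ using (refl; sym; trans; cong; cong₂; subst; subst₂; module ≡-Reasoning)

-- The Alexander polynomial of a torus link

module TorusPolynomial where
  open import Data.Integer.Base using (+_; 0ℤ; 1ℤ; -1ℤ)
  open import Defs using (t^[_]-1; 1/[t^_-1]; Δ; module ℤ⟦t⟧)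
  open ℤ⟦t⟧
  module ℤ[t] = Polynomials ℤ.+-*-commutativeRing
  module ℤ⟦t⟧ᴰ = LogarithmicDerivative ℤ.+-*-commutativeRing
  open SeriesRing ℤ.+-*-commutativeRing using (*ˢ-assoc; *ˢ-comm; *ˢ-distribʳ; 1ˢ-*ˢ; 0ˢ)
  open ℤ⟦t⟧ᴰ using (module S; congˡ; congʳ; LogD; LogD-*; LogD-^; LogD-inverse; D; D-+; D-t^)
  private module 𝕊 = ℤ⟦t⟧ᴰ.𝕊
  open Algebra.Properties.Monoid.Mult 𝕊.+-monoid using () renaming (_×_ to _×ˢ_; ×-congʳ to ×ˢ-congʳ)
  open Algebra.Properties.Monoid.Mult ℤ.+-0-monoid using () renaming (_×_ to _×ᶻ_)
  open Algebra.Properties.Semiring.Mult 𝕊.semiring using () renaming (×-assoc-* to ×ˢ-assoc-*)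
  open Algebra.Properties.Ring 𝕊.ring using () renaming (-‿distribˡ-* to -ˢ-distribˡ-*)
  private module Sˢ = Algebra.Solver.Ring.NaturalCoefficients.Default 𝕊.commutativeSemiring

  1/t^n-1-∣ : ∀ {n k} → n ∣ k → 1/[t^ n -1] k ≡ -1ℤ
  1/t^n-1-∣ {n} {k} n∣k rewrite dec-true (n ∣? k) n∣k = refl

  1/t^n-1-∤ : ∀ {n k} → ¬ n ∣ k → 1/[t^ n -1] k ≡ 0ℤ
  1/t^n-1-∤ {n} {k} n∤k rewrite dec-false (n ∣? k) n∤k = refl

  1/t^n-1-shift : ∀ n k → 1/[t^ n -1] (n ℕ.+ k) ≡ 1/[t^ n -1] k
  1/t^n-1-shift n k with n ∣? k
  ... | yes n∣k = 1/t^n-1-∣ (ℕ.∣m∣n⇒∣m+n ℕ.∣-refl n∣k)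
  ... | no  n∤k = 1/t^n-1-∤ λ n∣n+k → n∤k (ℕ.∣m+n∣m⇒∣n n∣n+k ℕ.∣-refl)

  -- Shifting -(1 + t^n + t^2n + ...) by n removes exactly its constant term -1. Below n the only
  -- index divisible by n is 0.
  t^n/t^n-1 : ∀ n .{{_ : NonZero n}} → t ^ˢ n *ˢ 1/[t^ n -1] ≈ˢ 1/[t^ n -1] +ˢ 1ˢ
  t^n/t^n-1 n k with n ℕ.≤? k
  ... | yes n≤k = subst (λ k → (t ^ˢ n *ˢ 1/[t^ n -1]) k ≡ 1/[t^ n -1] k ℤ.+ 1ˢ k)
          (ℕ.m+[n∸m]≡n n≤k) (begin
      (t ^ˢ n *ˢ 1/[t^ n -1]) (n ℕ.+ j)       ≡⟨ ℤ⟦t⟧ᴰ.t^-* n 1/[t^ n -1] j ⟩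
      1/[t^ n -1] j                           ≡⟨ 1/t^n-1-shift n j ⟨
      1/[t^ n -1] (n ℕ.+ j)                   ≡⟨ ℤ.+-identityʳ _ ⟨
      1/[t^ n -1] (n ℕ.+ j) ℤ.+ 0ℤ            ≡⟨ cong (λ x → 1/[t^ n -1] (n ℕ.+ j) ℤ.+ x) (1ˢ-positive n) ⟨
      1/[t^ n -1] (n ℕ.+ j) ℤ.+ 1ˢ (n ℕ.+ j)  ∎)
    where
    open ≡-Reasoning
    j = k ℕ.∸ n
    1ˢ-positive : ∀ n .{{_ : NonZero n}} → 1ˢ (n ℕ.+ j) ≡ 0ℤ
    1ˢ-positive (suc n) = refl
  t^n/t^n-1 n zero    | no n≰k = trans (ℤ⟦t⟧ᴰ.t^-*-< n 1/[t^ n -1] (ℕ.≰⇒> n≰k))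
    (sym (cong (ℤ._+ 1ℤ) (1/t^n-1-∣ {n} (n ℕ.∣0))))
  t^n/t^n-1 n (suc k) | no n≰k = trans (ℤ⟦t⟧ᴰ.t^-*-< n 1/[t^ n -1] (ℕ.≰⇒> n≰k))
    (sym (cong (ℤ._+ 0ℤ) (1/t^n-1-∤ {n} (ℕ.>⇒∤ (ℕ.≰⇒> n≰k)))))

  t^n-1-invertible : ∀ n .{{_ : NonZero n}} → t^[ n ]-1 *ˢ 1/[t^ n -1] ≈ˢ 1ˢ
  t^n-1-invertible n = S.begin
    (t ^ˢ n -ˢ 1ˢ) *ˢ v            S.≈⟨ *ˢ-distribʳ v (t ^ˢ n) (-ˢ 1ˢ) ⟩
    t ^ˢ n *ˢ v +ˢ (-ˢ 1ˢ) *ˢ v    S.≈⟨ 𝕊.+-cong (t^n/t^n-1 n) (𝕊.trans (𝕊.sym (-ˢ-distribˡ-* 1ˢ v)) (𝕊.-‿cong (1ˢ-*ˢ v))) ⟩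
    (v +ˢ 1ˢ) +ˢ (-ˢ v)            S.≈⟨ 𝕊.+-congʳ (𝕊.+-comm v 1ˢ) ⟩
    (1ˢ +ˢ v) +ˢ (-ˢ v)            S.≈⟨ 𝕊.+-assoc 1ˢ v (-ˢ v) ⟩
    1ˢ +ˢ (v -ˢ v)                 S.≈⟨ 𝕊.+-congˡ {1ˢ} (𝕊.-‿inverseʳ v) ⟩
    1ˢ +ˢ 0ˢ                       S.≈⟨ 𝕊.+-identityʳ 1ˢ ⟩
    1ˢ                             S.∎
    where v = 1/[t^ n -1]

  -- D (t^n - 1) = n t^n, and t^n / (t^n - 1) = 1 / (t^n - 1) + 1.
  logD-t^n-1 : ∀ n .{{_ : NonZero n}} → LogD t^[ n ]-1 (n ×ˢ (1/[t^ n -1] +ˢ 1ˢ))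
  logD-t^n-1 n = S.begin
    D (t ^ˢ n -ˢ 1ˢ)                         S.≈⟨ D-+ (t ^ˢ n) (-ˢ 1ˢ) ⟩
    D (t ^ˢ n) +ˢ D (-ˢ 1ˢ)                  S.≈⟨ 𝕊.+-cong (D-t^ n) D-neg-1 ⟩
    n ×ˢ t ^ˢ n +ˢ 0ˢ                        S.≈⟨ 𝕊.+-identityʳ _ ⟩
    n ×ˢ t ^ˢ n                              S.≈⟨ ×ˢ-congʳ n t^n ⟩
    n ×ˢ ((v +ˢ 1ˢ) *ˢ t^[ n ]-1)            S.≈⟨ ×ˢ-assoc-* n (v +ˢ 1ˢ) t^[ n ]-1 ⟨
    (n ×ˢ (v +ˢ 1ˢ)) *ˢ t^[ n ]-1            S.∎
    where
    v = 1/[t^ n -1]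
    D-neg-1 : D (-ˢ 1ˢ) ≈ˢ 0ˢ
    D-neg-1 zero    = refl
    D-neg-1 (suc k) = ℤ⟦t⟧ᴰ.×-zero (suc k)
    t^n : t ^ˢ n ≈ˢ (v +ˢ 1ˢ) *ˢ t^[ n ]-1
    t^n = S.begin
      t ^ˢ n                          S.≈⟨ 𝕊.*-identityʳ (t ^ˢ n) ⟨
      t ^ˢ n *ˢ 1ˢ                    S.≈⟨ congˡ (t ^ˢ n) (𝕊.trans (*ˢ-comm v t^[ n ]-1) (t^n-1-invertible n)) ⟨
      t ^ˢ n *ˢ (v *ˢ t^[ n ]-1)      S.≈⟨ *ˢ-assoc (t ^ˢ n) v t^[ n ]-1 ⟨
      t ^ˢ n *ˢ v *ˢ t^[ n ]-1        S.≈⟨ congʳ t^[ n ]-1 (t^n/t^n-1 n) ⟩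
      (v +ˢ 1ˢ) *ˢ t^[ n ]-1          S.∎

  lcm-nonZero : ∀ p q .{{_ : NonZero p}} .{{_ : NonZero q}} → NonZero (lcm p q)
  lcm-nonZero p q = ℕ.≢-nonZero λ lcm≡0 → ℕ.≢-nonZero⁻¹ (p ℕ.* q) {{ℕ.m*n≢0 p q}} (begin
    p ℕ.* q               ≡⟨ LCM.gcd*lcm p q ⟨
    gcd p q ℕ.* lcm p q   ≡⟨ cong (gcd p q ℕ.*_) lcm≡0 ⟩
    gcd p q ℕ.* 0         ≡⟨ ℕ.*-zeroʳ (gcd p q) ⟩
    0                     ∎)
    where open ≡-Reasoning

  logDΔ : ℕ → ℕ → Carrier
  logDΔ p q = (gcd p q ×ˢ g (lcm p q) +ˢ g 1) +ˢ ((-ˢ g p) +ˢ (-ˢ g q))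
    where
    g : ℕ → Carrier
    g n = n ×ˢ (1/[t^ n -1] +ˢ 1ˢ)

  module _ (p q : ℕ) .{{p≢0 : NonZero p}} .{{q≢0 : NonZero q}} where
    private
      instance
        L≢0 : NonZero (lcm p q)
        L≢0 = lcm-nonZero p q

    logD-Δ : LogD (Δ p q) (logDΔ p q)
    logD-Δ = LogD-* {t^[ lcm p q ]-1 ^ˢ gcd p q *ˢ t^[ 1 ]-1} {1/[t^ p -1] *ˢ 1/[t^ q -1]}
                    {gcd p q ×ˢ g (lcm p q) +ˢ g 1} {(-ˢ g p) +ˢ (-ˢ g q)}
      (LogD-* {t^[ lcm p q ]-1 ^ˢ gcd p q} {t^[ 1 ]-1} {gcd p q ×ˢ g (lcm p q)} {g 1}
        (LogD-^ (gcd p q) {t^[ lcm p q ]-1} {g (lcm p q)} (logD-t^n-1 (lcm p q))) (logD-t^n-1 1))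
      (LogD-* {1/[t^ p -1]} {1/[t^ q -1]} { -ˢ g p} { -ˢ g q} (inverse p) (inverse q))
      where
      g : ℕ → Carrier
      g n = n ×ˢ (1/[t^ n -1] +ˢ 1ˢ)
      inverse : ∀ n .{{_ : NonZero n}} → LogD 1/[t^ n -1] (-ˢ g n)
      inverse n = LogD-inverse {t^[ n ]-1} {1/[t^ n -1]} {g n} (t^n-1-invertible n) (logD-t^n-1 n)

    -- With the denominators cleared, every factor other than Δ is visibly a polynomial; degrees and
    -- divisibility are read off from this form.
    Δ-quotient : Δ p q *ˢ (t^[ p ]-1 *ˢ t^[ q ]-1) ≈ˢ t^[ lcm p q ]-1 ^ˢ gcd p q *ˢ t^[ 1 ]-1
    Δ-quotient = S.begin
      N *ˢ (vp *ˢ vq) *ˢ (a *ˢ b)     S.≈⟨ solve 5 (λ n x y a b →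
        n :* (x :* y) :* (a :* b) := n :* ((a :* x) :* (b :* y))) 𝕊.refl N vp vq a b ⟩
      N *ˢ ((a *ˢ vp) *ˢ (b *ˢ vq))   S.≈⟨ congˡ N (ℤ⟦t⟧ᴰ.𝕊.*-cong {a *ˢ vp} {1ˢ} {b *ˢ vq} {1ˢ} (t^n-1-invertible p) (t^n-1-invertible q)) ⟩
      N *ˢ (1ˢ *ˢ 1ˢ)                 S.≈⟨ congˡ N (1ˢ-*ˢ 1ˢ) ⟩
      N *ˢ 1ˢ                         S.≈⟨ 𝕊.*-identityʳ N ⟩
      N                               S.∎
      where
      open Sˢ
      N = t^[ lcm p q ]-1 ^ˢ gcd p q *ˢ t^[ 1 ]-1
      a = t^[ p ]-1
      b = t^[ q ]-1
      vp = 1/[t^ p -1]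
      vq = 1/[t^ q -1]

    -- Provides the inverse required by `LogD-unique`.
    Δ-invertible : ∃ λ v → Δ p q *ˢ v ≈ˢ 1ˢ
    Δ-invertible = (a *ˢ b) *ˢ (vL ^ˢ d *ˢ v1) , (S.begin
      Δ p q *ˢ ((a *ˢ b) *ˢ (vL ^ˢ d *ˢ v1))     S.≈⟨ *ˢ-assoc (Δ p q) (a *ˢ b) (vL ^ˢ d *ˢ v1) ⟨
      Δ p q *ˢ (a *ˢ b) *ˢ (vL ^ˢ d *ˢ v1)       S.≈⟨ congʳ (vL ^ˢ d *ˢ v1) Δ-quotient ⟩
      (uL ^ˢ d *ˢ u1) *ˢ (vL ^ˢ d *ˢ v1)
        S.≈⟨ solve 4 (λ x y z w → (x :* y) :* (z :* w) := (x :* z) :* (y :* w)) 𝕊.refl (uL ^ˢ d) u1 (vL ^ˢ d) v1 ⟩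
      (uL ^ˢ d *ˢ vL ^ˢ d) *ˢ (u1 *ˢ v1)
        S.≈⟨ ℤ⟦t⟧ᴰ.𝕊.*-cong {uL ^ˢ d *ˢ vL ^ˢ d} {1ˢ} {u1 *ˢ v1} {1ˢ} (inverse-^ d) (t^n-1-invertible 1) ⟩
      1ˢ *ˢ 1ˢ                                   S.≈⟨ 1ˢ-*ˢ 1ˢ ⟩
      1ˢ                                         S.∎)
      where
      open Sˢ using (solve; _:*_; _:=_)
      d = gcd p q
      a = t^[ p ]-1
      b = t^[ q ]-1
      uL = t^[ lcm p q ]-1
      vL = 1/[t^ lcm p q -1]
      u1 = t^[ 1 ]-1
      v1 = 1/[t^ 1 -1]
      inverse-^ : ∀ m → uL ^ˢ m *ˢ vL ^ˢ m ≈ˢ 1ˢ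
      inverse-^ zero    = 1ˢ-*ˢ 1ˢ
      inverse-^ (suc m) = S.begin
        (uL *ˢ uL ^ˢ m) *ˢ (vL *ˢ vL ^ˢ m)
          S.≈⟨ solve 4 (λ x y z w → (x :* y) :* (z :* w) := (x :* z) :* (y :* w)) 𝕊.refl uL (uL ^ˢ m) vL (vL ^ˢ m) ⟩
        (uL *ˢ vL) *ˢ (uL ^ˢ m *ˢ vL ^ˢ m)
          S.≈⟨ ℤ⟦t⟧ᴰ.𝕊.*-cong {uL *ˢ vL} {1ˢ} {uL ^ˢ m *ˢ vL ^ˢ m} {1ˢ} (t^n-1-invertible (lcm p q)) (inverse-^ m) ⟩
        1ˢ *ˢ 1ˢ  S.≈⟨ 1ˢ-*ˢ 1ˢ ⟩
        1ˢ        S.∎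

  ×ᶻ≡* : ∀ n x → n ×ᶻ x ≡ + n ℤ.* x
  ×ᶻ≡* zero    x = refl
  ×ᶻ≡* (suc n) x = trans (cong (λ y → x ℤ.+ y) (×ᶻ≡* n x)) (sym (ℤ.suc-* (+ n) x))

  -- For positive n this is the k-th power sum of the n-th roots of unity.
  multiple : ℕ → ℕ → ℕ
  multiple n k = if does (n ∣? k) then n else 0

  multiple-∣ : ∀ {n k} → n ∣ k → multiple n k ≡ n
  multiple-∣ {n} {k} n∣k rewrite dec-true (n ∣? k) n∣k = refl

  multiple≤ : ∀ n k .{{_ : NonZero k}} → multiple n k ℕ.≤ k
  multiple≤ n k with n ∣? k
  ... | yes n∣k = ℕ.∣⇒≤ n∣k
  ... | no  _   = z≤n

  -- Σ α^k over the roots α of Δ p q.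
  powerSum : ℕ → ℕ → ℕ → ℤ
  powerSum p q k =
    + (gcd p q ℕ.* multiple (lcm p q) k ℕ.+ 1) ℤ.- + (multiple p k ℕ.+ multiple q k)

  -- At a positive index the summand `1ˢ` of each n (1 / (t^n - 1) + 1) vanishes, leaving -n if n
  -- divides the index and 0 otherwise.
  logDΔ-powerSum : ∀ p q k → logDΔ p q (suc k) ≡ ℤ.- powerSum p q (suc k)
  logDΔ-powerSum p q k = begin
    ((gcd p q ×ˢ g (lcm p q)) (suc k) ℤ.+ g 1 (suc k)) ℤ.+ (ℤ.- g p (suc k) ℤ.+ ℤ.- g q (suc k))
      ≡⟨ cong₂ ℤ._+_ (cong₂ ℤ._+_ (trans (×ˢ-at (gcd p q) (g (lcm p q)) (suc k)) (cong (gcd p q ×ᶻ_) (g-at (lcm p q))))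
                                 (trans (g-at 1) (cong (λ n → ℤ.- (+ n)) (multiple-∣ (ℕ.1∣ suc k)))))
           (cong₂ (λ x y → ℤ.- x ℤ.+ ℤ.- y) (g-at p) (g-at q)) ⟩
    (gcd p q ×ᶻ (ℤ.- + m L) ℤ.+ ℤ.- 1ℤ) ℤ.+ (ℤ.- (ℤ.- + m p) ℤ.+ ℤ.- (ℤ.- + m q))
      ≡⟨ cong (λ x → (x ℤ.+ ℤ.- 1ℤ) ℤ.+ (ℤ.- (ℤ.- + m p) ℤ.+ ℤ.- (ℤ.- + m q))) (×ᶻ≡* (gcd p q) (ℤ.- + m L)) ⟩
    (+ gcd p q ℤ.* (ℤ.- + m L) ℤ.+ ℤ.- 1ℤ) ℤ.+ (ℤ.- (ℤ.- + m p) ℤ.+ ℤ.- (ℤ.- + m q))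
      ≡⟨ solve 4 (λ d l x y → (d :* (:- l) :+ :- con 1ℤ) :+ (:- (:- x) :+ :- (:- y)) :=
           :- ((d :* l :+ con 1ℤ) :- (x :+ y))) refl (+ gcd p q) (+ m L) (+ m p) (+ m q) ⟩
    ℤ.- ((+ gcd p q ℤ.* + m L ℤ.+ 1ℤ) ℤ.- (+ m p ℤ.+ + m q))
      ≡⟨ cong (λ x → ℤ.- ((x ℤ.+ 1ℤ) ℤ.- (+ m p ℤ.+ + m q))) (ℤ.pos-* (gcd p q) (m L)) ⟨
    ℤ.- powerSum p q (suc k) ∎
    where
    open ≡-Reasoning
    open ℤSolver
    L = lcm p q
    m : ℕ → ℕ
    m n = multiple n (suc k)
    g : ℕ → Carrier
    g n = n ×ˢ (1/[t^ n -1] +ˢ 1ˢ)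
    ×ˢ-at : ∀ n f k → (n ×ˢ f) k ≡ n ×ᶻ f k
    ×ˢ-at zero    f k = refl
    ×ˢ-at (suc n) f k = cong (λ y → f k ℤ.+ y) (×ˢ-at n f k)
    v-at : ∀ n → + n ℤ.* (1/[t^ n -1] (suc k) ℤ.+ 0ℤ) ≡ ℤ.- + m n
    v-at n with does (n ∣? suc k)
    ... | true  = trans (ℤ.*-comm (+ n) -1ℤ) (ℤ.-1*i≡-i (+ n))
    ... | false = ℤ.*-zeroʳ (+ n)
    g-at : ∀ n → g n (suc k) ≡ ℤ.- + m n
    g-at n = trans (×ˢ-at n (1/[t^ n -1] +ˢ 1ˢ) (suc k)) (trans (×ᶻ≡* n _) (v-at n))

  -- The point is uniformity in p and q. The large term gcd * lcm = p q occurs only when lcm divides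
  -- k; then p and q both divide k and p q is at most k^2. The terms add up to k^2 + 1 + 2 k.
  ∣powerSum∣≤ : ∀ p q k .{{_ : NonZero p}} .{{_ : NonZero q}} .{{_ : NonZero k}} →
               ℤ.∣ powerSum p q k ∣ ℕ.≤ suc k ℕ.* suc k
  ∣powerSum∣≤ p q k = begin
    ℤ.∣ + x ℤ.- + y ∣          ≡⟨ cong ℤ.∣_∣ (ℤ.m-n≡m⊖n x y) ⟩
    ℤ.∣ x ℤ.⊖ y ∣              ≤⟨ ℤ.∣m⊝n∣≤m⊔n x y ⟩
    x ℕ.⊔ y                    ≤⟨ ℕ.m⊔n≤m+n x y ⟩
    x ℕ.+ y                    ≤⟨ ℕ.+-mono-≤ (ℕ.+-monoˡ-≤ 1 gcd*≤) (ℕ.+-mono-≤ (multiple≤ p k) (multiple≤ q k)) ⟩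
    (k ℕ.* k ℕ.+ 1) ℕ.+ (k ℕ.+ k)
      ≡⟨ solve 1 (λ k → (k :* k :+ con 1) :+ (k :+ k) := (con 1 :+ k) :* (con 1 :+ k)) refl k ⟩
    suc k ℕ.* suc k            ∎
    where
    open ℕ.≤-Reasoning
    open ℕSolver
    x = gcd p q ℕ.* multiple (lcm p q) k ℕ.+ 1
    y = multiple p k ℕ.+ multiple q k
    gcd*≤ : gcd p q ℕ.* multiple (lcm p q) k ℕ.≤ k ℕ.* k
    gcd*≤ with lcm p q ∣? k
    ... | no  _   = ℕ.≤-trans (ℕ.≤-reflexive (ℕ.*-zeroʳ (gcd p q))) z≤n
    ... | yes L∣k = ℕ.≤-trans (ℕ.≤-reflexive (LCM.gcd*lcm p q))
      (ℕ.*-mono-≤ (ℕ.∣⇒≤ (ℕ.∣-trans (LCM.m∣lcm[m,n] p q) L∣k))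
                  (ℕ.∣⇒≤ (ℕ.∣-trans (LCM.n∣lcm[m,n] p q) L∣k)))

  -- The exponent p q is a multiple of p, q and their lcm, so all indicators are 1 and the value is
  -- p q + 1 - p - q, which factors.
  powerSum-pq : ∀ p q .{{_ : NonZero p}} .{{_ : NonZero q}} →
                powerSum p q (p ℕ.* q) ≡ + ((p ℕ.∸ 1) ℕ.* (q ℕ.∸ 1))
  powerSum-pq p@(suc i) q@(suc j) = begin
    powerSum p q (p ℕ.* q)
      ≡⟨ cong₂ (λ x y → + (gcd p q ℕ.* x ℕ.+ 1) ℤ.- + y) (multiple-∣ {lcm p q} L∣pq)
           (cong₂ ℕ._+_ (multiple-∣ {p} (ℕ.m∣m*n q)) (multiple-∣ {q} (ℕ.n∣m*n p))) ⟩
    + (gcd p q ℕ.* lcm p q ℕ.+ 1) ℤ.- + (p ℕ.+ q)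
      ≡⟨ cong (λ x → + x ℤ.- + (p ℕ.+ q)) (trans (cong (ℕ._+ 1) (LCM.gcd*lcm p q))
           (ℕˢ.solve 2 (λ i j → (ℕˢ.con 1 ℕˢ.:+ i) ℕˢ.:* (ℕˢ.con 1 ℕˢ.:+ j) ℕˢ.:+ ℕˢ.con 1 ℕˢ.:= i ℕˢ.:* j ℕˢ.:+
             ((ℕˢ.con 1 ℕˢ.:+ i) ℕˢ.:+ (ℕˢ.con 1 ℕˢ.:+ j))) refl i j)) ⟩
    (+ (i ℕ.* j) ℤ.+ + (p ℕ.+ q)) ℤ.- + (p ℕ.+ q)
      ≡⟨ solve 2 (λ x y → (x :+ y) :- y := x) refl (+ (i ℕ.* j)) (+ (p ℕ.+ q)) ⟩
    + (i ℕ.* j) ∎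
    where
    open ≡-Reasoning
    open ℤSolver
    module ℕˢ = ℕSolver
    L∣pq : lcm p q ∣ p ℕ.* q
    L∣pq = ℕ.divides (gcd p q) (sym (LCM.gcd*lcm p q))

open import Defs
open TorusPolynomial

-- The reals and the complex numbers as rings with order and absolute value

private
  ℚ⟶ℝ : ℚ.+-*-rawRing -Raw-AlmostCommutative⟶ fromCommutativeRing ℝ-commutativeRing
  ℚ⟶ℝ = record
    { ⟦_⟧ = fromℚ
    ; +-homo = λ _ _ → pointwise λ _ → refl
    ; *-homo = λ _ _ → pointwise λ _ → refl
    ; -‿homo = λ _ → pointwise λ _ → refl
    ; 0-homo = ≈-refl
    ; 1-homo = ≈-refl
    }

  fromℚ-≟ : ∀ p q → Maybe (fromℚ p ≈ fromℚ q)
  fromℚ-≟ p q with p ℚ.≟ q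
  ... | yes refl = just ≈-refl
  ... | no  _    = nothing

module ℝ-Solver = Algebra.Solver.Ring ℚ.+-*-rawRing (fromCommutativeRing ℝ-commutativeRing) ℚ⟶ℝ fromℚ-≟

pos : ∀ {ε} → .{{_ : Positive ε}} → 0ℚ ℚ.≤ ε
pos {ε} = ℚ.nonNegative⁻¹ ε {{ℚ.pos⇒nonNeg ε}}

p≤p+ε : ∀ p ε .{{_ : Positive ε}} → p ℚ.≤ p ℚ.+ ε
p≤p+ε p ε = subst (ℚ._≤ p ℚ.+ ε) (ℚ.+-identityʳ p) (ℚ.+-monoʳ-≤ p pos)

p≤∣p∣ : ∀ p → p ℚ.≤ ℚ.∣ p ∣
p≤∣p∣ p with ℚ.≤-total 0ℚ p
... | inj₁ 0≤p = ℚ.≤-reflexive (sym (ℚ.0≤p⇒∣p∣≡p 0≤p))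
... | inj₂ p≤0 = ℚ.≤-trans p≤0 (ℚ.0≤∣p∣ p)

∣p∣≤ : ∀ {p q} → p ℚ.≤ q → ℚ.- p ℚ.≤ q → ℚ.∣ p ∣ ℚ.≤ q
∣p∣≤ {p} h h′ with ℚ.∣p∣≡p∨∣p∣≡-p p
... | inj₁ e = subst (ℚ._≤ _) (sym e) h
... | inj₂ e = subst (ℚ._≤ _) (sym e) h′

p-q≤r⇒p≤q+r : ∀ {p q r} → p ℚ.- q ℚ.≤ r → p ℚ.≤ q ℚ.+ r
p-q≤r⇒p≤q+r {p} {q} {r} h = subst (ℚ._≤ q ℚ.+ r) (eq p q) (ℚ.+-monoʳ-≤ q h)
  where
  open ℚSolver
  eq : ∀ p q → q ℚ.+ (p ℚ.- q) ≡ p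
  eq = solve 2 (λ p q → q :+ (p :- q) := p) refl

dist-bound : ∀ {p q r} → p ℚ.≤ q ℚ.+ r → q ℚ.≤ p ℚ.+ r → ℚ.∣ p ℚ.- q ∣ ℚ.≤ r
dist-bound {p} {q} h h′ = ∣p∣≤ (a≤c+b⇒a-c≤b q h)
  (≤-respˡ (eq p q) (a≤c+b⇒a-c≤b p h′))
  where
  open ℚSolver
  eq : ∀ p q → q ℚ.- p ≡ ℚ.- (p ℚ.- q)
  eq = solve 2 (λ p q → q :- p := :- (p :- q)) refl

≤-pointwise : ∀ {x y} → (∀ n → seq x n ℚ.≤ seq y n) → x ≤ y
≤-pointwise {x} {y} h = mk≤ λ ε → 0 , λ n _ → ℚ.≤-trans (h n) (p≤p+ε (seq y n) ε)

≤-reflexive : ∀ {x y} → x ≈ y → x ≤ y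
≤-reflexive {x} {y} p = mk≤ λ ε → let (N , c) = close p ε in
  N , λ n N≤n → p-q≤r⇒p≤q+r {seq x n} {seq y n} {ε} (ℚ.≤-trans (p≤∣p∣ _) (c n N≤n))

+-halves : ∀ {a b c} ε → a ℚ.≤ b ℚ.+ ½ ℚ.* ε → b ℚ.≤ c ℚ.+ ½ ℚ.* ε → a ℚ.≤ c ℚ.+ ε
+-halves {a} {b} {c} ε p q = ℚ.≤-trans p (subst (b ℚ.+ ½ ℚ.* ε ℚ.≤_)
  (trans (ℚ.+-assoc c _ _) (cong (c ℚ.+_) (½+½ ε))) (ℚ.+-monoˡ-≤ (½ ℚ.* ε) q))

≤-trans : ∀ {x y z} → x ≤ y → y ≤ z → x ≤ z
≤-trans {x} {y} {z} p q = mk≤ λ ε → both (λ n → +-halves {seq x n} {seq y n} {seq z n} ε)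
  (below p (½ ℚ.* ε) {{½⁺ ε}}) (below q (½ ℚ.* ε) {{½⁺ ε}})

≤-antisym : ∀ {x y} → x ≤ y → y ≤ x → x ≈ y
≤-antisym {x} {y} p q = mk≈ λ ε → both (λ n → dist-bound {seq x n} {seq y n} {ε}) (below p ε) (below q ε)

ℝ-poset : Poset 0ℓ 0ℓ 0ℓ
ℝ-poset = record { _≤_ = _≤_ ; isPartialOrder = record
  { isPreorder = record
    { isEquivalence = ℝ-Ring.isEquivalence
    ; reflexive = ≤-reflexive
    ; trans = ≤-trans }
  ; antisym = ≤-antisym } }

module ≤-Reasoning = Relation.Binary.Reasoning.PartialOrder ℝ-poset

0≤⇒≤ : ∀ {x y} → 0ℝ ≤ y - x → x ≤ y
0≤⇒≤ {x} {y} h = mk≤ λ ε → let (N , c) = below h ε in N , λ n N≤n →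
  subst₂ ℚ._≤_ (ℚ.+-identityʳ (seq x n)) (eq (seq x n) (seq y n) ε) (ℚ.+-monoʳ-≤ (seq x n) (c n N≤n))
  where
  open ℚSolver
  eq : ∀ x y ε → x ℚ.+ ((y ℚ.- x) ℚ.+ ε) ≡ y ℚ.+ ε
  eq = solve 3 (λ x y ε → x :+ ((y :- x) :+ ε) := y :+ ε) refl

≤⇒0≤ : ∀ {x y} → x ≤ y → 0ℝ ≤ y - x
≤⇒0≤ {x} {y} h = mk≤ λ ε → let (N , c) = below h ε in N , λ n N≤n →
  subst₂ ℚ._≤_ (ℚ.+-inverseʳ (seq x n)) (eq (seq x n) (seq y n) ε) (ℚ.+-monoˡ-≤ (ℚ.- seq x n) (c n N≤n))
  where
  open ℚSolver
  eq : ∀ x y ε → (y ℚ.+ ε) ℚ.- x ≡ (y ℚ.- x) ℚ.+ ε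
  eq = solve 3 (λ x y ε → (y :+ ε) :- x := (y :- x) :+ ε) refl

∣∣-cong : ∀ {x y} → x ≈ y → ∣ x ∣ ≈ ∣ y ∣
∣∣-cong {x} {y} p = mk≈ λ ε → let (N , c) = close p ε in
  N , λ n N≤n → ℚ.≤-trans (dist-∣∣ (seq x n) (seq y n)) (c n N≤n)

x≤∣x∣ : ∀ x → x ≤ ∣ x ∣
x≤∣x∣ x = ≤-pointwise λ n → p≤∣p∣ (seq x n)

0≤∣x∣ : ∀ x → 0ℝ ≤ ∣ x ∣
0≤∣x∣ x = ≤-pointwise λ n → ℚ.0≤∣p∣ (seq x n)

∣-x∣≈∣x∣ : ∀ x → ∣ - x ∣ ≈ ∣ x ∣
∣-x∣≈∣x∣ x = pointwise λ n → ℚ.∣-p∣≡∣p∣ (seq x n)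

∣xy∣≈ : ∀ x y → ∣ x * y ∣ ≈ ∣ x ∣ * ∣ y ∣
∣xy∣≈ x y = pointwise λ n → ℚ.∣p*q∣≡∣p∣*∣q∣ (seq x n) (seq y n)

∣x+y∣≤ : ∀ x y → ∣ x + y ∣ ≤ ∣ x ∣ + ∣ y ∣
∣x+y∣≤ x y = ≤-pointwise λ n → ℚ.∣p+q∣≤∣p∣+∣q∣ (seq x n) (seq y n)

∣x∣≤ : ∀ {x y} → x ≤ y → - x ≤ y → ∣ x ∣ ≤ y
∣x∣≤ {x} {y} p q = mk≤ λ ε → both (λ n → ∣p∣≤ {seq x n} {seq y n ℚ.+ ε}) (below p ε) (below q ε)

0≤⇒∣x∣≈x : ∀ {x} → 0ℝ ≤ x → ∣ x ∣ ≈ x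
0≤⇒∣x∣≈x {x} h = ≤-antisym
  (∣x∣≤ (≤-reflexive ≈-refl) (0≤⇒≤ (≤-trans (0≤+ h h) (≤-reflexive (pointwise λ n → cong (seq x n ℚ.+_) (sym (neg-neg (seq x n))))))))
  (x≤∣x∣ x)
  where
  neg-neg : ∀ p → ℚ.- (ℚ.- p) ≡ p
  neg-neg = solve 1 (λ p → :- (:- p) := p) refl
    where open ℚSolver

-- A nonnegative real may have negative approximants. Passing to absolute values, to which
-- nonnegative reals are equal, makes the product nonnegative term by term.
0≤* : ∀ {x y} → 0ℝ ≤ x → 0ℝ ≤ y → 0ℝ ≤ x * y
0≤* {x} {y} p q = ≤-trans (0≤∣x∣ (x * y)) (≤-reflexive
  (≈-trans (∣xy∣≈ x y) (*-cong (0≤⇒∣x∣≈x p) (0≤⇒∣x∣≈x q))))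

0≤x² : ∀ x → 0ℝ ≤ x * x
0≤x² x = ≤-trans (0≤* (0≤∣x∣ x) (0≤∣x∣ x)) (≤-pointwise λ n → ℚ.≤-reflexive (sq (seq x n)))
  where
  neg-sq : ∀ p → ℚ.- p ℚ.* ℚ.- p ≡ p ℚ.* p
  neg-sq = solve 1 (λ p → :- p :* :- p := p :* p) refl
    where open ℚSolver
  sq : ∀ p → ℚ.∣ p ∣ ℚ.* ℚ.∣ p ∣ ≡ p ℚ.* p
  sq p with ℚ.∣p∣≡p∨∣p∣≡-p p
  ... | inj₁ e rewrite e = refl
  ... | inj₂ e rewrite e = neg-sq p

+-mono-≤ : ∀ {x x′ y y′} → x ≤ x′ → y ≤ y′ → x + y ≤ x′ + y′
+-mono-≤ {x} {x′} {y} {y′} p q = 0≤⇒≤ (≤-trans (0≤+ (≤⇒0≤ p) (≤⇒0≤ q))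
  (≤-reflexive (solve 4 (λ x x′ y y′ → (x′ :- x) :+ (y′ :- y) := (x′ :+ y′) :- (x :+ y)) ≈-refl x x′ y y′)))
  where open ℝ-Solver

*-monoˡ-≤ : ∀ {z x y} → 0ℝ ≤ z → x ≤ y → z * x ≤ z * y
*-monoˡ-≤ {z} {x} {y} h p = 0≤⇒≤ (≤-trans (0≤* h (≤⇒0≤ p))
  (≤-reflexive (solve 3 (λ z x y → z :* (y :- x) := z :* y :- z :* x) ≈-refl z x y)))
  where open ℝ-Solver

*-mono-≤ : ∀ {x x′ y y′} → 0ℝ ≤ x → 0ℝ ≤ y′ → x ≤ x′ → y ≤ y′ → x * y ≤ x′ * y′
*-mono-≤ {x} {x′} {y} {y′} 0≤x 0≤y′ p q = ≤-trans (*-monoˡ-≤ 0≤x q)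
  (≤-trans (≤-reflexive (ℝ-Ring.*-comm x y′)) (≤-trans (*-monoˡ-≤ 0≤y′ p) (≤-reflexive (ℝ-Ring.*-comm y′ x′))))

fromℚ-mono : ∀ {p q} → p ℚ.≤ q → fromℚ p ≤ fromℚ q
fromℚ-mono h = ≤-pointwise λ _ → h

≤-limit : ∀ {x y} → (∀ ε .{{_ : Positive ε}} → x ≤ y + fromℚ ε) → x ≤ y
≤-limit {x} {y} h = mk≤ λ ε → let (N , c) = below (h (½ ℚ.* ε) {{½⁺ ε}}) (½ ℚ.* ε) {{½⁺ ε}} in
  N , λ n N≤n → +-halves {seq x n} {seq y n ℚ.+ ½ ℚ.* ε} {seq y n} ε (c n N≤n) ℚ.≤-refl

-- Decided by comparing a rational approximation of x with the midpoint of p and q.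
≤-cotrans : ∀ x {p q} → p ℚ.< q → x ≤ fromℚ q ⊎ fromℚ p ≤ x
≤-cotrans x {p} {q} p<q = result
  where
  open ℚSolver
  ε = ½ ℚ.* (q ℚ.- p)
  instance
    ε⁺ : Positive ε
    ε⁺ = ½⁺ (q ℚ.- p) {{ℚ.positive (subst (ℚ._< q ℚ.- p) (ℚ.+-inverseʳ p) (ℚ.+-monoˡ-< (ℚ.- p) p<q))}}
  N = proj₁ (cauchy x ε)
  m = p ℚ.+ ε
  m+ε : m ℚ.+ ε ≡ q
  m+ε = trans (ℚ.+-assoc p ε ε) (trans (cong (p ℚ.+_) (½+½ (q ℚ.- p)))
    (solve 2 (λ p q → p :+ (q :- p) := q) refl p q))
  near : ∀ {a b} → N ℕ.≤ a → N ℕ.≤ b → seq x a ℚ.≤ seq x b ℚ.+ ε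
  near {a} {b} Na Nb = p-q≤r⇒p≤q+r {seq x a} {seq x b} {ε} (ℚ.≤-trans (p≤∣p∣ _) (proj₂ (cauchy x ε) a b Na Nb))
  result : x ≤ fromℚ q ⊎ fromℚ p ≤ x
  result with ℚ.≤-total (seq x N) m
  ... | inj₁ h = inj₁ (mk≤ λ η → N , λ n N≤n → ℚ.≤-trans (near N≤n ℕ.≤-refl)
        (ℚ.≤-trans (subst (seq x N ℚ.+ ε ℚ.≤_) m+ε (ℚ.+-monoˡ-≤ ε h)) (p≤p+ε q η)))
  ... | inj₂ h = inj₂ (mk≤ λ η → N , λ n N≤n → ℚ.≤-trans
        (subst₂ ℚ._≤_ (solve 2 (λ p ε → (p :+ ε) :- ε := p) refl p ε)
          (solve 2 (λ x ε → (x :+ ε) :- ε := x) refl (seq x n) ε)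
          (ℚ.+-monoˡ-≤ (ℚ.- ε) (ℚ.≤-trans h (near ℕ.≤-refl N≤n))))
        (p≤p+ε (seq x n) η))

fromℚ-reflects-≤ : ∀ {p q} → fromℚ p ≤ fromℚ q → p ℚ.≤ q
fromℚ-reflects-≤ {p} {q} h with p ℚ.≤? q
... | yes p≤q = p≤q
... | no  p≰q = contradiction (ℚ.<-≤-trans q+ε<p (proj₂ (below h ε {{ε⁺}}) _ ℕ.≤-refl)) (ℚ.<-irrefl refl)
  where
  open ℚSolver
  d⁺ : Positive (p ℚ.- q)
  d⁺ = ℚ.positive (subst (ℚ._< p ℚ.- q) (ℚ.+-inverseʳ q) (ℚ.+-monoˡ-< (ℚ.- q) (ℚ.≰⇒> p≰q)))
  ε = ½ ℚ.* (p ℚ.- q)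
  ε⁺ : Positive ε
  ε⁺ = ½⁺ (p ℚ.- q) {{d⁺}}
  q+ε<p : q ℚ.+ ε ℚ.< p
  q+ε<p = subst (q ℚ.+ ε ℚ.<_) (trans (ℚ.+-assoc q ε ε) (trans (cong (q ℚ.+_) (½+½ (p ℚ.- q)))
      (solve 2 (λ p q → q :+ (p :- q) := p) refl p q)))
    (subst (ℚ._< (q ℚ.+ ε) ℚ.+ ε) (ℚ.+-identityʳ _) (ℚ.+-monoʳ-< (q ℚ.+ ε) (ℚ.positive⁻¹ ε {{ε⁺}})))

0≤1 : 0ℝ ≤ 1ℝ
0≤1 = fromℚ-mono (pos {1ℚ})

1≉0 : ¬ (1ℝ ≈ 0ℝ)
1≉0 p = contradiction (fromℚ-reflects-≤ {1ℚ} {0ℚ} (≤-reflexive p)) (λ 1≤0 → ℚ.<-irrefl refl (ℚ.<-≤-trans (ℚ.positive⁻¹ 1ℚ) 1≤0))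

toℚᵘ-/1 : ∀ i → ℚ.toℚᵘ (i ℚ./ 1) ℚᵘ.≃ ℚᵘ.mkℚᵘ i 0
toℚᵘ-/1 i = ℚ.toℚᵘ-fromℚᵘ (ℚᵘ.mkℚᵘ i 0)

fromℤ-+ : ∀ i j → fromℤ (i ℤ.+ j) ≈ fromℤ i + fromℤ j
fromℤ-+ i j = pointwise λ _ → ℚ.toℚᵘ-injective (begin
  ℚ.toℚᵘ ((i ℤ.+ j) ℚ./ 1)                      ≈⟨ toℚᵘ-/1 (i ℤ.+ j) ⟩
  ℚᵘ.mkℚᵘ (i ℤ.+ j) 0                           ≈⟨ ℚᵘ.*≡* (solve 2 (λ i j → (i :+ j) :* con ℤ.1ℤ := (i :* con ℤ.1ℤ :+ j :* con ℤ.1ℤ) :* con ℤ.1ℤ) refl i j) ⟩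
  ℚᵘ.mkℚᵘ i 0 ℚᵘ.+ ℚᵘ.mkℚᵘ j 0                  ≈⟨ ℚᵘ.+-cong (toℚᵘ-/1 i) (toℚᵘ-/1 j) ⟨
  ℚ.toℚᵘ (i ℚ./ 1) ℚᵘ.+ ℚ.toℚᵘ (j ℚ./ 1)        ≈⟨ ℚ.toℚᵘ-homo-+ (i ℚ./ 1) (j ℚ./ 1) ⟨
  ℚ.toℚᵘ (i ℚ./ 1 ℚ.+ j ℚ./ 1)                  ∎)
  where
  open SetoidReasoning ℚᵘ.≃-setoid
  open ℤSolver

fromℤ-* : ∀ i j → fromℤ (i ℤ.* j) ≈ fromℤ i * fromℤ j
fromℤ-* i j = pointwise λ _ → ℚ.toℚᵘ-injective (begin
  ℚ.toℚᵘ ((i ℤ.* j) ℚ./ 1)                      ≈⟨ toℚᵘ-/1 (i ℤ.* j) ⟩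
  ℚᵘ.mkℚᵘ i 0 ℚᵘ.* ℚᵘ.mkℚᵘ j 0                  ≈⟨ ℚᵘ.*-cong (toℚᵘ-/1 i) (toℚᵘ-/1 j) ⟨
  ℚ.toℚᵘ (i ℚ./ 1) ℚᵘ.* ℚ.toℚᵘ (j ℚ./ 1)        ≈⟨ ℚ.toℚᵘ-homo-* (i ℚ./ 1) (j ℚ./ 1) ⟨
  ℚ.toℚᵘ ((i ℚ./ 1) ℚ.* (j ℚ./ 1))                  ∎)
  where open SetoidReasoning ℚᵘ.≃-setoid

fromℤ-neg : ∀ i → fromℤ (ℤ.- i) ≈ - fromℤ i
fromℤ-neg i = pointwise λ _ → ℚ.toℚᵘ-injective (begin
  ℚ.toℚᵘ ((ℤ.- i) ℚ./ 1)       ≈⟨ toℚᵘ-/1 (ℤ.- i) ⟩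
  ℚᵘ.- ℚᵘ.mkℚᵘ i 0             ≈⟨ ℚᵘ.-‿cong (toℚᵘ-/1 i) ⟨
  ℚᵘ.- ℚ.toℚᵘ (i ℚ./ 1)        ≈⟨ ℚ.toℚᵘ-homo‿- (i ℚ./ 1) ⟨
  ℚ.toℚᵘ (ℚ.- (i ℚ./ 1))       ∎)
  where open SetoidReasoning ℚᵘ.≃-setoid

fromℤ-mono : ∀ {i j} → i ℤ.≤ j → fromℤ i ≤ fromℤ j
fromℤ-mono {i} {j} i≤j = fromℚ-mono (ℚ.toℚᵘ-cancel-≤
  (ℚᵘ.≤-respˡ-≃ (ℚᵘ.≃-sym (toℚᵘ-/1 i)) (ℚᵘ.≤-respʳ-≃ (ℚᵘ.≃-sym (toℚᵘ-/1 j))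
    (ℚᵘ.*≤* (ℤ.*-monoʳ-≤-nonNeg ℤ.1ℤ i≤j)))))

fromℤ-reflects-≤ : ∀ {i j} → fromℤ i ≤ fromℤ j → i ℤ.≤ j
fromℤ-reflects-≤ {i} {j} h = ℤ.*-cancelʳ-≤-pos i j ℤ.1ℤ (ℚᵘ.drop-*≤*
  (ℚᵘ.≤-respˡ-≃ (toℚᵘ-/1 i) (ℚᵘ.≤-respʳ-≃ (toℚᵘ-/1 j) (ℚ.toℚᵘ-mono-≤ (fromℚ-reflects-≤ {i ℚ./ 1} {j ℚ./ 1} h)))))

fromℕ-mono : ∀ {m n} → m ℕ.≤ n → fromℕ m ≤ fromℕ n
fromℕ-mono {m} {n} m≤n = fromℤ-mono {ℤ.+ m} {ℤ.+ n} (ℤ.+≤+ m≤n)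

fromℕ-reflects-≤ : ∀ {m n} → fromℕ m ≤ fromℕ n → m ℕ.≤ n
fromℕ-reflects-≤ {m} {n} h = ℤ.drop‿+≤+ (fromℤ-reflects-≤ {ℤ.+ m} {ℤ.+ n} h)

fromℕ-+ : ∀ m n → fromℕ (m ℕ.+ n) ≈ fromℕ m + fromℕ n
fromℕ-+ m n = fromℤ-+ (ℤ.+ m) (ℤ.+ n)

fromℕ-* : ∀ m n → fromℕ (m ℕ.* n) ≈ fromℕ m * fromℕ n
fromℕ-* m n = ≈-trans (≤-reflexive-≡ (ℤ.pos-* m n)) (fromℤ-* (ℤ.+ m) (ℤ.+ n))
  where
  ≤-reflexive-≡ : ∀ {i j} → i ≡ j → fromℤ i ≈ fromℤ j
  ≤-reflexive-≡ refl = ≈-refl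

fromℕ-suc : ∀ n → fromℕ (suc n) ≈ fromℕ n + 1ℝ
fromℕ-suc n = ≈-trans (pointwise λ _ → /1-suc n) (ℝ-Ring.+-comm 1ℝ (fromℕ n))

0≤fromℕ : ∀ n → 0ℝ ≤ fromℕ n
0≤fromℕ n = fromℕ-mono {0} {n} ℕ.z≤n

∣fromℤ∣≤ : ∀ i {n} → ℤ.∣ i ∣ ℕ.≤ n → ∣ fromℤ i ∣ ≤ fromℕ n
∣fromℤ∣≤ i {n} h = ∣x∣≤ (bound i h) (≤-trans (≤-reflexive (≈-sym (fromℤ-neg i)))
  (bound (ℤ.- i) (subst (ℕ._≤ n) (sym (ℤ.∣-i∣≡∣i∣ i)) h)))
  where
  bound : ∀ i → ℤ.∣ i ∣ ℕ.≤ n → fromℤ i ≤ fromℕ n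
  bound (ℤ.+ m)      m≤n = fromℕ-mono {m} {n} m≤n
  bound (ℤ.-[1+ m ]) _   = fromℤ-mono {ℤ.-[1+ m ]} {ℤ.+ n} ℤ.-≤+

-- The complex numbers as a commutative ring

ℂ-isCommutativeRing : IsCommutativeRing ℂ-Ring._≈_ ℂ-Ring._+_ ℂ-Ring._*_ ℂ-Ring.-_ ℂ-Ring.0# ℂ-Ring.1#
ℂ-isCommutativeRing = record
  { isRing = record
    { +-isAbelianGroup = record
      { isGroup = record
        { isMonoid = record
          { isSemigroup = record
            { isMagma = record
              { isEquivalence = record
                { refl = ≈-refl , ≈-refl
                ; sym = λ (p , q) → ≈-sym p , ≈-sym q
                ; trans = λ (p , q) (p′ , q′) → ≈-trans p p′ , ≈-trans q q′ }
              ; ∙-cong = λ (p , q) (p′ , q′) → +-cong p p′ , +-cong q q′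
              }
            ; assoc = λ (a +i b) (c +i d) (e +i f) → ℝ-Ring.+-assoc a c e , ℝ-Ring.+-assoc b d f
            }
          ; identity = (λ (a +i b) → ℝ-Ring.+-identityˡ a , ℝ-Ring.+-identityˡ b)
                     , (λ (a +i b) → ℝ-Ring.+-identityʳ a , ℝ-Ring.+-identityʳ b)
          }
        ; inverse = (λ (a +i b) → ℝ-Ring.-‿inverseˡ a , ℝ-Ring.-‿inverseˡ b)
                  , (λ (a +i b) → ℝ-Ring.-‿inverseʳ a , ℝ-Ring.-‿inverseʳ b)
        ; ⁻¹-cong = λ (p , q) → -‿cong p , -‿cong q
        }
      ; comm = λ (a +i b) (c +i d) → ℝ-Ring.+-comm a c , ℝ-Ring.+-comm b d
      }
    ; *-cong = λ (p , q) (p′ , q′) →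
          +-cong (*-cong p p′) (-‿cong (*-cong q q′)) , +-cong (*-cong p q′) (*-cong q p′)
    ; *-assoc = λ (a +i b) (c +i d) (e +i f) →
          solve 6 (λ a b c d e f → (a :* c :- b :* d) :* e :- (a :* d :+ b :* c) :* f :=
            a :* (c :* e :- d :* f) :- b :* (c :* f :+ d :* e)) ≈-refl a b c d e f
        , solve 6 (λ a b c d e f → (a :* c :- b :* d) :* f :+ (a :* d :+ b :* c) :* e :=
            a :* (c :* f :+ d :* e) :+ b :* (c :* e :- d :* f)) ≈-refl a b c d e f
    ; *-identity =
          (λ (a +i b) → solve 2 (λ a b → con 1ℚ :* a :- con 0ℚ :* b := a) ≈-refl a b
                      , solve 2 (λ a b → con 1ℚ :* b :+ con 0ℚ :* a := b) ≈-refl a b)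
        , (λ (a +i b) → solve 2 (λ a b → a :* con 1ℚ :- b :* con 0ℚ := a) ≈-refl a b
                      , solve 2 (λ a b → a :* con 0ℚ :+ b :* con 1ℚ := b) ≈-refl a b)
    ; distrib =
          (λ (a +i b) (c +i d) (e +i f) →
              solve 6 (λ a b c d e f → a :* (c :+ e) :- b :* (d :+ f) :=
                (a :* c :- b :* d) :+ (a :* e :- b :* f)) ≈-refl a b c d e f
            , solve 6 (λ a b c d e f → a :* (d :+ f) :+ b :* (c :+ e) :=
                (a :* d :+ b :* c) :+ (a :* f :+ b :* e)) ≈-refl a b c d e f)
        , (λ (a +i b) (c +i d) (e +i f) →
              solve 6 (λ a b c d e f → (c :+ e) :* a :- (d :+ f) :* b :=
                (c :* a :- d :* b) :+ (e :* a :- f :* b)) ≈-refl a b c d e f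
            , solve 6 (λ a b c d e f → (c :+ e) :* b :+ (d :+ f) :* a :=
                (c :* b :+ d :* a) :+ (e :* b :+ f :* a)) ≈-refl a b c d e f)
    }
  ; *-comm = λ (a +i b) (c +i d) →
        solve 4 (λ a b c d → a :* c :- b :* d := c :* a :- d :* b) ≈-refl a b c d
      , solve 4 (λ a b c d → a :* d :+ b :* c := c :* b :+ d :* a) ≈-refl a b c d
  }
  where open ℝ-Solver

ℂ-commutativeRing : CommutativeRing 0ℓ 0ℓ
ℂ-commutativeRing = record { isCommutativeRing = ℂ-isCommutativeRing }

private
  ℚ⟶ℂ : ℚ.+-*-rawRing -Raw-AlmostCommutative⟶ fromCommutativeRing ℂ-commutativeRing
  ℚ⟶ℂ = record
    { ⟦_⟧ = λ q → fromℚ q +i 0ℝ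
    ; +-homo = λ _ _ → pointwise (λ _ → refl) , pointwise (λ _ → refl)
    ; *-homo = λ p q → pointwise (λ _ → ≡.sym (ℚ.+-identityʳ (p ℚ.* q)))
                     , pointwise (λ _ → ≡.sym (≡.cong₂ ℚ._+_ (ℚ.*-zeroʳ p) (ℚ.*-zeroˡ q)))
    ; -‿homo = λ _ → pointwise (λ _ → refl) , pointwise (λ _ → refl)
    ; 0-homo = ≈-refl , ≈-refl
    ; 1-homo = ≈-refl , ≈-refl
    }

  fromℚᶜ-≟ : ∀ p q → Maybe ((fromℚ p +i 0ℝ) ℂ-Ring.≈ (fromℚ q +i 0ℝ))
  fromℚᶜ-≟ p q with p ℚ.≟ q
  ... | yes refl = just (≈-refl , ≈-refl)
  ... | no  _    = nothing

module ℂ-Solver = Algebra.Solver.Ring ℚ.+-*-rawRing (fromCommutativeRing ℂ-commutativeRing) ℚ⟶ℂ fromℚᶜ-≟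

private module ℂᴿ = CommutativeRing ℂ-commutativeRing

-- The Fejér kernel

∑ : {A : Set} → List A → (A → ℝ) → ℝ
∑ []       f = 0ℝ
∑ (x ∷ xs) f = f x + ∑ xs f

module _ {A : Set} where
  ∑-cong : ∀ (xs : List A) {f g} → (∀ x → f x ≈ g x) → ∑ xs f ≈ ∑ xs g
  ∑-cong []       p = ≈-refl
  ∑-cong (x ∷ xs) p = +-cong (p x) (∑-cong xs p)

  ∑-mono : ∀ (xs : List A) {f g} → (∀ x → f x ≤ g x) → ∑ xs f ≤ ∑ xs g
  ∑-mono []       p = ≤-reflexive ≈-refl
  ∑-mono (x ∷ xs) p = +-mono-≤ (p x) (∑-mono xs p)

  ∑-+ : ∀ (xs : List A) f g → ∑ xs (λ x → f x + g x) ≈ ∑ xs f + ∑ xs g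
  ∑-+ []       f g = ≈-sym (ℝ-Ring.+-identityˡ 0ℝ)
  ∑-+ (x ∷ xs) f g = ≈-trans (+-cong ≈-refl (∑-+ xs f g))
    (solve 4 (λ a b c d → (a :+ b) :+ (c :+ d) := (a :+ c) :+ (b :+ d)) ≈-refl (f x) (g x) (∑ xs f) (∑ xs g))
    where open ℝ-Solver

  ∑-*ˡ : ∀ (xs : List A) c f → ∑ xs (λ x → c * f x) ≈ c * ∑ xs f
  ∑-*ˡ []       c f = ≈-sym (ℝ-Ring.zeroʳ c)
  ∑-*ˡ (x ∷ xs) c f = ≈-trans (+-cong ≈-refl (∑-*ˡ xs c f)) (≈-sym (ℝ-Ring.distribˡ c (f x) (∑ xs f)))

  ∑-neg : ∀ (xs : List A) f → ∑ xs (λ x → - f x) ≈ - ∑ xs f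
  ∑-neg []       f = pointwise λ _ → refl
  ∑-neg (x ∷ xs) f = ≈-trans (+-cong ≈-refl (∑-neg xs f))
    (solve 2 (λ a b → :- a :+ :- b := :- (a :+ b)) ≈-refl (f x) (∑ xs f))
    where open ℝ-Solver

  ∑-const : ∀ (xs : List A) c → ∑ xs (λ _ → c) ≈ fromℕ (length xs) * c
  ∑-const []       c = ≈-sym (ℝ-Ring.zeroˡ c)
  ∑-const (x ∷ xs) c = ≈-trans (+-cong ≈-refl (∑-const xs c))
    (≈-trans (solve 2 (λ c n → c :+ n :* c := (n :+ con 1ℚ) :* c) ≈-refl c (fromℕ (length xs)))
      (*-cong (≈-sym (fromℕ-suc (length xs))) ≈-refl))
    where open ℝ-Solver

  ∣∑∣≤ : ∀ (xs : List A) f → ∣ ∑ xs f ∣ ≤ ∑ xs (λ x → ∣ f x ∣)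
  ∣∑∣≤ []       f = ≤-pointwise λ _ → ℚ.≤-refl
  ∣∑∣≤ (x ∷ xs) f = ≤-trans (∣x+y∣≤ (f x) (∑ xs f)) (+-mono-≤ (≤-reflexive ≈-refl) (∣∑∣≤ xs f))

  ∣∑∣≤-const : ∀ (xs : List A) f c → (∀ x → ∣ f x ∣ ≤ c) → ∣ ∑ xs f ∣ ≤ fromℕ (length xs) * c
  ∣∑∣≤-const xs f c h = ≤-trans (∣∑∣≤ xs f) (≤-trans (∑-mono xs h) (≤-reflexive (∑-const xs c)))

∑-swap : ∀ {A B : Set} (xs : List A) (ys : List B) (f : A → B → ℝ) →
         ∑ xs (λ x → ∑ ys (f x)) ≈ ∑ ys (λ y → ∑ xs (λ x → f x y))
∑-swap []       ys f = ≈-sym (≈-trans (∑-const ys 0ℝ) (ℝ-Ring.zeroʳ _))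
∑-swap (x ∷ xs) ys f = ≈-trans (+-cong ≈-refl (∑-swap xs ys f))
  (≈-sym (∑-+ ys (f x) (λ y → ∑ xs (λ x → f x y))))

∑-map : ∀ {A B : Set} (h : A → B) xs f → ∑ (map h xs) f ≡ ∑ xs (λ x → f (h x))
∑-map h []       f = refl
∑-map h (x ∷ xs) f = cong (f (h x) +_) (∑-map h xs f)

conjℂ : ℂ → ℂ
conjℂ (a +i b) = a +i (- b)

conj : 𝕋 → 𝕋
point     (conj z) = conjℂ (point z)
∣point∣≈1 (conj z) = ≈-trans
  (solve 2 (λ a b → a :* a :+ (:- b) :* (:- b) := a :* a :+ b :* b) ≈-refl (re (point z)) (im (point z)))
  (∣point∣≈1 z)
  where open ℝ-Solver

1𝕋 : 𝕋
point     1𝕋 = ℂ-Ring.1#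
∣point∣≈1 1𝕋 = pointwise λ _ → refl

pow : 𝕋 → ℕ → 𝕋
pow u zero    = 1𝕋
pow u (suc n) = u · pow u n

chord² : 𝕋 → 𝕋 → ℝ
chord² z w = ∣ point z ℂ-Ring.+ (ℂ-Ring.- point w) ∣²

Re : 𝕋 → ℝ
Re u = re (point u)

2ℝ : ℝ
2ℝ = 1ℝ + 1ℝ

chord²≈ : ∀ z w → chord² z w ≈ 2ℝ - 2ℝ * Re (z · conj w)
chord²≈ z w = ≈-trans
  (solve 4 (λ a b c d → (a :- c) :* (a :- c) :+ (b :- d) :* (b :- d) :=
      ((a :* a :+ b :* b) :+ (c :* c :+ d :* d)) :- (con 1ℚ :+ con 1ℚ) :* (a :* c :- b :* (:- d)))
    ≈-refl (re (point z)) (im (point z)) (re (point w)) (im (point w)))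
  (+-cong (+-cong (∣point∣≈1 z) (∣point∣≈1 w)) ≈-refl)
  where open ℝ-Solver

0≤∣z∣² : ∀ z → 0ℝ ≤ ∣ z ∣²
0≤∣z∣² z = 0≤+ (0≤x² (re z)) (0≤x² (im z))

0≤2x⇒0≤x : ∀ {x} → 0ℝ ≤ 2ℝ * x → 0ℝ ≤ x
0≤2x⇒0≤x {x} h = ≤-trans (0≤scale ½ h) (≤-reflexive
  (solve 1 (λ x → con ½ :* ((con 1ℚ :+ con 1ℚ) :* x) := x) ≈-refl x))
  where open ℝ-Solver

-- |1 - u|^2 is nonnegative and equals 2 (1 - Re u).
Re≤1 : ∀ u → Re u ≤ 1ℝ
Re≤1 u = 0≤⇒≤ (0≤2x⇒0≤x (≤-trans (0≤+ (0≤x² (1ℝ - a)) (0≤x² b)) (≤-reflexive (≈-trans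
  (solve 2 (λ a b → (con 1ℚ :- a) :* (con 1ℚ :- a) :+ b :* b :=
    (con 1ℚ :- (con 1ℚ :+ con 1ℚ) :* a) :+ (a :* a :+ b :* b)) ≈-refl a b)
  (≈-trans (+-cong ≈-refl (∣point∣≈1 u))
    (solve 1 (λ a → (con 1ℚ :- (con 1ℚ :+ con 1ℚ) :* a) :+ con 1ℚ := (con 1ℚ :+ con 1ℚ) :* (con 1ℚ :- a)) ≈-refl a))))))
  where
  open ℝ-Solver
  a = Re u
  b = im (point u)

neg𝕋 : 𝕋 → 𝕋
point     (neg𝕋 u) = ℂ-Ring.- point u
∣point∣≈1 (neg𝕋 u) = ≈-trans
  (solve 2 (λ a b → (:- a) :* (:- a) :+ (:- b) :* (:- b) := a :* a :+ b :* b) ≈-refl (Re u) (im (point u)))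
  (∣point∣≈1 u)
  where open ℝ-Solver

∣Re∣≤1 : ∀ u → ∣ Re u ∣ ≤ 1ℝ
∣Re∣≤1 u = ∣x∣≤ (Re≤1 u) (Re≤1 (neg𝕋 u))

4ℝ : ℝ
4ℝ = 2ℝ + 2ℝ

chord²≤4 : ∀ z w → chord² z w ≤ 4ℝ
chord²≤4 z w = begin
  chord² z w                        ≈⟨ chord²≈ z w ⟩
  2ℝ - 2ℝ * Re (z · conj w)         ≈⟨ solve 2 (λ t x → t :- t :* x := t :+ t :* (:- x)) ≈-refl 2ℝ (Re (z · conj w)) ⟩
  2ℝ + 2ℝ * Re (neg𝕋 (z · conj w))  ≤⟨ +-mono-≤ (≤-reflexive ≈-refl) (*-monoˡ-≤ (0≤+ 0≤1 0≤1) (Re≤1 (neg𝕋 (z · conj w)))) ⟩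
  2ℝ + 2ℝ * 1ℝ                      ≈⟨ +-cong ≈-refl (ℝ-Ring.*-identityʳ 2ℝ) ⟩
  4ℝ                                ∎
  where
  open ≤-Reasoning
  open ℝ-Solver

geometric : 𝕋 → ℕ → ℂ
geometric w zero    = ℂ-Ring.0#
geometric w (suc n) = ℂ-Ring.1# ℂ-Ring.+ point w ℂ-Ring.* geometric w n

-- N times the Fejér kernel.
kernel : ℕ → 𝕋 → ℝ
kernel n w = ∣ geometric w n ∣²

cosines : ℕ → 𝕋 → ℝ
cosines zero    w = 0ℝ
cosines (suc n) w = cosines n w + Re (pow w (suc n))

geometric-suc : ∀ w n → geometric w (suc n) ℂ-Ring.≈ geometric w n ℂ-Ring.+ point (pow w n)
geometric-suc w zero    = solve 1 (λ w → con 1ℚ :+ w :* con 0ℚ := con 0ℚ :+ con 1ℚ) ℂᴿ.refl (point w)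
  where open ℂ-Solver
geometric-suc w (suc n) = ℂᴿ.trans (ℂᴿ.+-congˡ (ℂᴿ.*-congˡ (geometric-suc w n)))
  (solve 3 (λ w g p → con 1ℚ :+ w :* (g :+ p) := (con 1ℚ :+ w :* g) :+ w :* p) ℂᴿ.refl
    (point w) (geometric w n) (point (pow w n)))
  where open ℂ-Solver

re-geometric : ∀ w n → re (point w ℂ-Ring.* geometric w n) ≈ cosines n w
re-geometric w zero    = solve 2 (λ a b → a :* con 0ℚ :- b :* con 0ℚ := con 0ℚ) ≈-refl (Re w) (im (point w))
  where open ℝ-Solver
re-geometric w (suc n) = ≈-trans
  (proj₁ (ℂᴿ.trans (ℂᴿ.*-congˡ {point w} (geometric-suc w n)) (ℂᴿ.distribˡ (point w) (geometric w n) (point (pow w n)))))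
  (+-cong (re-geometric w n) ≈-refl)

-- The geometric sum of length n + 1 is 1 + v with v = w `geometric w n`, and |v| =
-- |`geometric w n`|. Iterated, this writes the kernel as n + 2 Σ `cosines m w` over m < n, in which
-- only exponents below n occur.
kernel-suc : ∀ w n → kernel (suc n) w ≈ (kernel n w + 1ℝ) + 2ℝ * cosines n w
kernel-suc w n = begin
  kernel (suc n) w
    ≈⟨ solve 2 (λ a b → (con 1ℚ :+ a) :* (con 1ℚ :+ a) :+ (con 0ℚ :+ b) :* (con 0ℚ :+ b) :=
         ((a :* a :+ b :* b) :+ con 1ℚ) :+ (con 1ℚ :+ con 1ℚ) :* a) ≈-refl (re v) (im v) ⟩
  (∣ v ∣² + 1ℝ) + 2ℝ * re v
    ≈⟨ +-cong (+-cong (≈-trans (∣zw∣² (point w) (geometric w n))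
         (≈-trans (*-cong (∣point∣≈1 w) ≈-refl) (ℝ-Ring.*-identityˡ _))) ≈-refl)
         (*-cong ≈-refl (re-geometric w n)) ⟩
  (kernel n w + 1ℝ) + 2ℝ * cosines n w ∎
  where
  open SetoidReasoning ℝ-Ring.setoid
  open ℝ-Solver
  v = point w ℂ-Ring.* geometric w n

0≤kernel : ∀ n w → 0ℝ ≤ kernel n w
0≤kernel n w = 0≤∣z∣² (geometric w n)

kernel-cong : ∀ n {u v} → (∀ k → Re (pow u k) ≈ Re (pow v k)) → kernel n u ≈ kernel n v
kernel-cong zero    p = ≈-refl
kernel-cong (suc n) {u} {v} p = ≈-trans (kernel-suc u n) (≈-trans
  (+-cong (+-cong (kernel-cong n p) ≈-refl) (*-cong ≈-refl (cosines-cong n))) (≈-sym (kernel-suc v n)))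
  where
  cosines-cong : ∀ n → cosines n u ≈ cosines n v
  cosines-cong zero    = ≈-refl
  cosines-cong (suc n) = +-cong (cosines-cong n) (p (suc n))

pow-cong : ∀ {u v} k → point u ℂ-Ring.≈ point v → point (pow u k) ℂ-Ring.≈ point (pow v k)
pow-cong zero    p = ℂᴿ.refl
pow-cong (suc k) p = ℂᴿ.*-cong p (pow-cong k p)

conj-* : ∀ z w → conjℂ (z ℂ-Ring.* w) ℂ-Ring.≈ conjℂ z ℂ-Ring.* conjℂ w
conj-* (a +i b) (c +i d) =
    solve 4 (λ a b c d → a :* c :- b :* d := a :* c :- (:- b) :* (:- d)) ≈-refl a b c d
  , solve 4 (λ a b c d → :- (a :* d :+ b :* c) := a :* (:- d) :+ (:- b) :* c) ≈-refl a b c d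
  where open ℝ-Solver

pow-conj : ∀ u k → point (pow (conj u) k) ℂ-Ring.≈ conjℂ (point (pow u k))
pow-conj u zero    = ≈-refl , pointwise λ _ → refl
pow-conj u (suc k) = ℂᴿ.trans (ℂᴿ.*-congˡ {point (conj u)} (pow-conj u k)) (ℂᴿ.sym (conj-* (point u) (point (pow u k))))

-- w / z is the conjugate of z / w, and by `kernel-suc` the kernel depends only on the real parts of
-- powers.
kernel-sym : ∀ n z w → kernel n (z · conj w) ≈ kernel n (w · conj z)
kernel-sym n z w = kernel-cong n λ k → ≈-sym (≈-trans
  (proj₁ (pow-cong {w · conj z} {conj (z · conj w)} k (swap (point z) (point w))))
  (proj₁ (pow-conj (z · conj w) k)))
  where
  open ℝ-Solver
  swap : ∀ z w → w ℂ-Ring.* conjℂ z ℂ-Ring.≈ conjℂ (z ℂ-Ring.* conjℂ w)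
  swap (a +i b) (c +i d) =
      solve 4 (λ a b c d → c :* a :- d :* (:- b) := a :* c :- b :* (:- d)) ≈-refl a b c d
    , solve 4 (λ a b c d → c :* (:- b) :+ d :* a := :- (a :* (:- d) :+ b :* c)) ≈-refl a b c d

1-w*geometric : ∀ w n → (ℂ-Ring.1# ℂ-Ring.+ ℂ-Ring.- point w) ℂ-Ring.* geometric w n ℂ-Ring.≈
                        ℂ-Ring.1# ℂ-Ring.+ ℂ-Ring.- point (pow w n)
1-w*geometric w zero    = solve 1 (λ w → (con 1ℚ :+ :- w) :* con 0ℚ := con 1ℚ :+ :- con 1ℚ) ℂᴿ.refl (point w)
  where open ℂ-Solver
1-w*geometric w (suc n) = ℂᴿ.trans
  (solve 2 (λ w g → (con 1ℚ :+ :- w) :* (con 1ℚ :+ w :* g) := (con 1ℚ :+ :- w) :+ w :* ((con 1ℚ :+ :- w) :* g))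
    ℂᴿ.refl (point w) (geometric w n))
  (ℂᴿ.trans (ℂᴿ.+-congˡ (ℂᴿ.*-congˡ (1-w*geometric w n)))
    (solve 2 (λ w p → (con 1ℚ :+ :- w) :+ w :* (con 1ℚ :+ :- p) := con 1ℚ :+ :- (w :* p)) ℂᴿ.refl
      (point w) (point (pow w n))))
  where open ℂ-Solver

∣∣²-cong : ∀ {z w} → z ℂ-Ring.≈ w → ∣ z ∣² ≈ ∣ w ∣²
∣∣²-cong (p , q) = +-cong (*-cong p p) (*-cong q q)

-- For u = z / w the left side is |1 - u|^2 |1 + ... + u^(n - 1)|^2 = |1 - u^n|^2. The bound is free
-- of n, so the kernel is negligible away from 1 compared with its mean, which grows like n.
chord²*kernel≤4 : ∀ n z w → chord² z w * kernel n (z · conj w) ≤ 4ℝ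
chord²*kernel≤4 n z w = begin
  chord² z w * kernel n u                     ≈⟨ *-cong chord-1 ≈-refl ⟩
  chord² 1𝕋 u * kernel n u                    ≈⟨ ∣zw∣² (ℂ-Ring.1# ℂ-Ring.+ ℂ-Ring.- point u) (geometric u n) ⟨
  ∣ (ℂ-Ring.1# ℂ-Ring.+ ℂ-Ring.- point u) ℂ-Ring.* geometric u n ∣²  ≈⟨ ∣∣²-cong (1-w*geometric u n) ⟩
  chord² 1𝕋 (pow u n)                         ≤⟨ chord²≤4 1𝕋 (pow u n) ⟩
  4ℝ                                          ∎
  where
  open ≤-Reasoning
  u = z · conj w
  chord-1 : chord² z w ≈ chord² 1𝕋 u
  chord-1 = ≈-trans (chord²≈ z w) (≈-trans
    (solve 2 (λ a b → (con 1ℚ :+ con 1ℚ) :- (con 1ℚ :+ con 1ℚ) :* a :=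
      (con 1ℚ :+ con 1ℚ) :- (con 1ℚ :+ con 1ℚ) :* (con 1ℚ :* a :- con 0ℚ :* (:- b))) ≈-refl (Re u) (im (point u)))
    (≈-sym (chord²≈ 1𝕋 u)))
    where open ℝ-Solver

-- The power sums Σ β^k, 0 < k < N, are small; the rotations u make the
-- condition invariant under rotating B.
SmallSums : List 𝕋 → ℕ → ℝ → Set
SmallSums B N η = ∀ u k → 0 ℕ.< k → k ℕ.< N → ∣ ∑ B (λ β → Re (pow (u · conj β) k)) ∣ ≤ η

≤-refl : ∀ {x} → x ≤ x
≤-refl = ≤-reflexive ≈-refl

∣x∣≤⇒x≤ : ∀ {x y} → ∣ x ∣ ≤ y → x ≤ y
∣x∣≤⇒x≤ {x} h = ≤-trans (x≤∣x∣ x) h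

∣x∣≤⇒-x≤ : ∀ {x y} → ∣ x ∣ ≤ y → - x ≤ y
∣x∣≤⇒-x≤ {x} h = ≤-trans (x≤∣x∣ (- x)) (≤-trans (≤-reflexive (∣-x∣≈∣x∣ x)) h)

size : {A : Set} → List A → ℝ
size xs = fromℕ (length xs)

0≤size : {A : Set} (xs : List A) → 0ℝ ≤ size xs
0≤size xs = 0≤fromℕ (length xs)

smallSums-rotate : ∀ {B N η} z → SmallSums B N η → SmallSums (map (_· z) B) N η
smallSums-rotate {B} {N} {η} z h u k 0<k k<N = ≤-trans (≤-reflexive (∣∣-cong
  (≈-trans (ℝ-Ring.reflexive (∑-map (_· z) B _))
    (∑-cong B λ β → proj₁ (pow-cong {u · conj (β · z)} {(u · conj z) · conj β} k (rotate (point u) (point z) (point β)))))))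
  (h (u · conj z) k 0<k k<N)
  where
  open ℝ-Solver
  rotate : ∀ u z β → u ℂ-Ring.* conjℂ (β ℂ-Ring.* z) ℂ-Ring.≈ (u ℂ-Ring.* conjℂ z) ℂ-Ring.* conjℂ β
  rotate (a +i b) (c +i d) (e +i f) =
      solve 6 (λ a b c d e f → a :* (e :* c :- f :* d) :- b :* (:- (e :* d :+ f :* c)) :=
        (a :* c :- b :* (:- d)) :* e :- (a :* (:- d) :+ b :* c) :* (:- f)) ≈-refl a b c d e f
    , solve 6 (λ a b c d e f → a :* (:- (e :* d :+ f :* c)) :+ b :* (e :* c :- f :* d) :=
        (a :* c :- b :* (:- d)) :* (:- f) :+ (a :* (:- d) :+ b :* c) :* e) ≈-refl a b c d e f

-- Kernel averages over families with small power sums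

module _ {B N η} (small : SmallSums B N η) (0≤η : 0ℝ ≤ η) where
  ∣∑cosines∣≤ : ∀ u n → n ℕ.< N → ∣ ∑ B (λ β → cosines n (u · conj β)) ∣ ≤ fromℕ n * η
  ∣∑cosines∣≤ u zero    n<N = ≤-reflexive (≈-trans (∣∣-cong (≈-trans (∑-const B 0ℝ) (ℝ-Ring.zeroʳ _)))
    (≈-trans (pointwise λ _ → refl) (≈-sym (ℝ-Ring.zeroˡ η))))
  ∣∑cosines∣≤ u (suc n) n<N = begin
    ∣ ∑ B (λ β → cosines n (u · conj β) + Re (pow (u · conj β) (suc n))) ∣
      ≈⟨ ∣∣-cong (∑-+ B _ _) ⟩
    ∣ ∑ B (λ β → cosines n (u · conj β)) + ∑ B (λ β → Re (pow (u · conj β) (suc n))) ∣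
      ≤⟨ ∣x+y∣≤ _ _ ⟩
    ∣ ∑ B (λ β → cosines n (u · conj β)) ∣ + ∣ ∑ B (λ β → Re (pow (u · conj β) (suc n))) ∣
      ≤⟨ +-mono-≤ (∣∑cosines∣≤ u n (ℕ.<-trans ℕ.≤-refl n<N)) (small u (suc n) (s≤s z≤n) n<N) ⟩
    fromℕ n * η + η
      ≈⟨ solve 2 (λ n η → n :* η :+ η := (n :+ con 1ℚ) :* η) ≈-refl (fromℕ n) η ⟩
    (fromℕ n + 1ℝ) * η
      ≈⟨ *-cong (fromℕ-suc n) ≈-refl ⟨
    fromℕ (suc n) * η ∎
    where
    open ≤-Reasoning
    open ℝ-Solver

  -- By `kernel-suc`, the deviation from n `size B` is twice the sum over m < n of the cosine sums
  -- of order m, each at most m η. This gives n (n - 1) η, rounded up to n^2 η.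
  ∣∑kernel∣≤ : ∀ u n → n ℕ.≤ N →
    ∣ ∑ B (λ β → kernel n (u · conj β)) - fromℕ n * size B ∣ ≤ (fromℕ n * fromℕ n) * η
  ∣∑kernel∣≤ u zero    n≤N = ≤-reflexive (≈-trans (∣∣-cong (≈-trans
      (+-cong (∑-const B (kernel 0 u)) ≈-refl)
      (solve 1 (λ b → b :* (con 0ℚ :* con 0ℚ :+ con 0ℚ :* con 0ℚ) :- con 0ℚ :* b := con 0ℚ) ≈-refl (size B))))
    (≈-trans (pointwise λ _ → refl) (solve 1 (λ η → con 0ℚ := (con 0ℚ :* con 0ℚ) :* η) ≈-refl η)))
    where open ℝ-Solver
  ∣∑kernel∣≤ u (suc n) n<N = begin
    ∣ ∑ B (λ β → kernel (suc n) (u · conj β)) - fromℕ (suc n) * size B ∣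
      ≈⟨ ∣∣-cong (+-cong (∑-cong B λ β → kernel-suc (u · conj β) n) (-‿cong (*-cong (fromℕ-suc n) ≈-refl))) ⟩
    ∣ ∑ B (λ β → (kernel n (u · conj β) + 1ℝ) + 2ℝ * cosines n (u · conj β)) - (fromℕ n + 1ℝ) * size B ∣
      ≈⟨ ∣∣-cong (+-cong (≈-trans (∑-+ B _ _) (+-cong (≈-trans (∑-+ B _ _) (+-cong ≈-refl (∑-const B 1ℝ))) (∑-*ˡ B 2ℝ _))) ≈-refl) ⟩
    ∣ ((k + size B * 1ℝ) + 2ℝ * c) - (fromℕ n + 1ℝ) * size B ∣
      ≈⟨ ∣∣-cong (solve 4 (λ k b c n → ((k :+ b :* con 1ℚ) :+ (con 1ℚ :+ con 1ℚ) :* c) :- (n :+ con 1ℚ) :* b :=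
           (k :- n :* b) :+ (c :+ c)) ≈-refl k (size B) c (fromℕ n)) ⟩
    ∣ (k - fromℕ n * size B) + (c + c) ∣
      ≤⟨ ∣x+y∣≤ _ _ ⟩
    ∣ k - fromℕ n * size B ∣ + ∣ c + c ∣
      ≤⟨ +-mono-≤ (∣∑kernel∣≤ u n (ℕ.<⇒≤ n<N)) (≤-trans (∣x+y∣≤ c c) (+-mono-≤ (∣∑cosines∣≤ u n n<N) (∣∑cosines∣≤ u n n<N))) ⟩
    (fromℕ n * fromℕ n) * η + (fromℕ n * η + fromℕ n * η)
      -- One more η completes the square (n + 1)^2.
      ≤⟨ +-mono-≤ ≤-refl (≤-trans (≤-reflexive (≈-sym (ℝ-Ring.+-identityʳ _))) (+-mono-≤ ≤-refl 0≤η)) ⟩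
    (fromℕ n * fromℕ n) * η + ((fromℕ n * η + fromℕ n * η) + η)
      ≈⟨ solve 2 (λ n η → (n :* n) :* η :+ ((n :* η :+ n :* η) :+ η) := ((n :+ con 1ℚ) :* (n :+ con 1ℚ)) :* η)
           ≈-refl (fromℕ n) η ⟩
    ((fromℕ n + 1ℝ) * (fromℕ n + 1ℝ)) * η
      ≈⟨ *-cong (*-cong (fromℕ-suc n) (fromℕ-suc n)) ≈-refl ⟨
    (fromℕ (suc n) * fromℕ (suc n)) * η ∎
    where
    open ≤-Reasoning
    open ℝ-Solver
    k = ∑ B (λ β → kernel n (u · conj β))
    c = ∑ B (λ β → cosines n (u · conj β))

  -- For each α the inner kernel sum differs from N `size B` by at most N^2 η, and |f α| is at most
  -- M; only this error has to be summed over A.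
  smooth : ∀ (A : List 𝕋) (f : 𝕋 → ℝ) {M} → (∀ z → ∣ f z ∣ ≤ M) →
    ∣ ∑ A (λ α → f α * ∑ B (λ β → kernel N (α · conj β))) - (fromℕ N * size B) * ∑ A f ∣
      ≤ size A * (M * ((fromℕ N * fromℕ N) * η))
  smooth A f {M} bound = ≤-trans
    (≤-reflexive (∣∣-cong (≈-trans (+-cong ≈-refl (≈-trans (-‿cong (≈-sym (∑-*ˡ A _ f))) (≈-sym (∑-neg A _))))
      (≈-trans (≈-sym (∑-+ A _ _)) (∑-cong A λ α →
        solve 3 (λ f k n → f :* k :- n :* f := f :* (k :- n)) ≈-refl (f α) (∑ B (λ β → kernel N (α · conj β))) (fromℕ N * size B))))))
    (∣∑∣≤-const A _ _ λ α → ≤-trans (≤-reflexive (∣xy∣≈ (f α) _))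
      (*-mono-≤ (0≤∣x∣ (f α)) (0≤* (0≤* (0≤fromℕ N) (0≤fromℕ N)) 0≤η) (bound α) (∣∑kernel∣≤ α N ℕ.≤-refl)))
    where open ℝ-Solver

-- Evaluates Σ_α Σ_β (f α - f β) K (α / β), K the kernel: K is concentrated near 1,
-- and its sum over either list is almost N times the size of the list.
compare : ∀ {A B N ηA ηB} → SmallSums A N ηA → SmallSums B N ηB → 0ℝ ≤ ηA → 0ℝ ≤ ηB →
  ∀ (f : 𝕋 → ℝ) {M C ε} → (∀ z → ∣ f z ∣ ≤ M) → 0ℝ ≤ C → 0ℝ ≤ ε →
  (∀ z w → ∣ f z - f w ∣ ≤ ε + C * chord² z w) →
  fromℕ N * ∣ size B * ∑ A f - size A * ∑ B f ∣ ≤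
    (size A * (M * ((fromℕ N * fromℕ N) * ηB)) + size B * (M * ((fromℕ N * fromℕ N) * ηA)))
    + (ε * (size A * (fromℕ N * size B + (fromℕ N * fromℕ N) * ηB)) + 4ℝ * (C * (size A * size B)))
compare {A} {B} {N} {ηA} {ηB} smallA smallB 0≤ηA 0≤ηB f {M} {C} {ε} bound 0≤C 0≤ε modulus = begin
  n * ∣ b * sA - a * sB ∣
    ≈⟨ *-cong (0≤⇒∣x∣≈x (0≤fromℕ N)) ≈-refl ⟨
  ∣ n ∣ * ∣ b * sA - a * sB ∣
    ≈⟨ ∣xy∣≈ n _ ⟨
  ∣ n * (b * sA - a * sB) ∣
    ≈⟨ ∣∣-cong (solve 7 (λ n a b x y S T → n :* (b :* x :- a :* y) :=
         ((:- (S :- (n :* b) :* x)) :+ (T :- (n :* a) :* y)) :+ (S :- T)) ≈-refl n a b sA sB S T) ⟩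
  ∣ ((- (S - (n * b) * sA)) + (T - (n * a) * sB)) + (S - T) ∣
    ≤⟨ ∣x+y∣≤ _ _ ⟩
  ∣ (- (S - (n * b) * sA)) + (T - (n * a) * sB) ∣ + ∣ S - T ∣
    ≤⟨ +-mono-≤ (∣x+y∣≤ _ _) ≤-refl ⟩
  (∣ - (S - (n * b) * sA) ∣ + ∣ T - (n * a) * sB ∣) + ∣ S - T ∣
    ≤⟨ +-mono-≤ (+-mono-≤ (≤-trans (≤-reflexive (∣-x∣≈∣x∣ _)) (smooth {B} {N} {ηB} smallB 0≤ηB A f {M} bound)) (smooth {A} {N} {ηA} smallA 0≤ηA B f {M} bound)) S-T ⟩
  (a * (M * ((n * n) * ηB)) + b * (M * ((n * n) * ηA)))
    + (ε * (a * (n * b + (n * n) * ηB)) + 4ℝ * (C * (a * b))) ∎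
  where
  open ≤-Reasoning
  open ℝ-Solver
  n = fromℕ N
  a = size A
  b = size B
  sA = ∑ A f
  sB = ∑ B f
  K : 𝕋 → 𝕋 → ℝ
  K α β = kernel N (α · conj β)
  S = ∑ A (λ α → f α * ∑ B (K α))
  T = ∑ B (λ β → f β * ∑ A (λ α → kernel N (β · conj α)))

  difference : S - T ≈ ∑ A (λ α → ∑ B (λ β → (f α - f β) * K α β))
  difference = ≈-trans
    (+-cong (∑-cong A λ α → ≈-sym (∑-*ˡ B (f α) (K α)))
      (-‿cong (≈-trans (∑-cong B λ β → ≈-trans (≈-sym (∑-*ˡ A (f β) _))
          (∑-cong A λ α → *-cong ≈-refl (kernel-sym N β α)))
        (∑-swap B A (λ β α → f β * K α β)))))
    (≈-trans (+-cong ≈-refl (≈-sym (∑-neg A _))) (≈-trans (≈-sym (∑-+ A _ _)) (∑-cong A λ α →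
      ≈-trans (+-cong ≈-refl (≈-sym (∑-neg B _))) (≈-trans (≈-sym (∑-+ B _ _)) (∑-cong B λ β →
        solve 3 (λ x y k → x :* k :- y :* k := (x :- y) :* k) ≈-refl (f α) (f β) (K α β))))))

  -- The ε part of the modulus keeps the kernel, whose sum over B is known; the quadratic part turns
  -- it into the bounded product `chord² α β * K α β`.
  term : ∀ α β → ∣ (f α - f β) * K α β ∣ ≤ ε * K α β + 4ℝ * C
  term α β = begin
    ∣ (f α - f β) * K α β ∣                      ≈⟨ ∣xy∣≈ _ _ ⟩
    ∣ f α - f β ∣ * ∣ K α β ∣                    ≈⟨ *-cong ≈-refl (0≤⇒∣x∣≈x (0≤kernel N _)) ⟩
    ∣ f α - f β ∣ * K α β                        ≤⟨ *-mono-≤ (0≤∣x∣ _) (0≤kernel N _) (modulus α β) ≤-refl ⟩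
    (ε + C * chord² α β) * K α β
      ≈⟨ solve 4 (λ e c x k → (e :+ c :* x) :* k := e :* k :+ c :* (x :* k)) ≈-refl ε C (chord² α β) (K α β) ⟩
    ε * K α β + C * (chord² α β * K α β)         ≤⟨ +-mono-≤ ≤-refl (*-monoˡ-≤ 0≤C (chord²*kernel≤4 N α β)) ⟩
    ε * K α β + C * 4ℝ                           ≈⟨ +-cong ≈-refl (ℝ-Ring.*-comm C 4ℝ) ⟩
    ε * K α β + 4ℝ * C                           ∎

  row : ∀ α → ∣ ∑ B (λ β → (f α - f β) * K α β) ∣ ≤ ε * (n * b + (n * n) * ηB) + b * (4ℝ * C)
  row α = begin
    ∣ ∑ B (λ β → (f α - f β) * K α β) ∣          ≤⟨ ∣∑∣≤ B _ ⟩
    ∑ B (λ β → ∣ (f α - f β) * K α β ∣)          ≤⟨ ∑-mono B (term α) ⟩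
    ∑ B (λ β → ε * K α β + 4ℝ * C)               ≈⟨ ≈-trans (∑-+ B _ _) (+-cong (∑-*ˡ B ε (K α)) (∑-const B _)) ⟩
    ε * ∑ B (K α) + b * (4ℝ * C)
      ≈⟨ +-cong (*-cong ≈-refl (solve 2 (λ s m → s := m :+ (s :- m)) ≈-refl (∑ B (K α)) (n * b))) ≈-refl ⟩
    ε * (n * b + (∑ B (K α) - n * b)) + b * (4ℝ * C)
      ≤⟨ +-mono-≤ (*-monoˡ-≤ 0≤ε (+-mono-≤ ≤-refl (∣x∣≤⇒x≤ (∣∑kernel∣≤ {B} {N} {ηB} smallB 0≤ηB α N ℕ.≤-refl)))) ≤-refl ⟩
    ε * (n * b + (n * n) * ηB) + b * (4ℝ * C)    ∎

  S-T : ∣ S - T ∣ ≤ ε * (a * (n * b + (n * n) * ηB)) + 4ℝ * (C * (a * b))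
  S-T = begin
    ∣ S - T ∣                                                  ≈⟨ ∣∣-cong difference ⟩
    ∣ ∑ A (λ α → ∑ B (λ β → (f α - f β) * K α β)) ∣            ≤⟨ ∣∑∣≤-const A _ _ row ⟩
    a * (ε * (n * b + (n * n) * ηB) + b * (4ℝ * C))
      ≈⟨ solve 6 (λ a e x b q C → a :* (e :* x :+ b :* (q :* C)) := e :* (a :* x) :+ q :* (C :* (a :* b)))
           ≈-refl a ε (n * b + (n * n) * ηB) b 4ℝ C ⟩
    ε * (a * (n * b + (n * n) * ηB)) + 4ℝ * (C * (a * b))      ∎


-- Continuous functions and the Haar integral

archimedeanℚ : ∀ p → ∃ λ n → p ℚ.≤ ℤ.+ n ℚ./ 1
archimedeanℚ p@(mkℚ (ℤ.+ n) d _) = n , ℚ.toℚᵘ-cancel-≤ {p} {ℤ.+ n ℚ./ 1}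
  (ℚᵘ.≤-respʳ-≃ {ℚ.toℚᵘ p} {ℚᵘ.mkℚᵘ (ℤ.+ n) 0} {ℚ.toℚᵘ (ℤ.+ n ℚ./ 1)} (ℚᵘ.≃-sym (toℚᵘ-/1 (ℤ.+ n)))
    (ℚᵘ.*≤* (ℤ.*-monoˡ-≤-nonNeg (ℤ.+ n) (ℤ.+≤+ (s≤s z≤n)))))
archimedeanℚ p@(mkℚ (ℤ.-[1+ n ]) d _) = 0 , ℚ.toℚᵘ-cancel-≤ {p} {0ℚ} (ℚᵘ.*≤* ℤ.-≤+)

archimedean : ∀ x → ∃ λ n → x ≤ fromℕ n
archimedean x = n , mk≤ λ ε → N , λ k N≤k → ℚ.≤-trans
    (ℚ.≤-trans (p≤∣p∣ (seq x k)) (ℚ.≤-trans (h k N≤k) B≤n)) (p≤p+ε (ℤ.+ n ℚ./ 1) ε)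
  where
  B = proj₁ (bounded x)
  N = proj₁ (proj₂ (proj₂ (bounded x)))
  h : ∀ k → N ℕ.≤ k → ℚ.∣ seq x k ∣ ℚ.≤ B
  h = proj₂ (proj₂ (proj₂ (bounded x)))
  n = proj₁ (archimedeanℚ B)
  B≤n : B ℚ.≤ ℤ.+ n ℚ./ 1
  B≤n = proj₂ (archimedeanℚ B)

reciprocal : ∀ p .{{_ : Positive p}} → ∃ λ n → 1ℚ ℚ.≤ p ℚ.* (ℤ.+ n ℚ./ 1)
reciprocal p with archimedeanℚ ((ℚ.1/ p) {{ℚ.pos⇒nonZero p}})
... | n , h = n , subst (ℚ._≤ p ℚ.* (ℤ.+ n ℚ./ 1)) (ℚ.*-inverseʳ p {{ℚ.pos⇒nonZero p}})
  (ℚ.*-monoˡ-≤-nonNeg p {{ℚ.pos⇒nonNeg p}} {(ℚ.1/ p) {{ℚ.pos⇒nonZero p}}} {ℤ.+ n ℚ./ 1} h)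

*-cancelˡ-≤ : ∀ n {x y} → fromℕ (suc n) * x ≤ fromℕ (suc n) * y → x ≤ y
*-cancelˡ-≤ n {x} {y} h = begin
  x                                  ≈⟨ expand x ⟩
  fromℚ q * (fromℕ (suc n) * x)      ≤⟨ *-monoˡ-≤ (fromℚ-mono (ℚ.nonNegative⁻¹ q {{ℚ.normalize-nonNeg 1 (suc n)}})) h ⟩
  fromℚ q * (fromℕ (suc n) * y)      ≈⟨ expand y ⟨
  y                                  ∎
  where
  open ≤-Reasoning
  q = ℤ.+ 1 ℚ./ suc n
  expand : ∀ x → x ≈ fromℚ q * (fromℕ (suc n) * x)
  expand x = ≈-trans (≈-sym (ℝ-Ring.*-identityˡ x)) (≈-trans
    (*-cong {1ℝ} {fromℚ q * fromℕ (suc n)} (pointwise λ _ → ≡.sym (1/n*n (suc n))) ≈-refl)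
    (ℝ-Ring.*-assoc (fromℚ q) (fromℕ (suc n)) x))

constᶜ : ℝ → C⟨𝕋⟩
constᶜ c ⟨ _ ⟩ = c
continuous (constᶜ c) ε = 1ℚ , _ , λ _ _ _ →
  ≤-trans (≤-reflexive (≈-trans (∣∣-cong (ℝ-Ring.-‿inverseʳ c)) (pointwise λ _ → refl))) (fromℚ-mono (pos {ε}))

private
  smaller : ∀ δ δ′ → Positive δ → Positive δ′ → ∃ λ m → Positive m × m ℚ.* m ℚ.≤ δ ℚ.* δ × m ℚ.* m ℚ.≤ δ′ ℚ.* δ′
  smaller δ δ′ δ⁺ δ′⁺ with ℚ.≤-total δ δ′
  ... | inj₁ h = δ , δ⁺ , ℚ.≤-refl , *-bound {{ℚ.pos⇒nonNeg δ {{δ⁺}}}} {{ℚ.pos⇒nonNeg δ′ {{δ′⁺}}}} h h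
  ... | inj₂ h = δ′ , δ′⁺ , *-bound {{ℚ.pos⇒nonNeg δ′ {{δ′⁺}}}} {{ℚ.pos⇒nonNeg δ {{δ⁺}}}} h h , ℚ.≤-refl

infixl 6 _+ᶜ_
_+ᶜ_ : C⟨𝕋⟩ → C⟨𝕋⟩ → C⟨𝕋⟩
(f +ᶜ g) ⟨ z ⟩ = f ⟨ z ⟩ + g ⟨ z ⟩
continuous (f +ᶜ g) ε =
  let (δ , δ⁺ , F) = continuous f (½ ℚ.* ε) {{½⁺ ε}}
      (δ′ , δ′⁺ , G) = continuous g (½ ℚ.* ε) {{½⁺ ε}}
      (m , m⁺ , m≤δ , m≤δ′) = smaller δ δ′ δ⁺ δ′⁺
  in m , m⁺ , λ z w near → begin
  ∣ (f ⟨ z ⟩ + g ⟨ z ⟩) - (f ⟨ w ⟩ + g ⟨ w ⟩) ∣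
    ≈⟨ ∣∣-cong (solve 4 (λ a b c d → (a :+ b) :- (c :+ d) := (a :- c) :+ (b :- d)) ≈-refl (f ⟨ z ⟩) (g ⟨ z ⟩) (f ⟨ w ⟩) (g ⟨ w ⟩)) ⟩
  ∣ (f ⟨ z ⟩ - f ⟨ w ⟩) + (g ⟨ z ⟩ - g ⟨ w ⟩) ∣
    ≤⟨ ∣x+y∣≤ _ _ ⟩
  ∣ f ⟨ z ⟩ - f ⟨ w ⟩ ∣ + ∣ g ⟨ z ⟩ - g ⟨ w ⟩ ∣
    ≤⟨ +-mono-≤ (F z w (≤-trans near (fromℚ-mono m≤δ))) (G z w (≤-trans near (fromℚ-mono m≤δ′))) ⟩
  fromℚ (½ ℚ.* ε) + fromℚ (½ ℚ.* ε)
    ≈⟨ pointwise (λ _ → ½+½ ε) ⟩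
  fromℚ ε ∎
  where
  open ≤-Reasoning
  open ℝ-Solver

infixr 7 _*ᶜ_
_*ᶜ_ : ℝ → C⟨𝕋⟩ → C⟨𝕋⟩
(c *ᶜ f) ⟨ z ⟩ = c * f ⟨ z ⟩
continuous (c *ᶜ f) ε = let (δ , δ⁺ , F) = continuous f η {{η⁺}} in δ , δ⁺ , λ z w near → begin
  ∣ c * f ⟨ z ⟩ - c * f ⟨ w ⟩ ∣
    ≈⟨ ∣∣-cong (solve 3 (λ c a b → c :* a :- c :* b := c :* (a :- b)) ≈-refl c (f ⟨ z ⟩) (f ⟨ w ⟩)) ⟩
  ∣ c * (f ⟨ z ⟩ - f ⟨ w ⟩) ∣
    ≈⟨ ∣xy∣≈ _ _ ⟩
  ∣ c ∣ * ∣ f ⟨ z ⟩ - f ⟨ w ⟩ ∣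
    ≤⟨ *-mono-≤ (0≤∣x∣ c) (fromℚ-mono (pos {η} {{η⁺}})) (≤-trans (proj₂ (archimedean ∣ c ∣)) (fromℕ-mono (ℕ.n≤1+n n))) (F z w near) ⟩
  fromℕ (suc n) * fromℚ η
    ≈⟨ pointwise (λ _ → ≡.trans (≡.sym (ℚ.*-assoc (ℤ.+ suc n ℚ./ 1) q ε)) (≡.trans (cong (ℚ._* ε)
         (≡.trans (ℚ.*-comm (ℤ.+ suc n ℚ./ 1) q) (1/n*n (suc n)))) (ℚ.*-identityˡ ε))) ⟩
  fromℚ ε ∎
  where
  open ≤-Reasoning
  open ℝ-Solver
  n = proj₁ (archimedean ∣ c ∣)
  q = ℤ.+ 1 ℚ./ suc n
  η = q ℚ.* ε
  η⁺ : Positive η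
  η⁺ = ℚ.pos*pos⇒pos q {{ℚ.normalize-pos 1 (suc n)}} ε

rotateᶜ : 𝕋 → C⟨𝕋⟩ → C⟨𝕋⟩
rotateᶜ a f ⟨ z ⟩ = f ⟨ a · z ⟩
continuous (rotateᶜ a f) ε = let (δ , δ⁺ , F) = continuous f ε in
  δ , δ⁺ , λ z w near → F (a · z) (a · w) (≤-trans (≤-reflexive (isometry z w)) near)
  where
  isometry : ∀ z w → chord² (a · z) (a · w) ≈ chord² z w
  isometry z w = ≈-trans (∣∣²-cong (solve 3 (λ a z w → a :* z :+ :- (a :* w) := a :* (z :+ :- w))
      ℂᴿ.refl (point a) (point z) (point w)))
    (≈-trans (∣zw∣² (point a) _) (≈-trans (*-cong (∣point∣≈1 a) ≈-refl) (ℝ-Ring.*-identityˡ _)))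
    where open ℂ-Solver

-- The sum of f over the family B rotated by z, regarded as a continuous function of z so that it
-- can be integrated.
rotations : List 𝕋 → C⟨𝕋⟩ → C⟨𝕋⟩
rotations []      f = constᶜ 0ℝ
rotations (γ ∷ B) f = rotateᶜ γ f +ᶜ rotations B f

rotations-∑ : ∀ B f z → rotations B f ⟨ z ⟩ ≡ ∑ (map (_· z) B) (f ⟨_⟩)
rotations-∑ []      f z = refl
rotations-∑ (γ ∷ B) f z = cong (f ⟨ γ · z ⟩ +_) (rotations-∑ B f z)

module _ (ν : Measure) (haar : IsNormalizedHaar ν) where
  open IsNormalizedHaar haar

  ∫const : ∀ c → ∫ ν (constᶜ c) ≈ c
  ∫const c = ≈-trans
    (homogeneous ν c (constᶜ 1ℝ) (constᶜ c) λ _ → ≈-sym (ℝ-Ring.*-identityʳ c))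
    (≈-trans (*-cong ≈-refl (isProbability (constᶜ 1ℝ) λ _ → ≈-refl)) (ℝ-Ring.*-identityʳ c))

  -- Each summand is a rotate of f and has the same integral. This is where invariance of the Haar
  -- measure enters.
  ∫rotations : ∀ B f → ∫ ν (rotations B f) ≈ size B * ∫ ν f
  ∫rotations []      f = ≈-trans (∫const 0ℝ) (≈-sym (ℝ-Ring.zeroˡ _))
  ∫rotations (γ ∷ B) f = ≈-trans
    (additive ν (rotateᶜ γ f) (rotations B f) (rotations (γ ∷ B) f) λ _ → ≈-refl)
    (≈-trans (+-cong (invariant γ f (rotateᶜ γ f) λ _ → ≈-refl) (∫rotations B f))
      (≈-trans (solve 2 (λ x b → x :+ b :* x := (b :+ con 1ℚ) :* x) ≈-refl (∫ ν f) (size B))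
        (*-cong (≈-sym (fromℕ-suc (length B))) ≈-refl)))
    where open ℝ-Solver

  -- Positivity of the integral, applied to the continuous function c - κ f.
  ∫≤ : ∀ f κ c → (∀ z → κ * f ⟨ z ⟩ ≤ c) → κ * ∫ ν f ≤ c
  ∫≤ f κ c h = 0≤⇒≤ (≤-trans
    (positive ν (constᶜ c +ᶜ (- κ) *ᶜ f) λ z → ≤-trans (≤⇒0≤ (h z)) (≤-reflexive
      (solve 3 (λ c κ x → c :- κ :* x := c :+ (:- κ) :* x) ≈-refl c κ (f ⟨ z ⟩))))
    (≤-reflexive (≈-trans
      (additive ν (constᶜ c) ((- κ) *ᶜ f) (constᶜ c +ᶜ (- κ) *ᶜ f) λ _ → ≈-refl)
      (≈-trans (+-cong (∫const c) (homogeneous ν (- κ) f ((- κ) *ᶜ f) λ _ → ≈-refl))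
        (solve 3 (λ c κ x → c :+ (:- κ) :* x := c :- κ :* x) ≈-refl c κ (∫ ν f))))))
    where open ℝ-Solver

  ∣∫∣≤ : ∀ f κ x c → (∀ z → ∣ x - κ * f ⟨ z ⟩ ∣ ≤ c) → ∣ x - κ * ∫ ν f ∣ ≤ c
  ∣∫∣≤ f κ x c h = ∣x∣≤
    (fwd (∫≤ f (- κ) (c - x) λ z → bwd (∣x∣≤⇒x≤ (h z))))
    (fwd′ (∫≤ f κ (c + x) λ z → bwd′ (∣x∣≤⇒-x≤ (h z))))
    where
    open ℝ-Solver
    fwd : ∀ {y} → - κ * y ≤ c - x → x - κ * y ≤ c
    fwd {y} p = 0≤⇒≤ (≤-trans (≤⇒0≤ p) (≤-reflexive
      (solve 4 (λ κ y c x → (c :- x) :- ((:- κ) :* y) := c :- (x :- κ :* y)) ≈-refl κ y c x)))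
    bwd : ∀ {y} → x - κ * y ≤ c → - κ * y ≤ c - x
    bwd {y} p = 0≤⇒≤ (≤-trans (≤⇒0≤ p) (≤-reflexive
      (solve 4 (λ κ y c x → c :- (x :- κ :* y) := (c :- x) :- ((:- κ) :* y)) ≈-refl κ y c x)))
    fwd′ : ∀ {y} → κ * y ≤ c + x → - (x - κ * y) ≤ c
    fwd′ {y} p = 0≤⇒≤ (≤-trans (≤⇒0≤ p) (≤-reflexive
      (solve 4 (λ κ y c x → (c :+ x) :- κ :* y := c :- :- (x :- κ :* y)) ≈-refl κ y c x)))
    bwd′ : ∀ {y} → - (x - κ * y) ≤ c → κ * y ≤ c + x
    bwd′ {y} p = 0≤⇒≤ (≤-trans (≤⇒0≤ p) (≤-reflexive
      (solve 4 (λ κ y c x → c :- :- (x :- κ :* y) := (c :+ x) :- κ :* y) ≈-refl κ y c x)))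

-- Smallness relative to the size, stated without division: the power sums with positive exponent
-- below N are at most η, and c η lies below the size. Strictness also makes B nonempty.
record Ample (N c : ℕ) (B : List 𝕋) : Set where
  field
    η     : ℕ
    small : SmallSums B N (fromℕ η)
    large : c ℕ.* η ℕ.< length B
open Ample

8ℚ 9ℚ 16ℚ : ℚ
8ℚ = ℤ.+ 8 ℚ./ 1
9ℚ = ℤ.+ 9 ℚ./ 1
16ℚ = ℤ.+ 16 ℚ./ 1

-- Ample families as finite nets, and moduli of continuity

module _ {N B} (ample : Ample N (2 ℕ.* N) B) {p ρ} .{{_ : Positive p}} (p<ρ : p ℚ.< ρ)
         (9≤pN : fromℚ 9ℚ ≤ fromℚ p * fromℕ N) where

  -- If every γ in B had `chord² z γ` at least p, then p Σ K ≤ Σ chord² K ≤ 4 b, where b is the size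
  -- of B. But 2 N η < b gives Σ K ≥ N b - N^2 η ≥ N b / 2, so 9 b ≤ p N b ≤ 8 b, impossible for
  -- nonempty B. The gap between p and ρ lets `search` decide for each γ between the overlapping
  -- alternatives.
  dense : ∀ z → Any (λ γ → chord² z γ ≤ fromℚ ρ) B
  dense z = result (search B)
    where
    open ≤-Reasoning
    open ℝ-Solver
    n = fromℕ N
    b = size B
    e = fromℕ (η ample)
    K : 𝕋 → ℝ
    K γ = kernel N (z · conj γ)
    0≤p : 0ℝ ≤ fromℚ p
    0≤p = fromℚ-mono {0ℚ} {p} (pos {p})
    search : ∀ xs → Any (λ γ → chord² z γ ≤ fromℚ ρ) xs ⊎ (fromℚ p * ∑ xs K ≤ ∑ xs (λ γ → chord² z γ * K γ))
    search [] = inj₂ (≤-reflexive (ℝ-Ring.zeroʳ (fromℚ p)))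
    search (γ ∷ xs) = step (≤-cotrans (chord² z γ) p<ρ) (search xs)
      where
      step : chord² z γ ≤ fromℚ ρ ⊎ fromℚ p ≤ chord² z γ →
        Any (λ γ → chord² z γ ≤ fromℚ ρ) xs ⊎ (fromℚ p * ∑ xs K ≤ ∑ xs (λ γ → chord² z γ * K γ)) →
        Any (λ γ → chord² z γ ≤ fromℚ ρ) (γ ∷ xs) ⊎
          (fromℚ p * ∑ (γ ∷ xs) K ≤ ∑ (γ ∷ xs) (λ γ → chord² z γ * K γ))
      step (inj₁ h) _        = inj₁ (here h)
      step (inj₂ _) (inj₁ h) = inj₁ (there h)
      step (inj₂ h) (inj₂ k) = inj₂ (≤-trans (≤-reflexive (ℝ-Ring.distribˡ (fromℚ p) (K γ) (∑ xs K)))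
        (+-mono-≤ (*-mono-≤ 0≤p (0≤kernel N (z · conj γ)) h ≤-refl) k))
    2Ne≤b : fromℕ (2 ℕ.* N ℕ.* η ample) ≤ b
    2Ne≤b = fromℕ-mono {2 ℕ.* N ℕ.* η ample} {length B} (ℕ.<⇒≤ (large ample))
    9b≤8b : fromℚ p * ∑ B K ≤ ∑ B (λ γ → chord² z γ * K γ) → fromℚ 9ℚ * b ≤ fromℚ 8ℚ * b
    9b≤8b h = begin
      fromℚ 9ℚ * b                                    ≤⟨ *-mono-≤ (0≤fromℕ 9) (0≤size B) 9≤pN ≤-refl ⟩
      (fromℚ p * n) * b                               ≈⟨ solve 3 (λ p n b → (p :* n) :* b := p :* (n :* b) :+ (p :* n) :* con 0ℚ) ≈-refl (fromℚ p) n b ⟩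
      fromℚ p * (n * b) + (fromℚ p * n) * 0ℝ
        ≤⟨ +-mono-≤ ≤-refl (*-monoˡ-≤ (0≤* 0≤p (0≤fromℕ N)) (≤⇒0≤ 2Ne≤b′)) ⟩
      fromℚ p * (n * b) + (fromℚ p * n) * (b - (2ℝ * n) * e)
        ≈⟨ solve 4 (λ p n b e → p :* (n :* b) :+ (p :* n) :* (b :- ((con 1ℚ :+ con 1ℚ) :* n) :* e) :=
             (con 1ℚ :+ con 1ℚ) :* (p :* (n :* b :- (n :* n) :* e))) ≈-refl (fromℚ p) n b e ⟩
      2ℝ * (fromℚ p * (n * b - (n * n) * e))
        ≤⟨ *-monoˡ-≤ (0≤+ 0≤1 0≤1) (*-monoˡ-≤ 0≤p lower) ⟩
      2ℝ * (fromℚ p * ∑ B K)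
        ≤⟨ *-monoˡ-≤ (0≤+ 0≤1 0≤1) (≤-trans h (≤-trans (∑-mono B (chord²*kernel≤4 N z)) (≤-reflexive (∑-const B 4ℝ)))) ⟩
      2ℝ * (b * 4ℝ)
        ≈⟨ solve 1 (λ b → (con 1ℚ :+ con 1ℚ) :* (b :* ((con 1ℚ :+ con 1ℚ) :+ (con 1ℚ :+ con 1ℚ))) := con 8ℚ :* b) ≈-refl b ⟩
      fromℚ 8ℚ * b ∎
      where
      2Ne≤b′ : (2ℝ * n) * e ≤ b
      2Ne≤b′ = ≤-trans (≤-reflexive (≈-trans (*-cong (*-cong {2ℝ} {fromℕ 2} (pointwise λ _ → refl) ≈-refl) ≈-refl)
        (≈-sym (≈-trans (fromℕ-* (2 ℕ.* N) (η ample)) (*-cong (fromℕ-* 2 N) ≈-refl))))) 2Ne≤b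
      lower : n * b - (n * n) * e ≤ ∑ B K
      lower = 0≤⇒≤ (≤-trans (≤⇒0≤ (∣x∣≤⇒-x≤ (∣∑kernel∣≤ {B} {N} (small ample) (0≤fromℕ (η ample)) z N ℕ.≤-refl)))
        (≤-reflexive (solve 3 (λ s m q → q :- (:- (s :- m)) := s :- (m :- q)) ≈-refl (∑ B K) (n * b) ((n * n) * e))))
    result : Any (λ γ → chord² z γ ≤ fromℚ ρ) B ⊎ (fromℚ p * ∑ B K ≤ ∑ B (λ γ → chord² z γ * K γ)) →
             Any (λ γ → chord² z γ ≤ fromℚ ρ) B
    result (inj₁ h) = h
    result (inj₂ h) = contradiction
      (fromℕ-reflects-≤ {9 ℕ.* length B} {8 ℕ.* length B} (≤-trans (≤-reflexive (fromℕ-* 9 (length B))) (≤-trans (9b≤8b h) (≤-reflexive (≈-sym (fromℕ-* 8 (length B)))))))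
      (ℕ.<⇒≱ (ℕ.*-monoˡ-< (length B) {{ℕ.>-nonZero (ℕ.≤-<-trans z≤n (large ample))}} (ℕ.≤-refl {9})))

≤∑∣∣ : ∀ {B : List 𝕋} {P : 𝕋 → Set} (f : 𝕋 → ℝ) → Any P B → ∃ λ γ → P γ × ∣ f γ ∣ ≤ ∑ B (λ γ → ∣ f γ ∣)
≤∑∣∣ {γ ∷ B} f (here p) = γ , p , ≤-trans (≤-reflexive (≈-sym (ℝ-Ring.+-identityʳ _))) (+-mono-≤ ≤-refl (0≤∑ B))
  where
  0≤∑ : ∀ B → 0ℝ ≤ ∑ B (λ γ → ∣ f γ ∣)
  0≤∑ []      = ≤-refl
  0≤∑ (γ ∷ B) = 0≤+ (0≤∣x∣ (f γ)) (0≤∑ B)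
≤∑∣∣ {γ ∷ B} f (there h) = let (γ′ , p , q) = ≤∑∣∣ f h in
  γ′ , p , ≤-trans q (≤-trans (≤-reflexive (≈-sym (ℝ-Ring.+-identityˡ _))) (+-mono-≤ (0≤∣x∣ (f γ)) ≤-refl))

½p<p : ∀ p .{{_ : Positive p}} → ½ ℚ.* p ℚ.< p
½p<p p = subst (½ ℚ.* p ℚ.<_) (½+½ p)
  (subst (ℚ._< ½ ℚ.* p ℚ.+ ½ ℚ.* p) (ℚ.+-identityʳ (½ ℚ.* p)) (ℚ.+-monoʳ-< (½ ℚ.* p) (ℚ.positive⁻¹ (½ ℚ.* p) {{½⁺ p}})))

module _ (source : ∀ N c → ∃ (Ample N c)) where

  -- Every z is within the radius r of some γ of a finite net, where f varies by at most 1. The sum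
  -- of the |f γ| stands in for their maximum.
  boundedᶜ : ∀ f → ∃ λ M → ∀ z → ∣ f ⟨ z ⟩ ∣ ≤ fromℕ M
  boundedᶜ f = proj₁ (archimedean bound) , λ z → ≤-trans (f≤bound z) (proj₂ (archimedean bound))
    where
    open ≤-Reasoning
    open ℝ-Solver
    r = proj₁ (continuous f 1ℚ)
    r⁺ = proj₁ (proj₂ (continuous f 1ℚ))
    ρ = r ℚ.* r
    instance
      ρ⁺ : Positive ρ
      ρ⁺ = ℚ.pos*pos⇒pos r {{r⁺}} r {{r⁺}}
      p⁺ : Positive (½ ℚ.* ρ)
      p⁺ = ½⁺ ρ
    p = ½ ℚ.* ρ
    n = proj₁ (reciprocal p)
    -- Since 1 ≤ p n, this choice gives the 9 ≤ p N that `dense` requires.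
    N = 9 ℕ.* n
    B = proj₁ (source N (2 ℕ.* N))
    bound = ∑ B (λ γ → ∣ f ⟨ γ ⟩ ∣) + 1ℝ
    9≤pN : fromℚ 9ℚ ≤ fromℚ p * fromℕ N
    9≤pN = begin
      fromℚ 9ℚ                              ≈⟨ ℝ-Ring.*-identityʳ _ ⟨
      fromℚ 9ℚ * 1ℝ                         ≤⟨ *-monoˡ-≤ (0≤fromℕ 9) (fromℚ-mono (proj₂ (reciprocal p))) ⟩
      fromℚ 9ℚ * fromℚ (p ℚ.* (ℤ.+ n ℚ./ 1))  ≈⟨ *-cong ≈-refl (pointwise λ _ → refl) ⟩
      fromℚ 9ℚ * (fromℚ p * fromℕ n)        ≈⟨ solve 3 (λ k p n → k :* (p :* n) := p :* (k :* n)) ≈-refl (fromℚ 9ℚ) (fromℚ p) (fromℕ n) ⟩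
      fromℚ p * (fromℚ 9ℚ * fromℕ n)        ≈⟨ *-cong ≈-refl (fromℕ-* 9 n) ⟨
      fromℚ p * fromℕ N                     ∎
    f≤bound : ∀ z → ∣ f ⟨ z ⟩ ∣ ≤ bound
    f≤bound z = let (γ , near , γ≤) = ≤∑∣∣ {B} (f ⟨_⟩) (dense (proj₂ (source N (2 ℕ.* N))) (½p<p ρ) 9≤pN z) in begin
      ∣ f ⟨ z ⟩ ∣                                 ≈⟨ ∣∣-cong (solve 2 (λ a b → a := b :+ (a :- b)) ≈-refl (f ⟨ z ⟩) (f ⟨ γ ⟩)) ⟩
      ∣ f ⟨ γ ⟩ + (f ⟨ z ⟩ - f ⟨ γ ⟩) ∣           ≤⟨ ∣x+y∣≤ _ _ ⟩
      ∣ f ⟨ γ ⟩ ∣ + ∣ f ⟨ z ⟩ - f ⟨ γ ⟩ ∣         ≤⟨ +-mono-≤ γ≤ (proj₂ (proj₂ (continuous f 1ℚ)) z γ near) ⟩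
      bound                                       ∎

  -- Close points are served by ε. Otherwise `chord² z w` is at least p, and 2 M ≤ 2 M n p ≤ C
  -- `chord² z w`, because n is at least 1 / p. The term is quadratic in the distance to fit
  -- `chord²*kernel≤4`.
  modulusᶜ : ∀ f ε .{{_ : Positive ε}} → ∃ λ C → ∀ z w → ∣ f ⟨ z ⟩ - f ⟨ w ⟩ ∣ ≤ fromℚ ε + fromℕ C * chord² z w
  modulusᶜ f ε = C , λ z w → result z w (≤-cotrans (chord² z w) (½p<p ρ))
    where
    open ≤-Reasoning
    open ℝ-Solver
    r = proj₁ (continuous f ε)
    r⁺ = proj₁ (proj₂ (continuous f ε))
    ρ = r ℚ.* r
    instance
      ρ⁺ : Positive ρ
      ρ⁺ = ℚ.pos*pos⇒pos r {{r⁺}} r {{r⁺}}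
      p⁺ : Positive (½ ℚ.* ρ)
      p⁺ = ½⁺ ρ
    p = ½ ℚ.* ρ
    n = proj₁ (reciprocal p)
    M = proj₁ (boundedᶜ f)
    ∣f∣≤M = proj₂ (boundedᶜ f)
    C = n ℕ.* (M ℕ.+ M)
    result : ∀ z w → chord² z w ≤ fromℚ ρ ⊎ fromℚ p ≤ chord² z w →
             ∣ f ⟨ z ⟩ - f ⟨ w ⟩ ∣ ≤ fromℚ ε + fromℕ C * chord² z w
    result z w (inj₁ h) = ≤-trans (proj₂ (proj₂ (continuous f ε)) z w h) (≤-trans
      (≤-reflexive (≈-sym (ℝ-Ring.+-identityʳ _))) (+-mono-≤ ≤-refl (0≤* (0≤fromℕ C) (0≤∣z∣² _))))
    result z w (inj₂ h) = begin
      ∣ f ⟨ z ⟩ - f ⟨ w ⟩ ∣             ≤⟨ ∣x+y∣≤ _ _ ⟩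
      ∣ f ⟨ z ⟩ ∣ + ∣ - f ⟨ w ⟩ ∣       ≤⟨ +-mono-≤ (∣f∣≤M z) (≤-trans (≤-reflexive (∣-x∣≈∣x∣ _)) (∣f∣≤M w)) ⟩
      fromℕ M + fromℕ M                 ≈⟨ fromℕ-+ M M ⟨
      fromℕ (M ℕ.+ M)                   ≈⟨ ℝ-Ring.*-identityʳ _ ⟨
      fromℕ (M ℕ.+ M) * 1ℝ              ≤⟨ *-monoˡ-≤ (0≤fromℕ (M ℕ.+ M)) (fromℚ-mono (proj₂ (reciprocal p))) ⟩
      fromℕ (M ℕ.+ M) * (fromℚ (p ℚ.* (ℤ.+ n ℚ./ 1)))  ≈⟨ *-cong ≈-refl (pointwise λ _ → refl) ⟩
      fromℕ (M ℕ.+ M) * (fromℚ p * fromℕ n)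
        ≈⟨ solve 3 (λ m p n → m :* (p :* n) := (n :* m) :* p) ≈-refl (fromℕ (M ℕ.+ M)) (fromℚ p) (fromℕ n) ⟩
      (fromℕ n * fromℕ (M ℕ.+ M)) * fromℚ p   ≈⟨ *-cong (fromℕ-* n (M ℕ.+ M)) ≈-refl ⟨
      fromℕ C * fromℚ p                 ≤⟨ *-monoˡ-≤ (0≤fromℕ C) h ⟩
      fromℕ C * chord² z w              ≈⟨ ℝ-Ring.+-identityˡ _ ⟨
      0ℝ + fromℕ C * chord² z w         ≤⟨ +-mono-≤ (fromℚ-mono (pos {ε})) ≤-refl ⟩
      fromℚ ε + fromℕ C * chord² z w    ∎

-- With a, b the sizes of the lists this is the bound of `compare`, cleared of
-- denominators; the factor 8 n collects the four error terms 1 + 1 + 4 + 2.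
absorb : ∀ {N J M C} {a b eA eB E X : ℝ} → let n = fromℕ (suc N) ; j = fromℕ J ; m = fromℕ M in
  0ℝ ≤ a → 0ℝ ≤ b →
  fromℚ 8ℚ * (j * (m * (n * eB))) ≤ b → fromℚ 8ℚ * (j * (m * (n * eA))) ≤ a → n * eB ≤ b →
  fromℚ 16ℚ * (fromℕ C * j) ≤ n → (4ℝ * j) * E ≈ 1ℝ →
  n * X ≤ (a * (m * ((n * n) * eB)) + b * (m * ((n * n) * eA)))
          + (E * (a * (n * b + (n * n) * eB)) + 4ℝ * (fromℕ C * (a * b))) →
  j * X ≤ a * b
absorb {N} {J} {M} {C} {a} {b} {eA} {eB} {E} {X} 0≤a 0≤b hB hA hn hC hE h =
  *-cancelˡ-≤ N (*-cancelˡ-≤ 7 (begin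
    fromℕ 8 * (n * (j * X))
      ≈⟨ solve 3 (λ n j X → con 8ℚ :* (n :* (j :* X)) := (con 8ℚ :* j) :* (n :* X)) ≈-refl n j X ⟩
    (fromℕ 8 * j) * (n * X)
      ≤⟨ *-monoˡ-≤ (0≤* (0≤fromℕ 8) (0≤fromℕ J)) h ⟩
    (fromℕ 8 * j) * ((a * (m * ((n * n) * eB)) + b * (m * ((n * n) * eA)))
          + (E * (a * (n * b + (n * n) * eB)) + 4ℝ * (c * (a * b))))
      ≈⟨ solve 9 (λ n j m c a b eA eB E →
           (con 8ℚ :* j) :* ((a :* (m :* ((n :* n) :* eB)) :+ b :* (m :* ((n :* n) :* eA)))
             :+ (E :* (a :* (n :* b :+ (n :* n) :* eB)) :+ con4 :* (c :* (a :* b)))) :=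
           ((a :* n) :* (con 8ℚ :* (j :* (m :* (n :* eB)))) :+ (b :* n) :* (con 8ℚ :* (j :* (m :* (n :* eA)))))
             :+ ((con2 :* (a :* n)) :* ((b :+ n :* eB) :* ((con4 :* j) :* E)) :+ (con2 :* (a :* b)) :* (con 16ℚ :* (c :* j))))
           ≈-refl n j m c a b eA eB E ⟩
    ((a * n) * (fromℚ 8ℚ * (j * (m * (n * eB)))) + (b * n) * (fromℚ 8ℚ * (j * (m * (n * eA)))))
      + ((2ℝ * (a * n)) * ((b + n * eB) * ((4ℝ * j) * E)) + (2ℝ * (a * b)) * (fromℚ 16ℚ * (c * j)))
      ≤⟨ +-mono-≤ (+-mono-≤ (*-monoˡ-≤ (0≤* 0≤a 0≤n) hB) (*-monoˡ-≤ (0≤* 0≤b 0≤n) hA))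
           (+-mono-≤ (*-monoˡ-≤ (0≤* 0≤2 (0≤* 0≤a 0≤n))
               (≤-trans (≤-reflexive (≈-trans (*-cong ≈-refl hE) (ℝ-Ring.*-identityʳ _))) (+-mono-≤ ≤-refl hn)))
             (*-monoˡ-≤ (0≤* 0≤2 (0≤* 0≤a 0≤b)) hC)) ⟩
    ((a * n) * b + (b * n) * a) + ((2ℝ * (a * n)) * (b + b) + (2ℝ * (a * b)) * n)
      ≈⟨ solve 3 (λ n a b → ((a :* n) :* b :+ (b :* n) :* a) :+ ((con2 :* (a :* n)) :* (b :+ b) :+ (con2 :* (a :* b)) :* n)
           := con 8ℚ :* (n :* (a :* b))) ≈-refl n a b ⟩
    fromℕ 8 * (n * (a * b)) ∎))
  where
  open ≤-Reasoning
  open ℝ-Solver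
  n = fromℕ (suc N)
  j = fromℕ J
  m = fromℕ M
  c = fromℕ C
  con2 con4 : ∀ {k} → Polynomial k
  con2 = con 1ℚ :+ con 1ℚ
  con4 = con2 :+ con2
  0≤2 : 0ℝ ≤ 2ℝ
  0≤2 = 0≤+ 0≤1 0≤1
  0≤n : 0ℝ ≤ n
  0≤n = 0≤fromℕ (suc N)

fromℕ-*⁴ : ∀ k j m n e → fromℕ (k ℕ.* (j ℕ.* (m ℕ.* (n ℕ.* e)))) ≈
           fromℕ k * (fromℕ j * (fromℕ m * (fromℕ n * fromℕ e)))
fromℕ-*⁴ k j m n e = ≈-trans (fromℕ-* k _) (*-cong ≈-refl (≈-trans (fromℕ-* j _) (*-cong ≈-refl
  (≈-trans (fromℕ-* m _) (*-cong ≈-refl (fromℕ-* n e))))))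

-- The N and c for which the error terms in `absorb` are small enough.
Order Factor : (j M C : ℕ) → ℕ
Order  j M C = suc (16 ℕ.* (C ℕ.* suc j))
Factor j M C = 8 ℕ.* (suc j ℕ.* (M ℕ.* Order j M C)) ℕ.+ Order j M C

-- Comparison of a family with the Haar integral

module _ (ν : Measure) (haar : IsNormalizedHaar ν) (f : C⟨𝕋⟩) (j M C : ℕ) (B : List 𝕋)
  (ampleB : Ample (Order j M C) (Factor j M C) B) (bound : ∀ z → ∣ f ⟨ z ⟩ ∣ ≤ fromℕ M)
  (modulus : ∀ z w → ∣ f ⟨ z ⟩ - f ⟨ w ⟩ ∣ ≤ fromℚ (ℤ.+ 1 ℚ./ (4 ℕ.* suc j)) + fromℕ C * chord² z w) where
  private
    J = suc j
    N = Order j M C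
    ε = ℤ.+ 1 ℚ./ (4 ℕ.* J)
    instance
      ε⁺ : Positive ε
      ε⁺ = ℚ.normalize-pos 1 (4 ℕ.* J)

    large₁ : ∀ {A} (a : Ample N (Factor j M C) A) →
      fromℚ 8ℚ * (fromℕ J * (fromℕ M * (fromℕ N * fromℕ (η a)))) ≤ size A
    large₁ {A} a = ≤-trans (≤-reflexive (≈-sym (fromℕ-*⁴ 8 J M N (η a)))) (fromℕ-mono
      {8 ℕ.* (J ℕ.* (M ℕ.* (N ℕ.* η a)))} {length A}
      (ℕ.≤-trans (ℕ.≤-trans (ℕ.m≤m+n (8 ℕ.* (J ℕ.* (M ℕ.* (N ℕ.* η a)))) (N ℕ.* η a))
        (ℕ.≤-reflexive (solve 4 (λ J M N e → con 8 :* (J :* (M :* (N :* e))) :+ N :* e :=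
          (con 8 :* (J :* (M :* N)) :+ N) :* e) refl J M N (η a)))) (ℕ.<⇒≤ (large a))))
      where open ℕSolver

    large₂ : ∀ {A} (a : Ample N (Factor j M C) A) → fromℕ N * fromℕ (η a) ≤ size A
    large₂ {A} a = ≤-trans (≤-reflexive (≈-sym (fromℕ-* N (η a)))) (fromℕ-mono {N ℕ.* η a} {length A}
      (ℕ.≤-trans (ℕ.*-monoˡ-≤ (η a) (ℕ.m≤n+m N (8 ℕ.* (J ℕ.* (M ℕ.* N))))) (ℕ.<⇒≤ (large a))))

    16CJ≤N : fromℚ 16ℚ * (fromℕ C * fromℕ J) ≤ fromℕ N
    16CJ≤N = ≤-trans (≤-reflexive (≈-sym (≈-trans (fromℕ-* 16 (C ℕ.* J)) (*-cong ≈-refl (fromℕ-* C J)))))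
      (fromℕ-mono {16 ℕ.* (C ℕ.* J)} {N} (ℕ.n≤1+n _))

    4Jε≈1 : (4ℝ * fromℕ J) * fromℚ ε ≈ 1ℝ
    4Jε≈1 = ≈-trans (ℝ-Ring.*-comm _ (fromℚ ε)) (≈-trans
      (*-cong ≈-refl (≈-trans (*-cong {4ℝ} {fromℕ 4} (pointwise λ _ → refl) ≈-refl) (≈-sym (fromℕ-* 4 J))))
      (pointwise λ _ → 1/n*n (4 ℕ.* J)))

  module _ {A} (ampleA : Ample N (Factor j M C) A) where
    private
      open ≤-Reasoning
      open ℝ-Solver
      a = size A
      b = size B
      S = ∑ A (f ⟨_⟩)

      compare-rotated : ∀ z →
        ∣ (fromℕ J * b) * S - (fromℕ J * a) * rotations B f ⟨ z ⟩ ∣ ≤ a * b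
      compare-rotated z = begin
        ∣ (fromℕ J * b) * S - (fromℕ J * a) * rotations B f ⟨ z ⟩ ∣
          ≈⟨ ∣∣-cong (+-cong ≈-refl (-‿cong (*-cong ≈-refl (ℝ-Ring.reflexive (rotations-∑ B f z))))) ⟩
        ∣ (fromℕ J * b) * S - (fromℕ J * a) * S′ ∣
          ≈⟨ ∣∣-cong (solve 5 (λ j a b x y → (j :* b) :* x :- (j :* a) :* y := j :* (b :* x :- a :* y)) ≈-refl (fromℕ J) a b S S′) ⟩
        ∣ fromℕ J * (b * S - a * S′) ∣
          ≈⟨ ≈-trans (∣xy∣≈ _ _) (*-cong (0≤⇒∣x∣≈x (0≤fromℕ J)) ≈-refl) ⟩
        fromℕ J * ∣ b * S - a * S′ ∣
          ≤⟨ absorb {16 ℕ.* (C ℕ.* J)} {J} {M} {C} {a} {b} {fromℕ (η ampleA)} {fromℕ (η ampleB)} {fromℚ ε}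
               (0≤size A) (0≤size B) (large₁ ampleB) (large₁ ampleA) (large₂ ampleB) 16CJ≤N 4Jε≈1 compared ⟩
        a * b ∎
        where
        B′ = map (_· z) B
        S′ = ∑ B′ (f ⟨_⟩)
        -- Abstracting the size of B leaves S′ alone while `length-map` rewrites only the length of
        -- the rotated list.
        Bound : ℝ → Set
        Bound b = fromℕ N * ∣ b * S - a * S′ ∣ ≤
          (a * (fromℕ M * ((fromℕ N * fromℕ N) * fromℕ (η ampleB))) + b * (fromℕ M * ((fromℕ N * fromℕ N) * fromℕ (η ampleA))))
          + (fromℚ ε * (a * (fromℕ N * b + (fromℕ N * fromℕ N) * fromℕ (η ampleB))) + 4ℝ * (fromℕ C * (a * b)))
        compared : Bound b
        compared = subst (λ k → Bound (fromℕ k)) (length-map (_· z) B)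
          (compare {A} {B′} {N} {fromℕ (η ampleA)} {fromℕ (η ampleB)} (small ampleA)
            (smallSums-rotate {B} {N} {fromℕ (η ampleB)} z (small ampleB))
            (0≤fromℕ (η ampleA)) (0≤fromℕ (η ampleB)) (f ⟨_⟩) {fromℕ M} {fromℕ C} {fromℚ ε}
            bound (0≤fromℕ C) (fromℚ-mono {0ℚ} {ε} (pos {ε})) modulus)

      cancel : ∀ {l x y} → 0 ℕ.< l → fromℕ l * x ≤ fromℕ l * y → x ≤ y
      cancel {suc l} _ h = *-cancelˡ-≤ l h

    -- The bound `compare-rotated` is uniform in z, hence survives integration over z, which turns
    -- the rotated sums into b times the integral of f. The factor b then cancels, as B is nonempty.
    near-integral : fromℕ J * ∣ S - size A * ∫ ν f ∣ ≤ size A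
    near-integral = cancel (ℕ.≤-<-trans z≤n (large ampleB)) (begin
      b * (fromℕ J * ∣ S - a * ∫ ν f ∣)
        ≈⟨ ≈-trans (≈-trans (∣xy∣≈ _ _) (*-cong (0≤⇒∣x∣≈x (0≤* (0≤size B) (0≤fromℕ J))) ≈-refl)) (ℝ-Ring.*-assoc b (fromℕ J) _) ⟨
      ∣ (b * fromℕ J) * (S - a * ∫ ν f) ∣
        ≈⟨ ∣∣-cong (solve 5 (λ j a b x y → (b :* j) :* (x :- a :* y) := (j :* b) :* x :- (j :* a) :* (b :* y)) ≈-refl (fromℕ J) a b S (∫ ν f)) ⟩
      ∣ (fromℕ J * b) * S - (fromℕ J * a) * (b * ∫ ν f) ∣
        ≈⟨ ∣∣-cong (+-cong ≈-refl (-‿cong (*-cong ≈-refl (∫rotations ν haar B f)))) ⟨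
      ∣ (fromℕ J * b) * S - (fromℕ J * a) * ∫ ν (rotations B f) ∣
        ≤⟨ ∣∫∣≤ ν haar (rotations B f) (fromℕ J * a) ((fromℕ J * b) * S) (a * b) compare-rotated ⟩
      a * b
        ≈⟨ ℝ-Ring.*-comm a b ⟩
      b * a ∎)

-- N and c are fixed by f and j before A is given, so the bound applies at once to the roots at all
-- large cutoffs.
equidistributed : (∀ N c → ∃ (Ample N c)) → ∀ ν → IsNormalizedHaar ν → ∀ f j → ∃ λ N → ∃ λ c →
  ∀ A → Ample N c A → fromℕ (suc j) * ∣ ∑ A (f ⟨_⟩) - size A * ∫ ν f ∣ ≤ size A
equidistributed source ν haar f j =
  let (M , bound) = boundedᶜ source f
      (C , modulus) = modulusᶜ source f (ℤ.+ 1 ℚ./ (4 ℕ.* suc j)) {{ℚ.normalize-pos 1 (4 ℕ.* suc j)}}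
      (B , ampleB) = source (Order j M C) (Factor j M C)
  in Order j M C , Factor j M C , λ A ampleA →
       near-integral ν haar f j M C B ampleB bound modulus ampleA

-- Roots of the Alexander polynomial

module Roots where
  open Algebra.Properties.Monoid.Mult ℤ.+-0-monoid using () renaming (_×_ to _×ᶻ_)
  open Algebra.Properties.Monoid.Mult ℂᴿ.+-monoid using (×-congʳ) renaming (_×_ to _×ᶜ_)
  module ℂ[t] = Polynomials ℂ-commutativeRing
  module ℂ⟦t⟧ᴰ = LogarithmicDerivative ℂ-commutativeRing
  open ℂ⟦t⟧
  open ℂ⟦t⟧ᴰ using (LogD; D)
  open SeriesRing ℂ-commutativeRing using (*ˢ-comm; *ˢ-assoc; *ˢ-cong; 1ˢ-*ˢ; 0ˢ)

  ι : ℤ → ℂ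
  ι i = fromℤ i +i 0ℝ

  ι-cong : ∀ {i j} → i ≡ j → ι i ℂ-Ring.≈ ι j
  ι-cong refl = ℂᴿ.refl

  ι-+ : ∀ i j → ι (i ℤ.+ j) ℂ-Ring.≈ ι i ℂ-Ring.+ ι j
  ι-+ i j = fromℤ-+ i j , ≈-sym (ℝ-Ring.+-identityˡ 0ℝ)

  ι-* : ∀ i j → ι (i ℤ.* j) ℂ-Ring.≈ ι i ℂ-Ring.* ι j
  ι-* i j = ≈-trans (fromℤ-* i j) (solve 2 (λ a b → a :* b := a :* b :- con 0ℚ :* con 0ℚ) ≈-refl (fromℤ i) (fromℤ j))
          , solve 2 (λ a b → con 0ℚ := a :* con 0ℚ :+ con 0ℚ :* b) ≈-refl (fromℤ i) (fromℤ j)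
    where open ℝ-Solver

  ι-neg : ∀ i → ι (ℤ.- i) ℂ-Ring.≈ ℂ-Ring.- ι i
  ι-neg i = fromℤ-neg i , pointwise λ _ → refl

  ι-× : ∀ n i → ι (n ×ᶻ i) ℂ-Ring.≈ n ×ᶜ ι i
  ι-× zero    i = ℂᴿ.refl
  ι-× (suc n) i = ℂᴿ.trans (ι-+ i (n ×ᶻ i)) (ℂᴿ.+-congˡ {ι i} (ι-× n i))

  ιˢ : ℤ⟦t⟧.Carrier → ℂ⟦t⟧.Carrier
  ιˢ f k = ι (f k)

  ιˢ-* : ∀ f g → ιˢ (f ℤ⟦t⟧.*ˢ g) ≈ˢ ιˢ f *ˢ ιˢ g
  ιˢ-* f g zero    = ℂᴿ.trans (ι-+ (f 0 ℤ.* g 0) ℤ.0ℤ) (ℂᴿ.+-congʳ (ι-* (f 0) (g 0)))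
  ιˢ-* f g (suc k) = ℂᴿ.trans (ι-+ (f 0 ℤ.* g (suc k)) _)
    (ℂᴿ.+-cong (ι-* (f 0) (g (suc k))) (ιˢ-* (λ i → f (suc i)) g k))

  ιˢ-1 : ιˢ ℤ⟦t⟧.1ˢ ≈ˢ 1ˢ
  ιˢ-1 zero    = ℂᴿ.refl
  ιˢ-1 (suc k) = ℂᴿ.refl

  logD-Δℂ : ∀ p q .{{_ : NonZero p}} .{{_ : NonZero q}} → LogD (Δℂ p q) (ιˢ (logDΔ p q))
  logD-Δℂ p q k = ℂᴿ.trans (ℂᴿ.sym (ι-× k (Δ p q k)))
    (ℂᴿ.trans (ι-cong (logD-Δ p q k)) (ιˢ-* (logDΔ p q) (Δ p q) k))

  -- Since α⁻¹ = conj α, the series t / (t - α) is - Σ_{k > 0} (conj α)^k t^k.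
  logDlinear : 𝕋 → ℂ⟦t⟧.Carrier
  logDlinear α zero    = ℂ-Ring.0#
  logDlinear α (suc k) = ℂ-Ring.- point (pow (conj α) (suc k))

  α*conjα≈1 : ∀ α → point α ℂ-Ring.* conjℂ (point α) ℂ-Ring.≈ ℂ-Ring.1#
  α*conjα≈1 α = ≈-trans (solve 2 (λ a b → a :* a :- b :* (:- b) := a :* a :+ b :* b) ≈-refl (Re α) (im (point α))) (∣point∣≈1 α)
              , solve 2 (λ a b → a :* (:- b) :+ b :* a := con 0ℚ) ≈-refl (Re α) (im (point α))
    where open ℝ-Solver

  -- At index 1 the claim is α conj α = 1, and at higher indices (α conj α - 1) times a power
  -- vanishes. Here |α| = 1 supplies the inverse of α without a division.
  logD-linear : ∀ α → LogD (ℂ[t].linear (point α)) (logDlinear α)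
  logD-linear α k = ℂᴿ.trans (lemma k) (*ˢ-comm (ℂ[t].linear (point α)) (logDlinear α) k)
    where
    open ℂ-Solver
    a = point α
    lemma : ∀ k → D (ℂ[t].linear a) k ℂ-Ring.≈ (ℂ[t].linear a *ˢ logDlinear α) k
    lemma zero = ℂᴿ.sym (ℂᴿ.trans (ℂ[t].linear-*-0 a (logDlinear α)) (ℂᴿ.zeroʳ (ℂ-Ring.- a)))
    lemma (suc zero) = ℂᴿ.sym (ℂᴿ.trans (ℂ[t].linear-*-suc a (logDlinear α) 0) (ℂᴿ.trans
      (solve 2 (λ a c → con 0ℚ :+ (:- a) :* (:- (c :* con 1ℚ)) := a :* c) ℂᴿ.refl a (conjℂ a))
      (ℂᴿ.trans (α*conjα≈1 α) (solve 0 (con 1ℚ := (con 1ℚ :+ :- con 0ℚ) :+ con 0ℚ) ℂᴿ.refl))))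
    lemma (suc (suc k)) = ℂᴿ.trans
      (ℂᴿ.trans (×-congʳ (suc (suc k)) (ℂᴿ.-‿inverseʳ ℂ-Ring.0#)) (ℂ⟦t⟧ᴰ.×-zero (suc (suc k))))
      (ℂᴿ.sym (ℂᴿ.trans (ℂ[t].linear-*-suc a (logDlinear α) (suc k)) (ℂᴿ.trans
        (solve 3 (λ a c x → :- x :+ (:- a) :* (:- (c :* x)) := ((a :* c) :- con 1ℚ) :* x) ℂᴿ.refl a (conjℂ a) (point (pow (conj α) (suc k))))
        (ℂᴿ.trans (ℂᴿ.*-congʳ (ℂᴿ.trans (ℂᴿ.+-congʳ (α*conjα≈1 α)) (ℂᴿ.-‿inverseʳ ℂ-Ring.1#)))
          (ℂᴿ.zeroˡ _)))))

  logDroots : List 𝕋 → ℂ⟦t⟧.Carrier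
  logDroots []       = 0ˢ
  logDroots (α ∷ αs) = logDlinear α +ˢ logDroots αs

  rootProduct : List 𝕋 → ℂ⟦t⟧.Carrier
  rootProduct = foldr (λ α f → (t -ˢ constant (point α)) *ˢ f) 1ˢ

  logD-roots : ∀ αs → LogD (rootProduct αs) (logDroots αs)
  logD-roots []       = ℂ⟦t⟧ᴰ.LogD-1
  logD-roots (α ∷ αs) = ℂ⟦t⟧ᴰ.LogD-* {ℂ[t].linear (point α)} {rootProduct αs} {logDlinear α} {logDroots αs}
    (logD-linear α) (logD-roots αs)

  logDroots-suc : ∀ αs k → logDroots αs (suc k) ℂ-Ring.≈
    ((- ∑ αs (λ α → Re (pow (conj α) (suc k)))) +i (- ∑ αs (λ α → im (point (pow (conj α) (suc k))))))
  logDroots-suc []       k = pointwise (λ _ → refl) , pointwise (λ _ → refl)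
  logDroots-suc (α ∷ αs) k =
      ≈-trans (+-cong ≈-refl (proj₁ (logDroots-suc αs k))) (neg-+ _ _)
    , ≈-trans (+-cong ≈-refl (proj₂ (logDroots-suc αs k))) (neg-+ _ _)
    where
    open ℝ-Solver
    neg-+ : ∀ x y → - x + - y ≈ - (x + y)
    neg-+ = solve 2 (λ x y → :- x :+ :- y := :- (x :+ y)) ≈-refl

  -- All that the counting needs to know about the roots, so that multisets of roots and, for
  -- coprime pairs, sets of roots are treated alike. The conjugates come from the expansion of t /
  -- (t - α) in powers of t.
  record PowerSums (p q : ℕ) (αs : List 𝕋) : Set where
    field
      re-sum : ∀ k → ∑ αs (λ α → Re (pow (conj α) (suc k))) ≈ fromℤ (powerSum p q (suc k))
      im-sum : ∀ k → ∑ αs (λ α → im (point (pow (conj α) (suc k)))) ≈ 0ℝ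
  open PowerSums

  neg-injective : ∀ {x y} → - x ≈ - y → x ≈ y
  neg-injective {x} {y} p = ≈-trans (neg-neg x) (≈-trans (-‿cong p) (≈-sym (neg-neg y)))
    where
    open ℝ-Solver
    neg-neg : ∀ x → x ≈ - (- x)
    neg-neg = solve 1 (λ x → x := :- (:- x)) ≈-refl

  powerSums : ∀ p q .{{_ : NonZero p}} .{{_ : NonZero q}} {αs} → IsRootMultiset p q αs → PowerSums p q αs
  powerSums p q {αs} h = record
    { re-sum = λ k → neg-injective (≈-trans (≈-sym (proj₁ (logDroots-suc αs k))) (≈-trans (proj₁ (unique (suc k)))
        (≈-trans (proj₁ (ι-cong (logDΔ-powerSum p q k))) (fromℤ-neg (powerSum p q (suc k))))))
    ; im-sum = λ k → neg-injective (≈-trans (≈-sym (proj₂ (logDroots-suc αs k))) (≈-trans (proj₂ (unique (suc k)))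
        (pointwise λ _ → refl)))
    }
    where
    v = proj₁ (Δ-invertible p q)
    invertible : Δℂ p q *ˢ ιˢ v ≈ˢ 1ˢ
    invertible k = ℂᴿ.trans (ℂᴿ.sym (ιˢ-* (Δ p q) v k)) (ℂᴿ.trans (ι-cong (proj₂ (Δ-invertible p q) k)) (ιˢ-1 k))
    unique : logDroots αs ≈ˢ ιˢ (logDΔ p q)
    unique = ℂ⟦t⟧ᴰ.LogD-unique {Δℂ p q} {ιˢ v} {logDroots αs} {ιˢ (logDΔ p q)} invertible
      (ℂ⟦t⟧ᴰ.LogD-cong {rootProduct αs} {Δℂ p q} {logDroots αs} {logDroots αs} (λ k → ℂᴿ.sym (h k)) (λ _ → ℂᴿ.refl) (logD-roots αs))
      (logD-Δℂ p q)

  pow-· : ∀ u v k → point (pow (u · v) k) ℂ-Ring.≈ point (pow u k) ℂ-Ring.* point (pow v k)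
  pow-· u v zero    = solve 0 (con 1ℚ := con 1ℚ :* con 1ℚ) ℂᴿ.refl
    where open ℂ-Solver
  pow-· u v (suc k) = ℂᴿ.trans (ℂᴿ.*-congˡ {point (u · v)} (pow-· u v k))
    (solve 4 (λ u v x y → (u :* v) :* (x :* y) := (u :* x) :* (v :* y)) ℂᴿ.refl
      (point u) (point v) (point (pow u k)) (point (pow v k)))
    where open ℂ-Solver

  module _ {p q} .{{_ : NonZero p}} .{{_ : NonZero q}} {αs} (sums : PowerSums p q αs) where
    -- The k-th power sum of the conjugates is a real integer e, so rotation by u changes its real
    -- part to Re (u^k) e, and |Re (u^k)| is at most 1.
    ∣rotated-sum∣≤ : ∀ u k → 0 ℕ.< k →
      ∣ ∑ αs (λ α → Re (pow (u · conj α) k)) ∣ ≤ fromℕ (suc k ℕ.* suc k)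
    ∣rotated-sum∣≤ u k@(suc k-1) _ = begin
      ∣ ∑ αs (λ α → Re (pow (u · conj α) k)) ∣
        ≈⟨ ∣∣-cong (∑-cong αs λ α → proj₁ (pow-· u (conj α) k)) ⟩
      ∣ ∑ αs (λ α → x * Re (pow (conj α) k) - y * im (point (pow (conj α) k))) ∣
        ≈⟨ ∣∣-cong (≈-trans (∑-+ αs _ _) (+-cong (∑-*ˡ αs x _) (≈-trans (∑-neg αs _) (-‿cong (∑-*ˡ αs y _))))) ⟩
      ∣ x * ∑ αs (λ α → Re (pow (conj α) k)) - y * ∑ αs (λ α → im (point (pow (conj α) k))) ∣
        ≈⟨ ∣∣-cong (+-cong (*-cong ≈-refl (re-sum sums k-1)) (-‿cong (*-cong ≈-refl (im-sum sums k-1)))) ⟩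
      ∣ x * e - y * 0ℝ ∣
        ≈⟨ ∣∣-cong (solve 3 (λ x y e → x :* e :- y :* con 0ℚ := x :* e) ≈-refl x y e) ⟩
      ∣ x * e ∣
        ≈⟨ ∣xy∣≈ x e ⟩
      ∣ x ∣ * ∣ e ∣
        ≤⟨ *-mono-≤ (0≤∣x∣ x) (0≤fromℕ (suc k ℕ.* suc k)) (∣Re∣≤1 (pow u k)) (∣fromℤ∣≤ (powerSum p q k) (∣powerSum∣≤ p q k)) ⟩
      1ℝ * fromℕ (suc k ℕ.* suc k)
        ≈⟨ ℝ-Ring.*-identityˡ _ ⟩
      fromℕ (suc k ℕ.* suc k) ∎
      where
      open ≤-Reasoning
      open ℝ-Solver
      x = Re (pow u k)
      y = im (point (pow u k))
      e = fromℤ (powerSum p q k)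

    degree≤length : (p ℕ.∸ 1) ℕ.* (q ℕ.∸ 1) ℕ.≤ length αs
    degree≤length = fromℕ-reflects-≤ {(p ℕ.∸ 1) ℕ.* (q ℕ.∸ 1)} {length αs} (begin
      fromℤ (ℤ.+ ((p ℕ.∸ 1) ℕ.* (q ℕ.∸ 1)))             ≈⟨ proj₁ (ι-cong (powerSum-pq p q)) ⟨
      fromℤ (powerSum p q (p ℕ.* q))                    ≈⟨ sum-pq (p ℕ.* q) {{ℕ.m*n≢0 p q}} ⟨
      ∑ αs (λ α → Re (pow (conj α) (p ℕ.* q)))          ≤⟨ ∑-mono αs (λ α → Re≤1 (pow (conj α) (p ℕ.* q))) ⟩
      ∑ αs (λ _ → 1ℝ)                                   ≈⟨ ∑-const αs 1ℝ ⟩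
      size αs * 1ℝ                                      ≈⟨ ℝ-Ring.*-identityʳ _ ⟩
      size αs                                           ∎)
      where
      open ≤-Reasoning
      sum-pq : ∀ k .{{_ : NonZero k}} → ∑ αs (λ α → Re (pow (conj α) k)) ≈ fromℤ (powerSum p q k)
      sum-pq (suc k) = re-sum sums k

  -- Simple roots for coprime pairs, and the passage to root sets

  private
    module 𝕊ᶻ = ℤ⟦t⟧ᴰ.𝕊
    module 𝕊ᶜ = ℂ⟦t⟧ᴰ.𝕊
    module Z = ℤ⟦t⟧
  open ℂ[t] hiding (degree≤)

  -- If |x| were at least ε / 2, its square would be at least ε^2 / 4 > 0. The other alternative of
  -- `≤-cotrans` gives |x| ≤ ε for every ε.
  square≈0 : ∀ {x} → x * x ≤ 0ℝ → x ≈ 0ℝ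
  square≈0 {x} h = ≤-antisym (∣x∣≤⇒x≤ ∣x∣≤0)
    (≤-trans (≤⇒0≤ (∣x∣≤⇒-x≤ ∣x∣≤0)) (≤-reflexive (solve 1 (λ x → con 0ℚ :- :- x := x) ≈-refl x)))
    where
    open ℝ-Solver
    approximate : ∀ ε .{{_ : Positive ε}} → ∣ x ∣ ≤ fromℚ ε ⊎ fromℚ (½ ℚ.* ε) ≤ ∣ x ∣ → ∣ x ∣ ≤ 0ℝ + fromℚ ε
    approximate ε (inj₁ h′) = ≤-trans h′ (≤-reflexive (≈-sym (ℝ-Ring.+-identityˡ _)))
    approximate ε (inj₂ h′) = contradiction
      (fromℚ-reflects-≤ {½ ℚ.* ε ℚ.* (½ ℚ.* ε)} {0ℚ} (≤-trans (≤-trans (≤-reflexive (pointwise λ _ → refl))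
        (*-mono-≤ {fromℚ (½ ℚ.* ε)} {∣ x ∣} {fromℚ (½ ℚ.* ε)} {∣ x ∣} (fromℚ-mono {0ℚ} {½ ℚ.* ε} (pos {½ ℚ.* ε} {{½⁺ ε}})) (0≤∣x∣ x) h′ h′))
        (≤-trans (≤-reflexive (≈-trans (≈-sym (∣xy∣≈ x x)) (0≤⇒∣x∣≈x (0≤x² x)))) h)))
      (λ q → ℚ.<-irrefl refl (ℚ.<-≤-trans (ℚ.positive⁻¹ (½ ℚ.* ε ℚ.* (½ ℚ.* ε)) {{ℚ.pos*pos⇒pos (½ ℚ.* ε) {{½⁺ ε}} (½ ℚ.* ε) {{½⁺ ε}}}}) q))
    ∣x∣≤0 : ∣ x ∣ ≤ 0ℝ
    ∣x∣≤0 = ≤-limit λ ε → approximate ε (≤-cotrans ∣ x ∣ (½p<p ε))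

  ∣z∣²≈0⇒z≈0 : ∀ {z} → ∣ z ∣² ≈ 0ℝ → z ℂ-Ring.≈ ℂ-Ring.0#
  ∣z∣²≈0⇒z≈0 {z} h =
      square≈0 (≤-trans (≤-trans (≤-reflexive (≈-sym (ℝ-Ring.+-identityʳ _))) (+-mono-≤ ≤-refl (0≤x² (im z)))) (≤-reflexive h))
    , square≈0 (≤-trans (≤-trans (≤-reflexive (≈-sym (ℝ-Ring.+-identityˡ _))) (+-mono-≤ (0≤x² (re z)) ≤-refl)) (≤-reflexive h))

  -- A complex number that is merely not zero need not have an inverse constructively. Instead,
  -- |z|^2 bounded below by a positive rational would force |w|^2 = 0, so |z|^2 is at most every
  -- positive ε.
  cancel-nonzero : ∀ {z w} → z ℂ-Ring.* w ℂ-Ring.≈ ℂ-Ring.0# → ¬ (w ℂ-Ring.≈ ℂ-Ring.0#) → z ℂ-Ring.≈ ℂ-Ring.0#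
  cancel-nonzero {z} {w} zw≈0 w≉0 = ∣z∣²≈0⇒z≈0 (≤-antisym (≤-limit λ ε → approximate ε (≤-cotrans x (½p<p ε))) (0≤∣z∣² z))
    where
    x = ∣ z ∣²
    y = ∣ w ∣²
    xy≈0 : x * y ≈ 0ℝ
    xy≈0 = ≈-trans (≈-sym (∣zw∣² z w)) (≈-trans (∣∣²-cong zw≈0) (pointwise λ _ → refl))
    y≈0 : ∀ q .{{_ : Positive q}} → fromℚ q ≤ x → y ≈ 0ℝ
    y≈0 q q≤x = ≤-antisym (begin
      y                              ≈⟨ ℝ-Ring.*-identityˡ y ⟨
      1ℝ * y                         ≈⟨ *-cong {1ℝ} {fromℚ r * fromℚ q} (pointwise λ _ → ≡.sym (ℚ.*-inverseˡ q {{ℚ.pos⇒nonZero q}})) ≈-refl ⟩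
      (fromℚ r * fromℚ q) * y        ≤⟨ *-mono-≤ {fromℚ r * fromℚ q} {fromℚ r * x} (0≤* 0≤r (fromℚ-mono {0ℚ} {q} (pos {q}))) (0≤∣z∣² w) (*-monoˡ-≤ 0≤r q≤x) ≤-refl ⟩
      (fromℚ r * x) * y              ≈⟨ ≈-trans (ℝ-Ring.*-assoc (fromℚ r) x y) (*-cong ≈-refl xy≈0) ⟩
      fromℚ r * 0ℝ                   ≈⟨ ℝ-Ring.zeroʳ _ ⟩
      0ℝ                             ∎) (0≤∣z∣² w)
      where
      open ≤-Reasoning
      r = (ℚ.1/ q) {{ℚ.pos⇒nonZero q}}
      0≤r : 0ℝ ≤ fromℚ r
      0≤r = fromℚ-mono {0ℚ} {r} (pos {r} {{ℚ.1/pos⇒pos q}})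
    approximate : ∀ ε .{{_ : Positive ε}} → x ≤ fromℚ ε ⊎ fromℚ (½ ℚ.* ε) ≤ x → x ≤ 0ℝ + fromℚ ε
    approximate ε (inj₁ h) = ≤-trans h (≤-reflexive (≈-sym (ℝ-Ring.+-identityˡ _)))
    approximate ε (inj₂ h) = contradiction (∣z∣²≈0⇒z≈0 (y≈0 (½ ℚ.* ε) {{½⁺ ε}} h)) w≉0

  infix 4 _≈ᵀ_
  _≈ᵀ_ : 𝕋 → 𝕋 → Set
  _≈ᵀ_ = Setoid._≈_ 𝕋-setoid

  valueAt : List 𝕋 → ℂ → ℂ
  valueAt αs z = foldr (λ a x → (z ℂ-Ring.+ ℂ-Ring.- a) ℂ-Ring.* x) ℂ-Ring.1# (map point αs)

  valueAt-root : ∀ {z αs} → Any (λ α → z ℂ-Ring.≈ point α) αs → valueAt αs z ℂ-Ring.≈ ℂ-Ring.0#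
  valueAt-root {z} {α ∷ αs} (here p) = ℂᴿ.trans
    (ℂᴿ.*-congʳ {valueAt αs z} (ℂᴿ.trans (ℂᴿ.+-congʳ { ℂ-Ring.- point α} p) (ℂᴿ.-‿inverseʳ (point α)))) (ℂᴿ.zeroˡ (valueAt αs z))
  valueAt-root {z} {α ∷ αs} (there h) = ℂᴿ.trans (ℂᴿ.*-congˡ {z ℂ-Ring.+ ℂ-Ring.- point α} (valueAt-root h)) (ℂᴿ.zeroʳ _)

  valueAt-nonroot : ∀ {z} αs → ¬ Any (λ α → z ℂ-Ring.≈ point α) αs → ¬ (valueAt αs z ℂ-Ring.≈ ℂ-Ring.0#)
  valueAt-nonroot []       _    v≈0 = 1≉0 (proj₁ v≈0)
  valueAt-nonroot {z} (α ∷ αs) none v≈0 = none (here (z-α≈0⇒z≈α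
    (cancel-nonzero v≈0 (valueAt-nonroot αs λ h → none (there h)))))
    where
    z-α≈0⇒z≈α : z ℂ-Ring.+ ℂ-Ring.- point α ℂ-Ring.≈ ℂ-Ring.0# → z ℂ-Ring.≈ point α
    z-α≈0⇒z≈α p = ℂᴿ.trans (solve 2 (λ z a → z := (z :+ :- a) :+ a) ℂᴿ.refl z (point α))
      (ℂᴿ.trans (ℂᴿ.+-congʳ {point α} p) (ℂᴿ.+-identityˡ (point α)))
      where open ℂ-Solver

  fromRoots≡rootProduct : ∀ αs → fromRoots (map point αs) ≡ rootProduct αs
  fromRoots≡rootProduct []       = refl
  fromRoots≡rootProduct (α ∷ αs) = cong (linear (point α) *ˢ_) (fromRoots≡rootProduct αs)

  monic-rootProduct : ∀ αs → Monic (length αs) (rootProduct αs)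
  monic-rootProduct αs = ≡.subst₂ Monic (length-map point αs) (fromRoots≡rootProduct αs) (monic-fromRoots (map point αs))

  eval-rootProduct : ∀ αs z → eval (length αs) (rootProduct αs) z ℂ-Ring.≈ valueAt αs z
  eval-rootProduct αs z = ≡.subst₂ (λ n f → eval n f z ℂ-Ring.≈ valueAt αs z) (length-map point αs) (fromRoots≡rootProduct αs)
    (eval-fromRoots (map point αs) z)

  ι-monic : ∀ {n f} → ℤ[t].Monic n f → Monic n (ιˢ f)
  ι-monic (ℤ[t].monic l d) = monic (ι-cong l) λ k n<k → ι-cong (d k n<k)

  1ᶜ≉0 : ¬ (ℂ-Ring.1# ℂ-Ring.≈ ℂ-Ring.0#)
  1ᶜ≉0 (p , _) = 1≉0 p

  module _ (p q : ℕ) .{{p≢0 : NonZero p}} .{{q≢0 : NonZero q}} {αs} (isRoots : IsRootMultiset p q αs) where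
    private
      instance
        L≢0 : NonZero (lcm p q)
        L≢0 = lcm-nonZero p q

    -- Evaluation in `IsRootSet` runs up to `degΔ`, so the number of roots must match it exactly.
    -- Both sides of `Δ-quotient` are monic, and comparing degrees gives length + p + q = p q + 1.
    length≡degree : length αs ≡ degΔ p q
    length≡degree = arithmetic p q (monic-unique 1ᶜ≉0
      (monic-cong product (monic-* (monic-rootProduct αs) (ι-monic (ℤ[t].monic-* (ℤ[t].monic-t^-1 p) (ℤ[t].monic-t^-1 q)))))
      (ι-monic (ℤ[t].monic-* (ℤ[t].monic-^ (gcd p q) (ℤ[t].monic-t^-1 (lcm p q))) (ℤ[t].monic-t^-1 1))))
      where
      W = t^[ p ]-1 Z.*ˢ t^[ q ]-1
      product : rootProduct αs *ˢ ιˢ W ≈ˢ ιˢ (t^[ lcm p q ]-1 Z.^ˢ gcd p q Z.*ˢ t^[ 1 ]-1)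
      product = 𝕊ᶜ.trans (ℂ⟦t⟧ᴰ.congʳ (ιˢ W) (𝕊ᶜ.sym {Δℂ p q} {rootProduct αs} isRoots))
        (𝕊ᶜ.trans (𝕊ᶜ.sym (ιˢ-* (Δ p q) W)) (λ k → ι-cong (Δ-quotient p q k)))
      arithmetic : ∀ p q .{{_ : NonZero p}} .{{_ : NonZero q}} →
        length αs ℕ.+ (p ℕ.+ q) ≡ gcd p q ℕ.* lcm p q ℕ.+ 1 → length αs ≡ degΔ p q
      arithmetic (suc i) (suc j) e = ℕ.+-cancelʳ-≡ (suc i ℕ.+ suc j) (length αs) (i ℕ.* j) (≡.trans e
        (≡.trans (cong (ℕ._+ 1) (gcd*lcm (suc i) (suc j)))
          (solve 2 (λ i j → (con 1 :+ i) :* (con 1 :+ j) :+ con 1 := i :* j :+ ((con 1 :+ i) :+ (con 1 :+ j))) refl i j)))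
        where open ℕSolver

    eval-Δ : ∀ z → eval (degΔ p q) (Δℂ p q) z ℂ-Ring.≈ valueAt αs z
    eval-Δ z = ℂᴿ.trans (eval-cong (degΔ p q) z isRoots)
      (subst (λ n → eval n (rootProduct αs) z ℂ-Ring.≈ valueAt αs z) length≡degree (eval-rootProduct αs z))

  private
    module Sᶜ = Algebra.Solver.Ring.NaturalCoefficients.Default 𝕊ᶜ.commutativeSemiring
    module Sᶻ = Algebra.Solver.Ring.NaturalCoefficients.Default 𝕊ᶻ.commutativeSemiring
  open UniqueSetoid 𝕋-setoid using (Unique)
  private module T = Setoid 𝕋-setoid

  linear-cong : ∀ {a b} → a ℂ-Ring.≈ b → linear a ≈ˢ linear b
  linear-cong p zero    = ℂᴿ.+-congˡ (ℂᴿ.-‿cong p)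
  linear-cong p (suc k) = ℂᴿ.refl

  factor : ∀ {α αs} → Any (α ≈ᵀ_) αs →
           ∃ λ G → ∃ λ n → Degree≤ n G × rootProduct αs ≈ˢ linear (point α) *ˢ G
  factor {α} {β ∷ αs} (here p)  = rootProduct αs , length αs , Monic.degree≤ (monic-rootProduct αs) ,
    ℂ⟦t⟧ᴰ.congʳ (rootProduct αs) (linear-cong {point β} {point α} (T.sym {α} {β} p))
  factor {α} {β ∷ αs} (there h) = let (G , n , d , e) = factor {α} {αs} h in
    linear (point β) *ˢ G , 1 ℕ.+ n , degree≤-* (Monic.degree≤ (monic-linear (point β))) d ,
    𝕊ᶜ.trans (ℂ⟦t⟧ᴰ.congˡ (linear (point β)) e)
      (Sᶜ.solve 3 (λ a b g → b Sᶜ.:* (a Sᶜ.:* g) Sᶜ.:= a Sᶜ.:* (b Sᶜ.:* g)) 𝕊ᶜ.refl (linear (point α)) (linear (point β)) G)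

  -- The degree bound keeps the cofactor a polynomial: among series, t - a is itself invertible when
  -- a is a unit, and divisibility by it would say nothing.
  SquareFree : Carrier → Set
  SquareFree F = ∀ a n G → Degree≤ n G → ¬ (F ≈ˢ linear a *ˢ (linear a *ˢ G))

  -- P collects the factors already passed.
  squareFree⇒unique : ∀ αs {F P n} → SquareFree F → Degree≤ n P → F ≈ˢ P *ˢ rootProduct αs → Unique αs
  squareFree⇒unique []       _ _ _ = []
  squareFree⇒unique (α ∷ αs) {F} {P} {n} sf d e =
    ¬Any⇒All¬ αs repeated ∷ squareFree⇒unique αs {F} {P *ˢ l} {n ℕ.+ 1} sf
      (degree≤-* d (Monic.degree≤ (monic-linear (point α)))) (𝕊ᶜ.trans e (𝕊ᶜ.sym (*ˢ-assoc P l (rootProduct αs))))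
    where
    l = linear (point α)
    repeated : ¬ Any (α ≈ᵀ_) αs
    repeated h = let (G , m , d′ , e′) = factor {α} {αs} h in
      sf (point α) (n ℕ.+ m) (P *ˢ G) (degree≤-* d d′) (𝕊ᶜ.trans e (𝕊ᶜ.trans (ℂ⟦t⟧ᴰ.congˡ P (ℂ⟦t⟧ᴰ.congˡ l e′))
        (Sᶜ.solve 3 (λ p l g → p Sᶜ.:* (l Sᶜ.:* (l Sᶜ.:* g)) Sᶜ.:= l Sᶜ.:* (l Sᶜ.:* (p Sᶜ.:* g))) 𝕊ᶜ.refl P l G)))

  ιˢ-t^-1 : ∀ n → ιˢ t^[ n ]-1 ≈ˢ t ^ˢ n -ˢ 1ˢ
  ιˢ-t^-1 n k = ℂᴿ.trans (ι-+ ((Z.t Z.^ˢ n) k) (ℤ.- Z.1ˢ k))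
    (ℂᴿ.+-cong (power n k) (ℂᴿ.trans (ι-neg (Z.1ˢ k)) (ℂᴿ.-‿cong (ιˢ-1 k))))
    where
    ιˢ-t : ιˢ Z.t ≈ˢ t
    ιˢ-t zero          = ℂᴿ.refl
    ιˢ-t (suc zero)    = ℂᴿ.refl
    ιˢ-t (suc (suc k)) = ℂᴿ.refl
    power : ∀ n → ιˢ (Z.t Z.^ˢ n) ≈ˢ t ^ˢ n
    power zero    = ιˢ-1
    power (suc n) = 𝕊ᶜ.trans (ιˢ-* Z.t (Z.t Z.^ˢ n)) (*ˢ-cong ιˢ-t (power n))

  [t^n-1]/[t-1] : ℕ → Z.Carrier
  [t^n-1]/[t-1] n = t^[ n ]-1 Z.*ˢ 1/[t^ 1 -1]

  -- All coefficients of 1 / (t - 1) are -1, so beyond n the series and its shift by n cancel. The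
  -- sharp bound n - 1 is of no concern, since only finiteness of the degree matters later.
  degree≤-[t^n-1]/[t-1] : ∀ n → ℤ[t].Degree≤ n ([t^n-1]/[t-1] n)
  degree≤-[t^n-1]/[t-1] n k n<k = subst (λ k → [t^n-1]/[t-1] n k ≡ ℤ.0ℤ) (ℕ.m+[n∸m]≡n (ℕ.<⇒≤ n<k)) (begin
    [t^n-1]/[t-1] n (n ℕ.+ j)
      ≡⟨ SeriesRing.*ˢ-distribʳ ℤ.+-*-commutativeRing v (Z.t Z.^ˢ n) (Z.-ˢ Z.1ˢ) (n ℕ.+ j) ⟩
    (Z.t Z.^ˢ n Z.*ˢ v) (n ℕ.+ j) ℤ.+ ((Z.-ˢ Z.1ˢ) Z.*ˢ v) (n ℕ.+ j)
      ≡⟨ ≡.cong₂ ℤ._+_ (ℤ⟦t⟧ᴰ.t^-* n v j) (neg-1 (n ℕ.+ j)) ⟩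
    v j ℤ.+ ℤ.- v (n ℕ.+ j)
      ≡⟨ ≡.cong₂ (λ x y → x ℤ.+ ℤ.- y) (1/t^n-1-∣ {1} {j} (ℕ.1∣ j)) (1/t^n-1-∣ {1} {n ℕ.+ j} (ℕ.1∣ (n ℕ.+ j))) ⟩
    ℤ.0ℤ ∎)
    where
    open ≡.≡-Reasoning
    j = k ℕ.∸ n
    v = 1/[t^ 1 -1]
    open import Algebra.Properties.Ring 𝕊ᶻ.ring using (-‿distribˡ-*)
    neg-1 : (Z.-ˢ Z.1ˢ) Z.*ˢ v Z.≈ˢ Z.-ˢ v
    neg-1 = 𝕊ᶻ.trans (𝕊ᶻ.sym (-‿distribˡ-* Z.1ˢ v)) (𝕊ᶻ.-‿cong (SeriesRing.1ˢ-*ˢ ℤ.+-*-commutativeRing v))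

  module _ (p q : ℕ) .{{p≢0 : NonZero p}} .{{q≢0 : NonZero q}} (coprime : gcd p q ≡ 1) where
    private
      L = lcm p q
      W = t^[ p ]-1 Z.*ˢ [t^n-1]/[t-1] q
      instance
        L≢0 : NonZero L
        L≢0 = lcm-nonZero p q

    -- For gcd 1 the numerator in `Δ-quotient` is (t^L - 1)(t - 1). Replacing t^q - 1 by its
    -- quotient by t - 1 removes the second factor and leaves a polynomial cofactor.
    Δ-divides : Δ p q Z.*ˢ W Z.≈ˢ t^[ L ]-1
    Δ-divides = S.begin
      Δ p q Z.*ˢ (a Z.*ˢ (b Z.*ˢ v))             S.≈⟨ Sᶻ.solve 4 (λ d a b v → d Sᶻ.:* (a Sᶻ.:* (b Sᶻ.:* v)) Sᶻ.:=
                                                      d Sᶻ.:* (a Sᶻ.:* b) Sᶻ.:* v) 𝕊ᶻ.refl (Δ p q) a b v ⟩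
      Δ p q Z.*ˢ (a Z.*ˢ b) Z.*ˢ v               S.≈⟨ ℤ⟦t⟧ᴰ.congʳ v (Δ-quotient p q) ⟩
      (u Z.^ˢ gcd p q Z.*ˢ t^[ 1 ]-1) Z.*ˢ v     S.≈⟨ SeriesRing.*ˢ-assoc ℤ.+-*-commutativeRing (u Z.^ˢ gcd p q) t^[ 1 ]-1 v ⟩
      u Z.^ˢ gcd p q Z.*ˢ (t^[ 1 ]-1 Z.*ˢ v)     S.≈⟨ ℤ⟦t⟧ᴰ.congˡ (u Z.^ˢ gcd p q) (t^n-1-invertible 1) ⟩
      u Z.^ˢ gcd p q Z.*ˢ Z.1ˢ                   S.≈⟨ 𝕊ᶻ.*-identityʳ (u Z.^ˢ gcd p q) ⟩
      u Z.^ˢ gcd p q                             S.≈⟨ (λ k → cong (λ n → (u Z.^ˢ n) k) coprime) ⟩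
      u Z.*ˢ Z.1ˢ                                S.≈⟨ 𝕊ᶻ.*-identityʳ u ⟩
      u                                          S.∎
      where
      open ℤ⟦t⟧ᴰ using (module S)
      a = t^[ p ]-1
      b = t^[ q ]-1
      u = t^[ L ]-1
      v = 1/[t^ 1 -1]

    squareFree-Δ : SquareFree (Δℂ p q)
    squareFree-Δ a n G d e = ℕ.≢-nonZero⁻¹ L (ℕ.n≤0⇒n≡0 (fromℕ-reflects-≤ {L} {0} (≤-reflexive (proj₁ L≈0))))
      where
      w = ιˢ W
      l = linear a
      degree-W : Degree≤ (p ℕ.+ q) w
      degree-W k h = ι-cong (ℤ[t].degree≤-* (ℤ[t].Monic.degree≤ (ℤ[t].monic-t^-1 p)) (degree≤-[t^n-1]/[t-1] q) k h)
      double : t ^ˢ L -ˢ 1ˢ ≈ˢ l *ˢ (l *ˢ (G *ˢ w))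
      double = 𝕊ᶜ.trans (𝕊ᶜ.sym (ιˢ-t^-1 L)) (𝕊ᶜ.trans (λ k → ι-cong (≡.sym (Δ-divides k)))
        (𝕊ᶜ.trans (ιˢ-* (Δ p q) W) (𝕊ᶜ.trans (ℂ⟦t⟧ᴰ.congʳ w e)
          (Sᶜ.solve 3 (λ l g w → (l Sᶜ.:* (l Sᶜ.:* g)) Sᶜ.:* w Sᶜ.:= l Sᶜ.:* (l Sᶜ.:* (g Sᶜ.:* w))) 𝕊ᶜ.refl l G w))))
      L≈0 : ι (ℤ.+ L) ℂ-Ring.≈ ℂ-Ring.0#
      L≈0 = ℂᴿ.trans (ι-cong (≡.sym (≡.trans (×ᶻ≡* L ℤ.1ℤ) (ℤ.*-identityʳ (ℤ.+ L)))))
        (ℂᴿ.trans (ι-× L ℤ.1ℤ) (t^-1-squarefree L {a} {n ℕ.+ (p ℕ.+ q)} {G *ˢ w} (degree≤-* d degree-W) double))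

  private module _ {α : 𝕋} where
    ∑-─ : ∀ (g : 𝕋 → ℝ) → (∀ {β γ} → β ≈ᵀ γ → g β ≈ g γ) → ∀ {βs} (i : Any (α ≈ᵀ_) βs) → ∑ βs g ≈ g α + ∑ (βs ─ i) g
    ∑-─ g resp {β ∷ βs} (here p)  = +-cong (≈-sym (resp {α} {β} p)) ≈-refl
    ∑-─ g resp {β ∷ βs} (there i) = ≈-trans (+-cong ≈-refl (∑-─ g (λ {β} {γ} → resp {β} {γ}) i))
      (solve 3 (λ x y z → x :+ (y :+ z) := y :+ (x :+ z)) ≈-refl (g β) (g α) (∑ (βs ─ i) g))
      where open ℝ-Solver

    All-─ : ∀ {P : 𝕋 → Set} {βs} (i : Any (α ≈ᵀ_) βs) → All P βs → All P (βs ─ i)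
    All-─ (here _)  (_ ∷ ps) = ps
    All-─ (there i) (p ∷ ps) = p ∷ All-─ i ps

    Unique-─ : ∀ {βs} (i : Any (α ≈ᵀ_) βs) → Unique βs → Unique (βs ─ i)
    Unique-─ (here _)  (_ ∷ u) = u
    Unique-─ (there i) (p ∷ u) = All-─ i p ∷ Unique-─ i u

    removed : ∀ {βs} (i : Any (α ≈ᵀ_) βs) → Unique βs → All (λ β → ¬ β ≈ᵀ α) (βs ─ i)
    removed {β ∷ βs} (here p)  (β∉ ∷ _) = All.map (λ {γ} β≉γ γ≈α → β≉γ (T.trans {β} {α} {γ} (T.sym {α} {β} p) (T.sym {γ} {α} γ≈α))) β∉
    removed {β ∷ βs} (there i) (β∉ ∷ u) = (λ β≈α → All.lookupAny β∉ i .proj₁ (T.trans {β} {α} {Any.lookup i} β≈α (All.lookupAny β∉ i .proj₂)))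
      ∷ removed i u

    Any-─ : ∀ {γ βs} (i : Any (α ≈ᵀ_) βs) → ¬ γ ≈ᵀ α → Any (γ ≈ᵀ_) βs → Any (γ ≈ᵀ_) (βs ─ i)
    Any-─ {γ} {β ∷ βs} (here p)  γ≉α (here q)  = contradiction (T.trans {γ} {β} {α} q (T.sym {α} {β} p)) γ≉α
    Any-─ (here p)  γ≉α (there j) = j
    Any-─ (there i) γ≉α (here q)  = here q
    Any-─ {γ} (there i) γ≉α (there j) = there (Any-─ {γ} i γ≉α j)

  -- Each α is removed from βs together with its match. The reverse inclusion may be doubly negated
  -- because it serves only to refute an element left in βs once αs is exhausted.
  ∑-match : ∀ (g : 𝕋 → ℝ) → (∀ {β γ} → β ≈ᵀ γ → g β ≈ g γ) → ∀ αs βs → Unique αs → Unique βs →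
    All (λ α → Any (α ≈ᵀ_) βs) αs → All (λ β → ¬ ¬ Any (β ≈ᵀ_) αs) βs → ∑ αs g ≈ ∑ βs g
  ∑-match g resp []       []       _ _ _ _ = ≈-refl
  ∑-match g resp []       (β ∷ βs) _ _ _ (h ∷ _) = contradiction (λ ()) h
  ∑-match g resp (α ∷ αs) βs (α∉ ∷ uα) uβ (i ∷ α⊆β) β⊆α = ≈-trans
    (+-cong ≈-refl (∑-match g (λ {β} {γ} → resp {β} {γ}) αs (βs ─ i) uα (Unique-─ {α} i uβ)
      (All.zipWith (λ {γ} (α≉γ , j) → Any-─ {α} {γ} i (λ γ≈α → α≉γ (T.sym {γ} {α} γ≈α)) j) (α∉ , α⊆β))
      (All.zipWith (λ (β≉α , h) none → h λ { (here β≈α) → β≉α β≈α ; (there j) → none j }) (removed {α} i uβ , All-─ {α} i β⊆α))))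
    (≈-sym (∑-─ {α} g (λ {β} {γ} → resp {β} {γ}) i))

  rootSet-powerSums : ∀ p q .{{_ : NonZero p}} .{{_ : NonZero q}} → gcd p q ≡ 1 → ∀ {αs βs} →
    IsRootMultiset p q αs → IsRootSet p q βs → PowerSums p q βs
  rootSet-powerSums p q coprime {αs} {βs} isRoots isRootSet = record
    { re-sum = λ k → ≈-trans (≈-sym (match λ {β} {γ} e → proj₁ (pow-cong {conj β} {conj γ} (suc k) (conj-cong {β} {γ} e)))) (PowerSums.re-sum sums k)
    ; im-sum = λ k → ≈-trans (≈-sym (match λ {β} {γ} e → proj₂ (pow-cong {conj β} {conj γ} (suc k) (conj-cong {β} {γ} e)))) (PowerSums.im-sum sums k)
    }
    where
    open IsRootSet isRootSet
    sums : PowerSums p q αs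
    sums = powerSums p q {αs} isRoots
    conj-cong : ∀ {β γ : 𝕋} → β ≈ᵀ γ → point (conj β) ℂ-Ring.≈ point (conj γ)
    conj-cong (e , e′) = e , -‿cong e′
    unique : Unique αs
    unique = squareFree⇒unique αs {Δℂ p q} {1ˢ} (squareFree-Δ p q coprime) degree≤-1
      (𝕊ᶜ.trans isRoots (𝕊ᶜ.sym (1ˢ-*ˢ (rootProduct αs))))
    root⇒∈ : ∀ {α} → Any (α ≈ᵀ_) αs → Any (α ≈ᵀ_) βs
    root⇒∈ {α} h = Equivalence.to (roots (point α)) (ℂᴿ.trans (eval-Δ p q {αs} isRoots (point α)) (valueAt-root {point α} {αs} h))
    -- A vanishing product does not tell which factor vanishes, so membership in αs is obtained only
    -- under double negation.
    ∈⇒root : ∀ {β} → Any (β ≈ᵀ_) βs → ¬ ¬ Any (β ≈ᵀ_) αs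
    ∈⇒root {β} h none = valueAt-nonroot αs none
      (ℂᴿ.trans (ℂᴿ.sym (eval-Δ p q {αs} isRoots (point β))) (Equivalence.from (roots (point β)) h))
    self : ∀ γs → All (λ γ → Any (γ ≈ᵀ_) γs) γs
    self []       = []
    self (γ ∷ γs) = here (T.refl {γ}) ∷ All.map there (self γs)
    match : ∀ {g : 𝕋 → ℝ} → (∀ {β γ} → β ≈ᵀ γ → g β ≈ g γ) → ∑ αs g ≈ ∑ βs g
    match {g} resp = ∑-match g (λ {β} {γ} → resp {β} {γ}) αs βs unique distinct
      (All.map (λ {α} → root⇒∈ {α}) (self αs)) (All.map (λ {β} → ∈⇒root {β}) (self βs))

open Roots

-- Counting

open import Data.Nat.ListAction using (sum)

grid : ℕ → List (ℕ × ℕ)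
grid Y = cartesianProduct (applyUpTo suc Y) (applyUpTo suc Y)

Coprime? : (pq : ℕ × ℕ) → _
Coprime? (p , q) = gcd p q ℕ.≟ 1

weight coprimeWeight : ℕ × ℕ → ℕ
weight (p , q) = degΔ p q
coprimeWeight pq = if does (Coprime? pq) then weight pq else 0

total : (ℕ × ℕ → ℕ) → List (ℕ × ℕ) → ℕ
total w ps = sum (map w ps)

total-coprime≤ : ∀ ps → total coprimeWeight ps ℕ.≤ total weight ps
total-coprime≤ []       = z≤n
total-coprime≤ (pq ∷ ps) with does (Coprime? pq)
... | true  = ℕ.+-monoʳ-≤ (weight pq) (total-coprime≤ ps)
... | false = ℕ.≤-trans (total-coprime≤ ps) (ℕ.m≤n+m _ (weight pq))

total-filter : ∀ ps → total coprimeWeight ps ≡ total weight (filter Coprime? ps)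
total-filter []        = refl
total-filter (pq ∷ ps) with does (Coprime? pq)
... | true  = cong (weight pq ℕ.+_) (total-filter ps)
... | false = total-filter ps

total-cartesianProduct : ∀ w xs ys →
  total w (cartesianProduct xs ys) ≡ sum (map (λ x → sum (map (λ y → w (x , y)) ys)) xs)
total-cartesianProduct w []       ys = refl
total-cartesianProduct w (x ∷ xs) ys = begin
  sum (map w (map (x ,_) ys ++ cartesianProduct xs ys))
    ≡⟨ cong sum (map-++ w (map (x ,_) ys) (cartesianProduct xs ys)) ⟩
  sum (map w (map (x ,_) ys) ++ map w (cartesianProduct xs ys))
    ≡⟨ ℕ.sum-++ (map w (map (x ,_) ys)) _ ⟩
  sum (map w (map (x ,_) ys)) ℕ.+ total w (cartesianProduct xs ys)
    ≡⟨ ≡.cong₂ (λ zs n → sum zs ℕ.+ n) (≡.sym (map-∘ ys)) (total-cartesianProduct w xs ys) ⟩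
  sum (map (λ y → w (x , y)) ys) ℕ.+ sum (map (λ x → sum (map (λ y → w (x , y)) ys)) xs) ∎
  where open ≡.≡-Reasoning

term≤sum : ∀ (f g : ℕ → ℕ) {i n} → i ℕ.< n → f (g i) ℕ.≤ sum (map f (applyUpTo g n))
term≤sum f g {zero}  {suc n} _         = ℕ.m≤m+n (f (g 0)) _
term≤sum f g {suc i} {suc n} (s≤s i<n) = ℕ.≤-trans (term≤sum f (g ∘ suc) i<n) (ℕ.m≤n+m _ (f (g 0)))

sum-last : ∀ (f g : ℕ → ℕ) n → sum (map f (applyUpTo g (suc n))) ≡ sum (map f (applyUpTo g n)) ℕ.+ f (g n)
sum-last f g zero    = ℕ.+-comm (f (g 0)) 0
sum-last f g (suc n) = ≡.trans (cong (f (g 0) ℕ.+_) (sum-last f (g ∘ suc) n)) (≡.sym (ℕ.+-assoc (f (g 0)) _ _))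

-- Σ i (i - 1) over i < n, twice a tetrahedral number; i (i - 1) is the degree of Δ for the pair (i
-- + 1, i).
pyramid : ℕ → ℕ
pyramid zero    = 0
pyramid (suc n) = pyramid n ℕ.+ n ℕ.* (n ℕ.∸ 1)

pyramid≤ : ∀ (f : ℕ → ℕ) n → (∀ i → i ℕ.< n → i ℕ.* (i ℕ.∸ 1) ℕ.≤ f (suc i)) →
           pyramid n ℕ.≤ sum (map f (applyUpTo suc n))
pyramid≤ f zero    h = z≤n
pyramid≤ f (suc n) h = ℕ.≤-trans
  (ℕ.+-mono-≤ (pyramid≤ f n λ i i<n → h i (ℕ.m<n⇒m<1+n i<n)) (h n ℕ.≤-refl)) (ℕ.≤-reflexive (≡.sym (sum-last f suc n)))

3*pyramid : ∀ n → 3 ℕ.* pyramid (2 ℕ.+ n) ≡ (2 ℕ.+ n) ℕ.* (1 ℕ.+ n) ℕ.* n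
3*pyramid zero    = refl
3*pyramid (suc n) = ≡.trans (ℕ.*-distribˡ-+ 3 (pyramid (2 ℕ.+ n)) ((2 ℕ.+ n) ℕ.* (1 ℕ.+ n))) (≡.trans
  (cong (ℕ._+ 3 ℕ.* ((2 ℕ.+ n) ℕ.* (1 ℕ.+ n))) (3*pyramid n))
  (solve 1 (λ n → (con 2 :+ n) :* (con 1 :+ n) :* n :+ con 3 :* ((con 2 :+ n) :* (con 1 :+ n)) :=
    (con 3 :+ n) :* (con 2 :+ n) :* (con 1 :+ n)) refl n))
  where open ℕSolver

-- The pairs (i + 1, i) alone contribute cubically many roots.
pyramid≤total : ∀ Y → pyramid Y ℕ.≤ total coprimeWeight (grid Y)
pyramid≤total Y = ℕ.≤-trans (pyramid≤ row Y row≥)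
  (ℕ.≤-reflexive (≡.sym (total-cartesianProduct coprimeWeight (applyUpTo suc Y) (applyUpTo suc Y))))
  where
  row : ℕ → ℕ
  row p = sum (map (λ q → coprimeWeight (p , q)) (applyUpTo suc Y))
  row≥ : ∀ i → i ℕ.< Y → i ℕ.* (i ℕ.∸ 1) ℕ.≤ row (suc i)
  row≥ zero    _   = z≤n
  row≥ (suc i) i<Y = ℕ.≤-trans (ℕ.≤-reflexive (≡.sym consecutive))
    (term≤sum (λ q → coprimeWeight (2 ℕ.+ i , q)) suc (ℕ.<-trans ℕ.≤-refl i<Y))
    where
    consecutive : coprimeWeight (2 ℕ.+ i , suc i) ≡ suc i ℕ.* i
    consecutive rewrite dec-true (gcd (2 ℕ.+ i) (suc i) ℕ.≟ 1)
      (subst (λ k → gcd k (suc i) ≡ 1) (ℕ.+-comm (suc i) 1) (coprime⇒gcd≡1 (coprime-+ {1} {suc i} (1-coprimeTo (suc i))))) = refl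

-- With Y = n + 2, three times the pyramid is (n + 2)(n + 1) n. Since n + 2 ≤ 2 (n + 1), the claim
-- follows from 6 K < n, that is Y ≥ 6 K + 3.
cubic-beats-quadratic : ∀ K Y → 6 ℕ.* K ℕ.+ 3 ℕ.≤ Y → K ℕ.* (Y ℕ.* Y) ℕ.< pyramid Y
cubic-beats-quadratic K Y h = subst (λ Y → K ℕ.* (Y ℕ.* Y) ℕ.< pyramid Y) (ℕ.m+[n∸m]≡n 2≤Y)
  (ℕ.*-cancelˡ-< 3 _ _ (ℕ.<-≤-trans bound (ℕ.≤-reflexive (≡.sym (3*pyramid n)))))
  where
  n = Y ℕ.∸ 2
  2≤Y : 2 ℕ.≤ Y
  2≤Y = ℕ.≤-trans (ℕ.≤-trans (ℕ.n≤1+n 2) (ℕ.m≤n+m 3 (6 ℕ.* K))) h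
  6K<n : 6 ℕ.* K ℕ.< n
  6K<n = ℕ.+-cancelʳ-≤ 2 _ _ (ℕ.≤-trans (ℕ.≤-reflexive (solve 1 (λ k → (con 1 :+ k) :+ con 2 := k :+ con 3) refl (6 ℕ.* K)))
    (ℕ.≤-trans h (ℕ.≤-reflexive (≡.sym (ℕ.m∸n+n≡m 2≤Y)))))
    where open ℕSolver
  bound : 3 ℕ.* (K ℕ.* ((2 ℕ.+ n) ℕ.* (2 ℕ.+ n))) ℕ.< (2 ℕ.+ n) ℕ.* (1 ℕ.+ n) ℕ.* n
  bound = begin-strict
    3 ℕ.* (K ℕ.* ((2 ℕ.+ n) ℕ.* (2 ℕ.+ n)))
      ≤⟨ ℕ.*-monoʳ-≤ 3 (ℕ.*-monoʳ-≤ K (ℕ.*-monoʳ-≤ (2 ℕ.+ n) (ℕ.≤-trans (ℕ.m≤m+n (2 ℕ.+ n) n)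
           (ℕ.≤-reflexive (solve 1 (λ n → (con 2 :+ n) :+ n := con 2 :* (con 1 :+ n)) refl n))))) ⟩
    3 ℕ.* (K ℕ.* ((2 ℕ.+ n) ℕ.* (2 ℕ.* (1 ℕ.+ n))))
      ≡⟨ solve 2 (λ K n → con 3 :* (K :* ((con 2 :+ n) :* (con 2 :* (con 1 :+ n)))) :=
           (con 2 :+ n) :* (con 1 :+ n) :* (con 6 :* K)) refl K n ⟩
    (2 ℕ.+ n) ℕ.* (1 ℕ.+ n) ℕ.* (6 ℕ.* K)
      <⟨ ℕ.*-monoʳ-< ((2 ℕ.+ n) ℕ.* (1 ℕ.+ n)) 6K<n ⟩
    (2 ℕ.+ n) ℕ.* (1 ℕ.+ n) ℕ.* n ∎
    where
    open ℕ.≤-Reasoning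
    open ℕSolver

-- Ampleness of the families of roots

module _ (rs : ℕ → ℕ → List 𝕋) where
  private
    allRoots : List (ℕ × ℕ) → List 𝕋
    allRoots ps = map proj₂ (withRoots rs ps)

  record Good (pq : ℕ × ℕ) : Set where
    field
      p≢0  : NonZero (proj₁ pq)
      q≢0  : NonZero (proj₂ pq)
      sums : PowerSums (proj₁ pq) (proj₂ pq) (rs (proj₁ pq) (proj₂ pq))
  open Good

  ∑-++ : ∀ (αs βs : List 𝕋) g → ∑ (αs ++ βs) g ≈ ∑ αs g + ∑ βs g
  ∑-++ []       βs g = ≈-sym (ℝ-Ring.+-identityˡ _)
  ∑-++ (α ∷ αs) βs g = ≈-trans (+-cong ≈-refl (∑-++ αs βs g)) (≈-sym (ℝ-Ring.+-assoc (g α) (∑ αs g) (∑ βs g)))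

  allRoots-∷ : ∀ p q ps → allRoots ((p , q) ∷ ps) ≡ rs p q ++ allRoots ps
  allRoots-∷ p q ps = ≡.trans (map-++ proj₂ (map ((p , q) ,_) (rs p q)) (withRoots rs ps))
    (cong (_++ allRoots ps) (map-proj₂ (rs p q)))
    where
    map-proj₂ : ∀ αs → map proj₂ (map ((p , q) ,_) αs) ≡ αs
    map-proj₂ []       = refl
    map-proj₂ (α ∷ αs) = cong (α ∷_) (map-proj₂ αs)

  total≤length : ∀ {ps} → All Good ps → total weight ps ℕ.≤ length (allRoots ps)
  total≤length []                        = z≤n
  total≤length {(p , q) ∷ ps} (g ∷ good) = ℕ.≤-trans
    (ℕ.+-mono-≤ (degree≤length {p} {q} {{p≢0 g}} {{q≢0 g}} (sums g)) (total≤length good))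
    (ℕ.≤-reflexive (≡.sym (≡.trans (cong length (allRoots-∷ p q ps)) (length-++ (rs p q)))))

  ∣∑allRoots∣≤ : ∀ {ps} → All Good ps → ∀ u k → 0 ℕ.< k →
    ∣ ∑ (allRoots ps) (λ α → Re (pow (u · conj α) k)) ∣ ≤ fromℕ (length ps ℕ.* (suc k ℕ.* suc k))
  ∣∑allRoots∣≤ []                        u k 0<k = ≤-pointwise λ _ → ℚ.≤-refl
  ∣∑allRoots∣≤ {(p , q) ∷ ps} (g ∷ good) u k 0<k = begin
    ∣ ∑ (allRoots ((p , q) ∷ ps)) h ∣             ≈⟨ ∣∣-cong (ℝ-Ring.reflexive (cong (λ αs → ∑ αs h) (allRoots-∷ p q ps))) ⟩
    ∣ ∑ (rs p q ++ allRoots ps) h ∣               ≈⟨ ∣∣-cong (∑-++ (rs p q) (allRoots ps) h) ⟩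
    ∣ ∑ (rs p q) h + ∑ (allRoots ps) h ∣          ≤⟨ ∣x+y∣≤ _ _ ⟩
    ∣ ∑ (rs p q) h ∣ + ∣ ∑ (allRoots ps) h ∣
      ≤⟨ +-mono-≤ (∣rotated-sum∣≤ {p} {q} {{p≢0 g}} {{q≢0 g}} (sums g) u k 0<k) (∣∑allRoots∣≤ good u k 0<k) ⟩
    fromℕ (suc k ℕ.* suc k) + fromℕ (length ps ℕ.* (suc k ℕ.* suc k))
      ≈⟨ fromℕ-+ (suc k ℕ.* suc k) (length ps ℕ.* (suc k ℕ.* suc k)) ⟨
    fromℕ (suc (length ps) ℕ.* (suc k ℕ.* suc k)) ∎
    where
    open ≤-Reasoning
    h : 𝕋 → ℝ
    h α = Re (pow (u · conj α) k)

  ample : ∀ N c Y {ps} → 6 ℕ.* (c ℕ.* (N ℕ.* N)) ℕ.+ 3 ℕ.≤ Y → All Good ps →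
    length ps ℕ.≤ Y ℕ.* Y → pyramid Y ℕ.≤ total weight ps → Ample N c (allRoots ps)
  ample N c Y {ps} Y≥ good ps≤ pyramid≤ = record
    -- At most Y^2 pairs occur, each contributing at most (k + 1)^2 ≤ N^2 for k < N. So c η = K Y^2
    -- with K = c N^2, which fixes the threshold on Y.
    { η     = (Y ℕ.* Y) ℕ.* (N ℕ.* N)
    ; small = λ u k 0<k k<N → ≤-trans (∣∑allRoots∣≤ good u k 0<k)
        (fromℕ-mono {length ps ℕ.* (suc k ℕ.* suc k)} {(Y ℕ.* Y) ℕ.* (N ℕ.* N)} (ℕ.*-mono-≤ ps≤ (ℕ.*-mono-≤ k<N k<N)))
    ; large = ℕ.≤-<-trans
        (ℕ.≤-reflexive (solve 3 (λ c Y N → c :* ((Y :* Y) :* (N :* N)) := (c :* (N :* N)) :* (Y :* Y)) refl c Y N))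
        (ℕ.<-≤-trans (cubic-beats-quadratic (c ℕ.* (N ℕ.* N)) Y Y≥) (ℕ.≤-trans pyramid≤ (total≤length good)))
    }
    where open ℕSolver

grid-positive : ∀ Y → All (λ (p , q) → NonZero p × NonZero q) (grid Y)
grid-positive Y = cartesianProduct⁺ (≡.setoid ℕ) (≡.setoid ℕ) (applyUpTo suc Y) (applyUpTo suc Y)
  λ p∈ q∈ → All.lookup allPositive p∈ , All.lookup allPositive q∈
  where
  allPositive : All NonZero (applyUpTo suc Y)
  allPositive = applyUpTo⁺₂ suc Y λ _ → _

length-cartesianProduct : ∀ {A B : Set} (xs : List A) (ys : List B) →
  length (cartesianProduct xs ys) ≡ length xs ℕ.* length ys
length-cartesianProduct []       ys = refl
length-cartesianProduct (x ∷ xs) ys = ≡.trans (length-++ (map (x ,_) ys))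
  (≡.cong₂ ℕ._+_ (length-map (x ,_) ys) (length-cartesianProduct xs ys))

length-grid : ∀ Y → length (grid Y) ≡ Y ℕ.* Y
length-grid Y = ≡.trans (length-cartesianProduct (applyUpTo suc Y) (applyUpTo suc Y))
  (≡.cong₂ ℕ._*_ (length-applyUpTo suc Y) (length-applyUpTo suc Y))

∫-sum : ∀ {A : Set} (α : A → 𝕋) ω f → ∫ (foldr _+ᴹ_ 0ᴹ (map (δ ∘ α) ω)) f ≡ ∑ (map α ω) (f ⟨_⟩)
∫-sum α []      f = refl
∫-sum α (x ∷ ω) f = cong (f ⟨ α x ⟩ +_) (∫-sum α ω f)

floor≥ : ∀ X {n} → fromℕ n ≤ value X → n ℕ.≤ ⌊ X ⌋
floor≥ X {n} n≤X with n ℕ.≤? ⌊ X ⌋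
... | yes h = h
... | no  h = contradiction (≤-trans (fromℕ-mono {suc ⌊ X ⌋} {n} (ℕ.≰⇒> h)) n≤X) (<floor+1 X)

-- From ample families to weak convergence

module _ (source : ∀ N c → ∃ (Ample N c)) (ν : Measure) (haar : IsNormalizedHaar ν)
  {A : Set} (α : A → 𝕋) (ω : Cutoff → List A)
  (ampleω : ∀ N c → ∃ λ Y → ∀ X → Y ℕ.≤ ⌊ X ⌋ → Ample N c (map α (ω X))) where

  converges : ConvergesWeakly {λ X → NonZero (length (ω X))} (λ X d → empirical α (ω X) {{d}}) ν
  converges f ε = fromℕ Y , λ X Y≤X → let a = proj₂ (ampleω N c) X (floor≥ X Y≤X) in
    nonEmpty X a , close-to-integral (ω X) {{nonEmpty X a}} (proj₂ (proj₂ eq) (map α (ω X)) a)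
    where
    -- As 1 ≤ ε j, the error 1 / (j + 1) granted by `equidistributed` is at most ε; the successor
    -- avoids a division by zero.
    j = proj₁ (reciprocal ε)
    1≤εj = proj₂ (reciprocal ε)
    eq = equidistributed source ν haar f j
    N = proj₁ eq
    c = proj₁ (proj₂ eq)
    Y = proj₁ (ampleω N c)
    nonEmpty : ∀ X → Ample N c (map α (ω X)) → NonZero (length (ω X))
    nonEmpty X a = ℕ.>-nonZero (ℕ.≤-<-trans z≤n (subst (c ℕ.* Ample.η a ℕ.<_) (length-map α (ω X)) (Ample.large a)))
    close-to-integral : ∀ ω .{{_ : NonZero (length ω)}} →
      fromℕ (suc j) * ∣ ∑ (map α ω) (f ⟨_⟩) - size (map α ω) * ∫ ν f ∣ ≤ size (map α ω) →
      ∣ ∫ (empirical α ω) f - ∫ ν f ∣ ≤ fromℚ ε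
    close-to-integral ω h = *-cancelˡ-≤ j (begin
      J * ∣ fromℚ r * ∫ (foldr _+ᴹ_ 0ᴹ (map (δ ∘ α) ω)) f - I ∣
        ≈⟨ *-cong ≈-refl (∣∣-cong (+-cong (*-cong ≈-refl (ℝ-Ring.reflexive (∫-sum α ω f))) ≈-refl)) ⟩
      J * ∣ fromℚ r * S - I ∣
        ≈⟨ *-cong ≈-refl (∣∣-cong (+-cong ≈-refl (-‿cong (≈-trans (≈-sym (ℝ-Ring.*-identityˡ I)) (*-cong (≈-sym rn≈1) ≈-refl))))) ⟩
      J * ∣ fromℚ r * S - (fromℚ r * n) * I ∣
        ≈⟨ *-cong ≈-refl (≈-trans (∣∣-cong (solve 4 (λ r s n i → r :* s :- (r :* n) :* i := r :* (s :- n :* i)) ≈-refl (fromℚ r) S n I))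
             (≈-trans (∣xy∣≈ _ _) (*-cong (0≤⇒∣x∣≈x 0≤r) ≈-refl))) ⟩
      J * (fromℚ r * ∣ S - n * I ∣)
        ≈⟨ solve 3 (λ j r x → j :* (r :* x) := r :* (j :* x)) ≈-refl J (fromℚ r) ∣ S - n * I ∣ ⟩
      fromℚ r * (J * ∣ S - n * I ∣)
        ≤⟨ *-monoˡ-≤ 0≤r (subst (λ k → J * ∣ S - fromℕ k * I ∣ ≤ fromℕ k) (length-map α ω) h) ⟩
      fromℚ r * n
        ≈⟨ rn≈1 ⟩
      1ℝ
        ≤⟨ fromℚ-mono {1ℚ} 1≤εj ⟩
      fromℚ (ε ℚ.* (ℤ.+ j ℚ./ 1))
        ≈⟨ pointwise (λ _ → refl) ⟩
      fromℚ ε * fromℕ j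
        ≤⟨ *-monoˡ-≤ (fromℚ-mono {0ℚ} {ε} (pos {ε})) (fromℕ-mono {j} {suc j} (ℕ.n≤1+n j)) ⟩
      fromℚ ε * J
        ≈⟨ ℝ-Ring.*-comm (fromℚ ε) J ⟩
      J * fromℚ ε ∎)
      where
      open ≤-Reasoning
      open ℝ-Solver
      J = fromℕ (suc j)
      I = ∫ ν f
      S = ∑ (map α ω) (f ⟨_⟩)
      n = fromℕ (length ω)
      r = ℤ.+ 1 ℚ./ length ω
      0≤r : 0ℝ ≤ fromℚ r
      0≤r = fromℚ-mono {0ℚ} {r} (pos {r} {{ℚ.normalize-pos 1 (length ω)}})
      rn≈1 : fromℚ r * n ≈ 1ℝ
      rn≈1 = pointwise λ _ → 1/n*n (length ω)

theorem3 : (μ𝕋 : Measure) → IsNormalizedHaar μ𝕋 →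
    (roots : ℕ → ℕ → List 𝕋) →
    (∀ p q → .{{_ : NonZero p}} → .{{_ : NonZero q}} → IsRootMultiset p q (roots p q)) →
    (rootSet : ℕ → ℕ → List 𝕋) →
    (∀ p q → .{{_ : NonZero p}} → .{{_ : NonZero q}} → gcd p q ≡ 1 → IsRootSet p q (rootSet p q)) →
    ConvergesWeakly (μ roots) μ𝕋 × ConvergesWeakly (μ′ rootSet) μ𝕋
theorem3 μ𝕋 haar roots isRoots rootSet isRootSet =
    converges source μ𝕋 haar proj₂ (Ω roots) (λ N c → cutoff N c , λ X h → ampleGrid N c ⌊ X ⌋ h)
  , converges source μ𝕋 haar proj₂ (Ω₁ rootSet) (λ N c → cutoff N c , λ X h → ampleCoprime N c ⌊ X ⌋ h)
  where
  cutoff : ℕ → ℕ → ℕ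
  cutoff N c = 6 ℕ.* (c ℕ.* (N ℕ.* N)) ℕ.+ 3

  ampleGrid : ∀ N c Y → cutoff N c ℕ.≤ Y → Ample N c (map proj₂ (withRoots roots (grid Y)))
  ampleGrid N c Y h = ample roots N c Y h
    (All.map (λ { {p , q} (p≢0 , q≢0) → record { p≢0 = p≢0 ; q≢0 = q≢0
      ; sums = powerSums p q {{p≢0}} {{q≢0}} {roots p q} (isRoots p q {{p≢0}} {{q≢0}}) } }) (grid-positive Y))
    (ℕ.≤-reflexive (length-grid Y))
    (ℕ.≤-trans (pyramid≤total Y) (total-coprime≤ (grid Y)))

  ampleCoprime : ∀ N c Y → cutoff N c ℕ.≤ Y → Ample N c (map proj₂ (withRoots rootSet (filter Coprime? (grid Y))))
  ampleCoprime N c Y h = ample rootSet N c Y h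
    (All.zipWith (λ { {p , q} ((p≢0 , q≢0) , coprime) → record { p≢0 = p≢0 ; q≢0 = q≢0
      ; sums = rootSet-powerSums p q {{p≢0}} {{q≢0}} coprime {roots p q} {rootSet p q} (isRoots p q {{p≢0}} {{q≢0}}) (isRootSet p q {{p≢0}} {{q≢0}} coprime) } })
      (filter⁺ Coprime? (grid-positive Y) , all-filter Coprime? (grid Y)))
    (ℕ.≤-trans (length-filter Coprime? (grid Y)) (ℕ.≤-reflexive (length-grid Y)))
    (ℕ.≤-trans (pyramid≤total Y) (ℕ.≤-reflexive (total-filter (grid Y))))

  -- The roots counted with multiplicity, at the least admissible cutoff, serve as reference family
  -- for both measures.
  source : ∀ N c → ∃ (Ample N c)
  source N c = _ , ampleGrid N c (cutoff N c) ℕ.≤-refl
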